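{- For every real $\varepsilon > 0$, there exists $q_0$ such that for all integers $q\ge q_0$ the following holds: If $G$ is a simple graph that is properly edge colored with $(2+\varepsilon)q$ colors, with at least $(2+\varepsilon)qr$ edges for some integer $r\le q$, and such that no color appears on more than $q$ edges, then $G$ has a rainbow matching of size $r$.
   Context: A proper edge coloring assigns colors to edges so that edges sharing a vertex get different colors. A matching is rainbow if its edges have pairwise distinct colors.
   Formalization: The formal theorem takes ε to be a positive rational number instead of a positive real number. -}

module Defs where

open import Data.Nat using (ℕ; _≤_; _<_)
open import Data.Fin using (Fin; toℕ; _≟_)
open import Data.List using (length; filter; allFin)
open import Data.Product using (_×_; _,_; proj₁; proj₂)
open import Data.Integer using (+_)
open import Data.Rational using (ℚ; _/_)
open import Relation.Binary.PropositionalEquality using (_≡_; _≢_)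
open import Function.Definitions using (Injective)
import Data.Empty
open import Data.Sum using (_⊎_)
open import Data.Product using (Σ)

ℕ→ℚ : ℕ → ℚ
ℕ→ℚ n = + n / 1

-- A finite simple graph on vertex set Fin n, given by an enumeration of its
-- m edges  e ↦ (u , v)  with u < v (no loops, canonical orientation) and
-- the enumeration injective (no multiple edges), together with an edge
-- colouring with palette Fin k.
record ColouredGraph (n m k : ℕ) : Set where
  field
    ends      : Fin m → Fin n × Fin n
    ordered   : ∀ e → toℕ (proj₁ (ends e)) < toℕ (proj₂ (ends e))
    simple    : Injective _≡_ _≡_ ends
    colour    : Fin m → Fin k

  _∋ᵥ_ : Fin m → Fin n → Set
  e ∋ᵥ v = (proj₁ (ends e) ≡ v) ⊎ (proj₂ (ends e) ≡ v)

  Adjacent : Fin m → Fin m → Set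
  Adjacent e f = Σ (Fin n) (λ v → (e ∋ᵥ v) × (f ∋ᵥ v))

  Proper : Set
  Proper = ∀ e f → e ≢ f → Adjacent e f → colour e ≢ colour f

  colourCount : Fin k → ℕ
  colourCount c = length (filter (λ e → colour e ≟ c) (allFin m))

  record RainbowMatching (r : ℕ) : Set where
    field
      edge      : Fin r → Fin m
      disjoint  : ∀ i j → i ≢ j → ∀ v → edge i ∋ᵥ v → edge j ∋ᵥ v → Data.Empty.⊥
      rainbow   : Injective _≡_ _≡_ (λ i → colour (edge i))

{-# OPTIONS --safe #-}
module Submission where

-- Vertices and colours are the points of a linear 3-uniform hypergraph with edges (u , v , colour), and
-- a rainbow matching is a matching of it. Put d = 2q + g with g about εq/2 and D = d + Δ ≤ (2 + ε) q.
--
-- Nibble: a linear 3-graph with m edges and degrees at most d has a matching of size (1 - o(1)) m / d.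
-- Expose the edges one by one; an edge e is selected with odds w = ρ z(e₀) z(e₁) z(e₂), where z(x) is the
-- inverse probability that x has survived, so that z and the fractional matching w stay martingales.
-- Instead of tossing coins, follow the outcome that does not lower the potential
-- (matched edges + remaining weight - penalty for deviating loads) by more than its expectation.
--
-- Exact size: delete edges with two points of degree above d, until the set I of points of degree
-- above d is independent. If |I| is at least 3r - d - 2, induction gives a matching of size r - |I|
-- avoiding I, and the points of I are matched greedily. Otherwise truncating the degrees at d leaves
-- (1 + Ω(1)) d r edges, by counting the edges that meet I and the points which were above d, and the
-- nibble applies.

-- The nibble alone is not enough: from `D r` edges with degrees at most `D` it yields (1 - o(1)) r
-- edges, not r. The slack must come from lowering the degree bound from `D` to `d`, and truncation
-- is costly exactly when many points lie above `d`. Such points help in another way: one of them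
-- can be matched as long as at most `d` of its edges are blocked. A matching of size r - |I| off I
-- occupies 3 (r - |I|) points, and every greedy edge before the last adds two, hence the condition
-- 3 r ≤ 2 + d + |I|. If it fails, `d ≥ 2 r + g` forces `e = r - |I| ≥ g`, which is linear in q, and
-- the surplus over `d r` edges is of order `g e Δ / d`. The same gap `d - 2 r ≥ g` is what survives
-- in the count of edges meeting I and the points that were above `d`. No probability space is
-- needed: two edges share at most one point, so products of values of z over distinct points of an
-- unexposed edge are affine in the single number `τ` that encodes the outcome, and the martingale
-- property is a polynomial identity.

open import Level using (0ℓ)
open import Algebra.Bundles using (CommutativeRing; RawRing; CommutativeSemiring)
open import Algebra.Structures using (IsCommutativeRing; IsCommutativeSemiring)
open import Data.Bool using (if_then_else_)
open import Data.Empty using (⊥; ⊥-elim)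
open import Data.Integer as ℤ using (ℤ)
import Data.Integer.Properties as ℤ
open import Data.List using (List; []; _∷_; _++_; length; map; filter; take; lookup; allFin)
open import Data.List.Membership.Propositional using (_∈_; _∉_; find)
open import Data.List.Membership.Propositional.Properties using (∈-filter⁻; ∈-++⁺ˡ; ∈-++⁺ʳ; ∈-++⁻; ∈-map⁺; ∈-map⁻; ∈-allFin; ∈-lookup)
open import Data.List.Properties using (length-++; length-take; length-tabulate)
open import Data.List.Relation.Unary.All as All using (All; []; _∷_)
import Data.List.Relation.Unary.All.Properties as All
open import Data.List.Relation.Unary.AllPairs using (AllPairs; []; _∷_)
import Data.List.Relation.Unary.AllPairs.Properties as AllPairs
open import Data.List.Relation.Unary.Any as Any using (Any; here; there)
open import Data.List.Relation.Unary.Unique.Propositional using (Unique)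
import Data.List.Relation.Unary.Unique.Propositional.Properties as Unique
open import Data.Maybe using (Maybe; just; nothing)
open import Data.Nat as ℕ using (ℕ; zero; suc; z≤n; s≤s)
import Data.Nat.DivMod as ℕ
import Data.Nat.Properties as ℕ
open import Data.Nat.Solver using (module +-*-Solver)
open import Data.Product using (Σ; ∃; _×_; _,_; proj₁; proj₂)
open import Data.Product.Properties using (×-≡,≡→≡)
open import Data.Rational as ℚ using (ℚ)
import Data.Rational.Properties as ℚ
open import Data.Rational.Unnormalised as ℚᵘ using (mkℚᵘ)
import Data.Rational.Unnormalised.Properties as ℚᵘ
open import Data.Sum using (_⊎_; inj₁; inj₂; [_,_]′)
open import Data.Sum.Properties using (≡-dec; inj₁-injective; inj₂-injective)
open import Relation.Binary.Definitions using (DecidableEquality)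
open import Relation.Binary.PropositionalEquality using (_≡_; _≢_; refl; sym; trans; cong; cong₂; subst; subst₂; module ≡-Reasoning)
open import Relation.Nullary using (Dec; yes; no; does; ¬_; contradiction)
open import Relation.Nullary.Decidable using (_×-dec_; _⊎-dec_; ¬?; decidable-stable; toWitness; toWitnessFalse)
open import Relation.Unary using (Pred; Decidable)

-- Ordered semirings and fields

record OrderedSemiring : Set₁ where
  infix 4 _≤_
  infixl 7 _*_
  infixl 6 _+_
  field
    Carrier : Set
    _+_ _*_ : Carrier → Carrier → Carrier
    0# 1#   : Carrier
    _≤_     : Carrier → Carrier → Set
    isCommutativeSemiring : IsCommutativeSemiring _≡_ _+_ _*_ 0# 1#
    ≤-refl   : ∀ {a} → a ≤ a
    ≤-trans  : ∀ {a b c} → a ≤ b → b ≤ c → a ≤ c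
    +-mono-≤ : ∀ {a b c d} → a ≤ b → c ≤ d → a + c ≤ b + d
    0≤1      : 0# ≤ 1#

  commutativeSemiring : CommutativeSemiring 0ℓ 0ℓ
  commutativeSemiring = record { isCommutativeSemiring = isCommutativeSemiring }

  open IsCommutativeSemiring isCommutativeSemiring public
    using (+-identityˡ; +-identityʳ; +-assoc; +-comm; *-comm; *-assoc; *-identityˡ; *-identityʳ; zeroˡ; zeroʳ; distribˡ; distribʳ)

  ≤-reflexive : ∀ {a b} → a ≡ b → a ≤ b
  ≤-reflexive refl = ≤-refl

  +-nonneg : ∀ {a b} → 0# ≤ a → 0# ≤ b → 0# ≤ a + b
  +-nonneg p q = ≤-trans (≤-reflexive (sym (+-identityˡ 0#))) (+-mono-≤ p q)

  -- The separate clause for one makes `ι 1` reduce to `1#` with no trailing `0#`.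
  ι : ℕ → Carrier
  ι zero          = 0#
  ι (suc zero)    = 1#
  ι (suc (suc n)) = 1# + ι (suc n)

-- Finite sums over lists, shared by counts in ℕ and weights in a field

module Sum (S : OrderedSemiring) where
  open OrderedSemiring S
  open import Algebra.Solver.Ring.NaturalCoefficients.Default commutativeSemiring

  private
    variable
      A B : Set

  ∑ : List A → (A → Carrier) → Carrier
  ∑ []       f = 0#
  ∑ (x ∷ xs) f = f x + ∑ xs f

  ∑-cong : ∀ (xs : List A) {f g} → (∀ {x} → x ∈ xs → f x ≡ g x) → ∑ xs f ≡ ∑ xs g
  ∑-cong []       p = refl
  ∑-cong (x ∷ xs) p = cong₂ _+_ (p (here refl)) (∑-cong xs (λ i → p (there i)))

  ∑-mono : ∀ (xs : List A) {f g} → (∀ {x} → x ∈ xs → f x ≤ g x) → ∑ xs f ≤ ∑ xs g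
  ∑-mono []       p = ≤-refl
  ∑-mono (x ∷ xs) p = +-mono-≤ (p (here refl)) (∑-mono xs (λ i → p (there i)))

  ∑-zero : ∀ (xs : List A) {f} → (∀ {x} → x ∈ xs → f x ≡ 0#) → ∑ xs f ≡ 0#
  ∑-zero []       p = refl
  ∑-zero (x ∷ xs) p = trans (cong₂ _+_ (p (here refl)) (∑-zero xs (λ i → p (there i)))) (+-identityˡ 0#)

  ∑-nonneg : ∀ (xs : List A) {f} → (∀ {x} → x ∈ xs → 0# ≤ f x) → 0# ≤ ∑ xs f
  ∑-nonneg []       p = ≤-refl
  ∑-nonneg (x ∷ xs) p = +-nonneg (p (here refl)) (∑-nonneg xs (λ i → p (there i)))

  ∑-+ : ∀ (xs : List A) f g → ∑ xs (λ x → f x + g x) ≡ ∑ xs f + ∑ xs g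
  ∑-+ []       f g = sym (+-identityˡ 0#)
  ∑-+ (x ∷ xs) f g = trans (cong (λ t → _ + t) (∑-+ xs f g))
    (solve 4 (λ a b c d → (a :+ b) :+ (c :+ d) := (a :+ c) :+ (b :+ d)) refl (f x) (g x) (∑ xs f) (∑ xs g))

  ∑-*ˡ : ∀ (xs : List A) c f → ∑ xs (λ x → c * f x) ≡ c * ∑ xs f
  ∑-*ˡ []       c f = sym (zeroʳ c)
  ∑-*ˡ (x ∷ xs) c f = trans (cong (λ t → _ + t) (∑-*ˡ xs c f)) (sym (distribˡ c _ _))

  ∑-*ʳ : ∀ (xs : List A) c f → ∑ xs (λ x → f x * c) ≡ ∑ xs f * c
  ∑-*ʳ []       c f = sym (zeroˡ c)
  ∑-*ʳ (x ∷ xs) c f = trans (cong (λ t → _ + t) (∑-*ʳ xs c f)) (sym (distribʳ c _ _))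

  ∑-++ : ∀ (xs ys : List A) f → ∑ (xs ++ ys) f ≡ ∑ xs f + ∑ ys f
  ∑-++ []       ys f = sym (+-identityˡ _)
  ∑-++ (x ∷ xs) ys f = trans (cong (λ t → _ + t) (∑-++ xs ys f)) (sym (+-assoc _ _ _))

  ∑-swap : ∀ (xs : List A) (ys : List B) (f : A → B → Carrier) → ∑ xs (λ x → ∑ ys (f x)) ≡ ∑ ys (λ y → ∑ xs (λ x → f x y))
  ∑-swap []       ys f = sym (∑-zero ys {λ _ → 0#} (λ _ → refl))
  ∑-swap (x ∷ xs) ys f = trans (cong (λ t → ∑ ys (f x) + t) (∑-swap xs ys f)) (sym (∑-+ ys (f x) (λ y → ∑ xs (λ x′ → f x′ y))))

  ∑-member : ∀ {xs : List A} {f x} → x ∈ xs → (∀ {y} → y ∈ xs → 0# ≤ f y) → f x ≤ ∑ xs f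
  ∑-member {xs = y ∷ xs} (here refl) p = ≤-trans (≤-reflexive (sym (+-identityʳ _)))
    (+-mono-≤ ≤-refl (∑-nonneg xs (λ i → p (there i))))
  ∑-member {xs = y ∷ xs} (there i) p = ≤-trans (≤-reflexive (sym (+-identityˡ _)))
    (+-mono-≤ (p (here refl)) (∑-member i (λ j → p (there j))))

  ∑-mono-strict : ∀ {xs : List A} {f g x c} → x ∈ xs → (∀ {y} → y ∈ xs → f y ≤ g y) → c + f x ≤ g x → c + ∑ xs f ≤ ∑ xs g
  ∑-mono-strict {xs = y ∷ xs} (here refl) p q = ≤-trans (≤-reflexive (sym (+-assoc _ _ _)))
    (+-mono-≤ q (∑-mono xs (λ i → p (there i))))
  ∑-mono-strict {xs = y ∷ xs} {f} {c = c} (there i) p q = ≤-trans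
    (≤-reflexive (solve 3 (λ a b c → c :+ (a :+ b) := a :+ (c :+ b)) refl (f y) (∑ xs f) c))
    (+-mono-≤ (p (here refl)) (∑-mono-strict i (λ j → p (there j)) q))

  ∑-atMostOne : ∀ {xs : List A} {f} (P : A → Set) → Unique xs → (∀ x → f x ≡ 0# ⊎ (f x ≤ 1# × P x)) →
                (∀ {x y} → P x → P y → x ≡ y) → ∑ xs f ≤ 1#
  ∑-atMostOne {xs = []} P u c i = 0≤1
  ∑-atMostOne {xs = x ∷ xs} {f} P (x∉ ∷ u) c i with c x
  ... | inj₁ fx≡0 = ≤-trans (≤-reflexive (trans (cong (λ t → t + ∑ xs f) fx≡0) (+-identityˡ _))) (∑-atMostOne P u c i)
  ... | inj₂ (fx≤1 , px) = ≤-trans (≤-reflexive (trans (cong (λ t → f x + t) (∑-zero xs rest)) (+-identityʳ _))) fx≤1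
    where
    rest : ∀ {y} → y ∈ xs → f y ≡ 0#
    rest {y} y∈ with c y
    ... | inj₁ e = e
    ... | inj₂ (_ , py) = contradiction (i px py) (All.lookup x∉ y∈)

  -- Serves for a row of the codegree matrix: the diagonal entry, a degree, is charged to `c`, and
  -- every other entry, 0 or 1, to `g`.
  ∑-bound-except : ∀ {xs : List A} {f g : A → Carrier} {x₀ c} → Unique xs → (∀ x → 0# ≤ g x) → 0# ≤ c →
                   (∀ {x} → x ∈ xs → x ≢ x₀ → f x ≤ g x) → (∀ {x} → x ∈ xs → x ≡ x₀ → f x ≤ c) →
                   Dec (x₀ ∈ xs) → ∑ xs f ≤ c + ∑ xs g
  ∑-bound-except {xs = []} u g≥0 c≥0 p q d = ≤-trans c≥0 (≤-reflexive (sym (+-identityʳ _)))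
  ∑-bound-except {xs = x ∷ xs} {f} {g} {x₀} {c} (x∉ ∷ u) g≥0 c≥0 p q (yes (here refl)) =
    +-mono-≤ (q (here refl) refl)
      (≤-trans (≤-reflexive (sym (+-identityˡ _)))
        (+-mono-≤ (g≥0 x) (∑-mono xs λ {y} i → p (there i) λ e → All.lookup x∉ i (sym e))))
  ∑-bound-except {xs = x ∷ xs} {f} {g} {x₀} {c} (x∉ ∷ u) g≥0 c≥0 p q (yes (there i)) =
    ≤-trans (+-mono-≤ (p (here refl) (λ e → All.lookup x∉ i e))
              (∑-bound-except u g≥0 c≥0 (λ j → p (there j)) (λ j → q (there j)) (yes i)))
      (≤-reflexive (solve 3 (λ a b c → a :+ (c :+ b) := c :+ (a :+ b)) refl (g x) (∑ xs g) c))
  ∑-bound-except {xs = xs} {f} {g} {x₀} {c} u g≥0 c≥0 p q (no n) =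
    ≤-trans (∑-mono xs λ i → p i λ e → n (subst (_∈ xs) e i))
      (≤-trans (≤-reflexive (sym (+-identityˡ _))) (+-mono-≤ c≥0 ≤-refl))

-- Only positive integers are ever inverted: the constants of the nibble are fractions of integers,
-- and the selection rule is stated in odds, so nothing is divided by `1 + w`.
record OrderedField : Set₁ where
  infix 8 -_
  field
    orderedSemiring : OrderedSemiring
  open OrderedSemiring orderedSemiring public
  field
    -_ : Carrier → Carrier
    isCommutativeRing : IsCommutativeRing _≡_ _+_ _*_ -_ 0# 1#
    _≟_      : DecidableEquality Carrier
    _≤?_     : ∀ a b → Dec (a ≤ b)
    ≤-total  : ∀ a b → a ≤ b ⊎ b ≤ a
    *-nonneg : ∀ {a b} → 0# ≤ a → 0# ≤ b → 0# ≤ a * b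
    1≰0      : ¬ 1# ≤ 0#
    reciprocal : ∀ n → ∃ λ a → 0# ≤ a × a * ι (suc n) ≡ 1#

  commutativeRing : CommutativeRing 0ℓ 0ℓ
  commutativeRing = record { isCommutativeRing = isCommutativeRing }

  open IsCommutativeRing isCommutativeRing public using (-‿inverseˡ; -‿inverseʳ)

  infixl 6 _-_
  _-_ : Carrier → Carrier → Carrier
  a - b = a + - b

-- Ring solver with integer coefficients over an abstract ordered field

module FieldSolver (F : OrderedField) where
  open OrderedField F
  open import Data.Integer using (+_; -[1+_]; _⊖_)
  open import Algebra.Solver.Ring.AlmostCommutativeRing
  import Algebra.Properties.Semiring.Mult.TCOptimised (CommutativeRing.semiring commutativeRing) as Mult
  open import Algebra.Properties.Ring (CommutativeRing.ring commutativeRing)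
  open import Algebra.Properties.AbelianGroup (CommutativeRing.+-abelianGroup commutativeRing) using (⁻¹-∙-comm)

  private
    ℤ-raw : RawRing 0ℓ 0ℓ
    ℤ-raw = record { Carrier = ℤ ; _≈_ = _≡_ ; _+_ = ℤ._+_ ; _*_ = ℤ._*_ ; -_ = ℤ.-_ ; 0# = + 0 ; 1# = + 1 }

    n1 : ℕ → Carrier
    n1 n = n Mult.× 1#

    ⟦_⟧ : ℤ → Carrier
    ⟦ + n ⟧      = n1 n
    ⟦ -[1+ n ] ⟧ = - n1 (suc n)

    n1-suc : ∀ n → n1 (suc n) ≡ 1# + n1 n
    n1-suc n = Mult.×-homo-+ 1# 1 n

  ι-n1 : ∀ n → ι n ≡ n Mult.× 1#
  ι-n1 zero = refl
  ι-n1 (suc zero) = refl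
  ι-n1 (suc (suc n)) = trans (cong (λ t → 1# + t) (ι-n1 (suc n))) (sym (n1-suc (suc n)))

  ι-+ : ∀ m n → ι (m ℕ.+ n) ≡ ι m + ι n
  ι-+ m n rewrite ι-n1 (m ℕ.+ n) | ι-n1 m | ι-n1 n = Mult.×-homo-+ 1# m n

  ι-* : ∀ m n → ι (m ℕ.* n) ≡ ι m * ι n
  ι-* m n rewrite ι-n1 (m ℕ.* n) | ι-n1 m | ι-n1 n = Mult.×1-homo-* m n

  private
    neg-⟦⟧ : ∀ i → ⟦ ℤ.- i ⟧ ≡ - ⟦ i ⟧
    neg-⟦⟧ (+ zero)  = sym -0#≈0#
    neg-⟦⟧ (+ suc n) = refl
    neg-⟦⟧ -[1+ n ]  = sym (-‿involutive _)

    shift : ∀ a b → a - b ≡ (1# + a) - (1# + b)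
    shift a b = begin
      a - b                       ≡⟨ sym (+-identityˡ _) ⟩
      0# + (a - b)                ≡⟨ cong (λ t → t + (a - b)) (sym (-‿inverseʳ 1#)) ⟩
      (1# - 1#) + (a - b)         ≡⟨ +-assoc 1# (- 1#) (a - b) ⟩
      1# + (- 1# + (a - b))       ≡⟨ cong (λ t → 1# + t) (sym (+-assoc _ _ _)) ⟩
      1# + ((- 1# + a) - b)       ≡⟨ cong (λ t → 1# + (t - b)) (+-comm _ _) ⟩
      1# + ((a - 1#) - b)         ≡⟨ cong (λ t → 1# + t) (+-assoc _ _ _) ⟩
      1# + (a + (- 1# - b))       ≡⟨ cong (λ t → 1# + (a + t)) (⁻¹-∙-comm 1# b) ⟩
      1# + (a - (1# + b))         ≡⟨ sym (+-assoc _ _ _) ⟩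
      (1# + a) - (1# + b)         ∎
      where open ≡-Reasoning

    ⊖-⟦⟧ : ∀ m n → ⟦ m ⊖ n ⟧ ≡ n1 m - n1 n
    ⊖-⟦⟧ m zero = trans (cong ⟦_⟧ (ℤ.⊖-≥ {m} ℕ.z≤n)) (sym (trans (cong (λ t → n1 m + t) -0#≈0#) (+-identityʳ _)))
    ⊖-⟦⟧ zero (suc n) = sym (+-identityˡ _)
    ⊖-⟦⟧ (suc m) (suc n) = trans (cong ⟦_⟧ (ℤ.[1+m]⊖[1+n]≡m⊖n m n)) (trans (⊖-⟦⟧ m n)
      (trans (shift (n1 m) (n1 n)) (cong₂ _-_ (sym (n1-suc m)) (sym (n1-suc n)))))

    +-⟦⟧ : ∀ i j → ⟦ i ℤ.+ j ⟧ ≡ ⟦ i ⟧ + ⟦ j ⟧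
    +-⟦⟧ (+ m) (+ n) = Mult.×-homo-+ 1# m n
    +-⟦⟧ (+ m) -[1+ n ] = ⊖-⟦⟧ m (suc n)
    +-⟦⟧ -[1+ m ] (+ n) = trans (⊖-⟦⟧ n (suc m)) (+-comm _ _)
    +-⟦⟧ -[1+ m ] -[1+ n ] = trans (cong (λ k → - n1 (suc k)) (sym (ℕ.+-suc m n)))
      (trans (cong -_ (Mult.×-homo-+ 1# (suc m) (suc n))) (sym (⁻¹-∙-comm _ _)))

    +*-⟦⟧ : ∀ m j → ⟦ + m ℤ.* j ⟧ ≡ n1 m * ⟦ j ⟧
    +*-⟦⟧ m (+ n) = trans (cong ⟦_⟧ (sym (ℤ.pos-* m n))) (Mult.×1-homo-* m n)
    +*-⟦⟧ m -[1+ n ] = begin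
      ⟦ + m ℤ.* (ℤ.- (+ suc n)) ⟧   ≡⟨ cong ⟦_⟧ (sym (ℤ.neg-distribʳ-* (+ m) (+ suc n))) ⟩
      ⟦ ℤ.- (+ m ℤ.* + suc n) ⟧     ≡⟨ neg-⟦⟧ (+ m ℤ.* + suc n) ⟩
      - ⟦ + m ℤ.* + suc n ⟧         ≡⟨ cong -_ (+*-⟦⟧ m (+ suc n)) ⟩
      - (n1 m * n1 (suc n))         ≡⟨ -‿distribʳ-* _ _ ⟩
      n1 m * - n1 (suc n)           ∎
      where open ≡-Reasoning
    *-⟦⟧ : ∀ i j → ⟦ i ℤ.* j ⟧ ≡ ⟦ i ⟧ * ⟦ j ⟧
    *-⟦⟧ (+ m) j = +*-⟦⟧ m j
    *-⟦⟧ -[1+ m ] j = begin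
      ⟦ (ℤ.- (+ suc m)) ℤ.* j ⟧     ≡⟨ cong ⟦_⟧ (sym (ℤ.neg-distribˡ-* (+ suc m) j)) ⟩
      ⟦ ℤ.- (+ suc m ℤ.* j) ⟧       ≡⟨ neg-⟦⟧ (+ suc m ℤ.* j) ⟩
      - ⟦ + suc m ℤ.* j ⟧           ≡⟨ cong -_ (+*-⟦⟧ (suc m) j) ⟩
      - (n1 (suc m) * ⟦ j ⟧)        ≡⟨ -‿distribˡ-* _ _ ⟩
      - n1 (suc m) * ⟦ j ⟧          ∎
      where open ≡-Reasoning

    morphism : ℤ-raw -Raw-AlmostCommutative⟶ fromCommutativeRing commutativeRing
    morphism = record { ⟦_⟧ = ⟦_⟧ ; +-homo = +-⟦⟧ ; *-homo = *-⟦⟧ ; -‿homo = neg-⟦⟧ ; 0-homo = refl ; 1-homo = refl }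

    dec : ∀ i j → Maybe (⟦ i ⟧ ≡ ⟦ j ⟧)
    dec i j with i ℤ.≟ j
    ... | yes e = just (cong ⟦_⟧ e)
    ... | no _  = nothing

  open import Algebra.Solver.Ring ℤ-raw (fromCommutativeRing commutativeRing) morphism dec public
    using (solve; _:+_; _:*_; _:-_; :-_; _:=_; con)

module OrderedFieldProperties (F : OrderedField) where
  open OrderedField F
  open FieldSolver F

  ≤-by : ∀ {a b} t → 0# ≤ t → b ≡ a + t → a ≤ b
  ≤-by t t≥0 refl = ≤-trans (≤-reflexive (sym (+-identityʳ _))) (+-mono-≤ ≤-refl t≥0)

  difference-nonneg : ∀ {a b} → a ≤ b → 0# ≤ b - a
  difference-nonneg {a} {b} p = ≤-trans (≤-reflexive (sym (-‿inverseʳ a))) (+-mono-≤ p ≤-refl)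

  *-monoʳ-nonneg : ∀ {a b c} → 0# ≤ c → a ≤ b → c * a ≤ c * b
  *-monoʳ-nonneg {a} {b} {c} c≥0 p = ≤-by _ (*-nonneg c≥0 (difference-nonneg p))
    (solve 3 (λ a b c → c :* b := c :* a :+ c :* (b :- a)) refl a b c)

  *-mono-nonneg : ∀ {a b c d} → 0# ≤ b → 0# ≤ c → a ≤ b → c ≤ d → a * c ≤ b * d
  *-mono-nonneg {a} {b} {c} {d} b≥0 c≥0 p q =
    ≤-trans (≤-reflexive (*-comm a c)) (≤-trans (*-monoʳ-nonneg c≥0 p)
      (≤-trans (≤-reflexive (*-comm c b)) (*-monoʳ-nonneg b≥0 q)))

  square-nonneg : ∀ a → 0# ≤ a * a
  square-nonneg a with ≤-total 0# a
  ... | inj₁ p = *-nonneg p p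
  ... | inj₂ p = ≤-trans (*-nonneg q q) (≤-reflexive (solve 1 (λ a → (con (ℤ.+ 0) :- a) :* (con (ℤ.+ 0) :- a) := a :* a) refl a))
    where q = difference-nonneg p

  +-cancelʳ-≤ : ∀ {a b} c → a + c ≤ b + c → a ≤ b
  +-cancelʳ-≤ {a} {b} c p = ≤-by _ (difference-nonneg p)
    (solve 3 (λ a b c → b := a :+ ((b :+ c) :- (a :+ c))) refl a b c)

  ι-suc : ∀ n → ι (suc n) ≡ 1# + ι n
  ι-suc zero    = sym (+-identityʳ 1#)
  ι-suc (suc n) = refl

  ι-nonneg : ∀ n → 0# ≤ ι n
  ι-nonneg zero          = ≤-refl
  ι-nonneg (suc zero)    = 0≤1
  ι-nonneg (suc (suc n)) = +-nonneg 0≤1 (ι-nonneg (suc n))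

  ι-mono-≤ : ∀ {m n} → m ℕ.≤ n → ι m ≤ ι n
  ι-mono-≤ {m} p with ℕ.m≤n⇒∃[o]m+o≡n p
  ... | o , refl = ≤-by (ι o) (ι-nonneg o) (ι-+ m o)

  ι-cancel-≤ : ∀ {m n} → ι m ≤ ι n → m ℕ.≤ n
  ι-cancel-≤ {m} {n} p with m ℕ.≤? n
  ... | yes q = q
  ... | no  q = contradiction 1≤0 1≰0
    where
    1≤0 : 1# ≤ 0#
    1≤0 = +-cancelʳ-≤ (ι n) (≤-trans (≤-reflexive (sym (ι-suc n)))
      (≤-trans (ι-mono-≤ (ℕ.≰⇒> q)) (≤-trans p (≤-reflexive (sym (+-identityˡ _))))))

ℕ-orderedSemiring : OrderedSemiring
ℕ-orderedSemiring = record
  { Carrier = ℕ ; _+_ = ℕ._+_ ; _*_ = ℕ._*_ ; 0# = 0 ; 1# = 1 ; _≤_ = ℕ._≤_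
  ; isCommutativeSemiring = ℕ.+-*-isCommutativeSemiring
  ; ≤-refl = ℕ.≤-refl ; ≤-trans = ℕ.≤-trans ; +-mono-≤ = ℕ.+-mono-≤ ; 0≤1 = ℕ.z≤n
  }

-- Linear 3-uniform hypergraphs

record LinearTripleSystem : Set₁ where
  field
    X        : Set
    _≟_      : DecidableEquality X
    points   : List X
    complete : ∀ x → x ∈ points
    unique   : Unique points
    E        : Set
    v₀ v₁ v₂ : E → X
    v₀≢v₁    : ∀ e → v₀ e ≢ v₁ e
    v₀≢v₂    : ∀ e → v₀ e ≢ v₂ e
    v₁≢v₂    : ∀ e → v₁ e ≢ v₂ e

  infix 4 _∈ₑ_ _∈ₑ?_
  _∈ₑ_ : X → E → Set
  x ∈ₑ e = v₀ e ≡ x ⊎ v₁ e ≡ x ⊎ v₂ e ≡ x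

  field
    linear : ∀ {e f x y} → x ≢ y → x ∈ₑ e → y ∈ₑ e → x ∈ₑ f → y ∈ₑ f → e ≡ f

  _∈ₑ?_ : ∀ x e → Dec (x ∈ₑ e)
  x ∈ₑ? e = (v₀ e ≟ x) ⊎-dec (v₁ e ≟ x) ⊎-dec (v₂ e ≟ x)

  Disjoint : E → E → Set
  Disjoint e f = ∀ x → x ∈ₑ e → x ∈ₑ f → ⊥

module Incidence (H : LinearTripleSystem) (S : OrderedSemiring) where
  open LinearTripleSystem H
  open OrderedSemiring S
  open Sum S
  open import Algebra.Solver.Ring.NaturalCoefficients.Default commutativeSemiring

  δ : X → X → Carrier
  δ x y = if does (x ≟ y) then 1# else 0#

  δ-≡ : ∀ {x y} → x ≡ y → δ x y ≡ 1#
  δ-≡ {x} {y} e with x ≟ y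
  ... | yes _ = refl
  ... | no ¬e = contradiction e ¬e

  δ-≢ : ∀ {x y} → x ≢ y → δ x y ≡ 0#
  δ-≢ {x} {y} ¬e with x ≟ y
  ... | yes e = contradiction e ¬e
  ... | no _  = refl

  -- A sum of three indicators rather than one decision, so that `∑-inc` can turn a sum over all
  -- points into three values. It is 0 or 1 because the points of an edge are distinct.
  inc : E → X → Carrier
  inc e x = δ (v₀ e) x + δ (v₁ e) x + δ (v₂ e) x

  inc-∈ : ∀ {e x} → x ∈ₑ e → inc e x ≡ 1#
  inc-∈ {e} (inj₁ refl)
    rewrite δ-≡ {v₀ e} refl | δ-≢ (λ p → v₀≢v₁ e (sym p)) | δ-≢ (λ p → v₀≢v₂ e (sym p)) =
      trans (+-identityʳ _) (+-identityʳ _)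
  inc-∈ {e} (inj₂ (inj₁ refl))
    rewrite δ-≡ {v₁ e} refl | δ-≢ (v₀≢v₁ e) | δ-≢ (λ p → v₁≢v₂ e (sym p)) =
      trans (+-identityʳ _) (+-identityˡ _)
  inc-∈ {e} (inj₂ (inj₂ refl))
    rewrite δ-≡ {v₂ e} refl | δ-≢ (v₀≢v₂ e) | δ-≢ (v₁≢v₂ e) =
      trans (cong (λ t → t + 1#) (+-identityˡ _)) (+-identityˡ _)

  inc-∉ : ∀ {e x} → ¬ x ∈ₑ e → inc e x ≡ 0#
  inc-∉ {e} {x} n
    rewrite δ-≢ (λ p → n (inj₁ p)) | δ-≢ (λ p → n (inj₂ (inj₁ p))) | δ-≢ (λ p → n (inj₂ (inj₂ p))) =
      trans (+-identityʳ _) (+-identityʳ _)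

  inc-cases : ∀ e x → (x ∈ₑ e × inc e x ≡ 1#) ⊎ (¬ x ∈ₑ e × inc e x ≡ 0#)
  inc-cases e x with x ∈ₑ? e
  ... | yes p = inj₁ (p , inc-∈ p)
  ... | no  p = inj₂ (p , inc-∉ p)

  inc-nonneg : ∀ e x → 0# ≤ inc e x
  inc-nonneg e x with inc-cases e x
  ... | inj₁ (_ , p) = ≤-trans 0≤1 (≤-reflexive (sym p))
  ... | inj₂ (_ , p) = ≤-reflexive (sym p)

  inc*inc-cases : ∀ e x y → ((x ∈ₑ e × y ∈ₑ e) × inc e x * inc e y ≡ 1#) ⊎ (¬ (x ∈ₑ e × y ∈ₑ e) × inc e x * inc e y ≡ 0#)
  inc*inc-cases e x y with inc-cases e x | inc-cases e y
  ... | inj₁ (i , p) | inj₁ (j , q) = inj₁ ((i , j) , trans (cong₂ _*_ p q) (*-identityˡ _))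
  ... | inj₁ (i , p) | inj₂ (j , q) = inj₂ ((λ ij → j (proj₂ ij)) , trans (cong (λ t → inc e x * t) q) (zeroʳ _))
  ... | inj₂ (i , p) | _ = inj₂ ((λ ij → i (proj₁ ij)) , trans (cong (λ t → t * inc e y) p) (zeroˡ _))

  deg : List E → X → Carrier
  deg es x = ∑ es (λ e → inc e x)

  codeg : List E → X → X → Carrier
  codeg es x y = ∑ es (λ e → inc e x * inc e y)

  codeg≤1 : ∀ {es x y} → Unique es → x ≢ y → codeg es x y ≤ 1#
  codeg≤1 {es} {x} {y} u x≢y = ∑-atMostOne (λ e → x ∈ₑ e × y ∈ₑ e) u cases
      (λ p q → linear x≢y (proj₁ p) (proj₂ p) (proj₁ q) (proj₂ q))
    where
    cases : ∀ e → (inc e x * inc e y ≡ 0#) ⊎ (inc e x * inc e y ≤ 1# × (x ∈ₑ e × y ∈ₑ e))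
    cases e with inc*inc-cases e x y
    ... | inj₁ (p , q) = inj₂ (≤-reflexive q , p)
    ... | inj₂ (p , q) = inj₁ q

  ∑-δ : ∀ {ys : List X} {y} {c : X → Carrier} → Unique ys → y ∈ ys → ∑ ys (λ x → δ y x * c x) ≡ c y
  ∑-δ {x ∷ ys} {y} {c} (x∉ ∷ u) (here refl) rewrite δ-≡ {x} refl = trans (cong₂ _+_ (*-identityˡ _)
    (∑-zero ys λ i → trans (cong (λ t → t * c _) (δ-≢ (All.lookup x∉ i))) (zeroˡ _))) (+-identityʳ _)
  ∑-δ {x ∷ ys} {y} {c} (x∉ ∷ u) (there i) = trans (cong₂ _+_
      (trans (cong (λ t → t * c x) (δ-≢ (λ e → All.lookup x∉ i (sym e)))) (zeroˡ _)) (∑-δ {c = c} u i)) (+-identityˡ _)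

  ∑-inc : ∀ e (c : X → Carrier) → ∑ points (λ x → inc e x * c x) ≡ c (v₀ e) + c (v₁ e) + c (v₂ e)
  ∑-inc e c = begin
    ∑ points (λ x → inc e x * c x)
      ≡⟨ ∑-cong points (λ {x} _ → solve 4 (λ p q r c → (p :+ q :+ r) :* c := p :* c :+ (q :* c :+ r :* c)) refl (δ (v₀ e) x) (δ (v₁ e) x) (δ (v₂ e) x) (c x)) ⟩
    ∑ points (λ x → δ (v₀ e) x * c x + (δ (v₁ e) x * c x + δ (v₂ e) x * c x))
      ≡⟨ trans (∑-+ points (λ x → δ (v₀ e) x * c x) (λ x → δ (v₁ e) x * c x + δ (v₂ e) x * c x)) (cong (λ t → ∑ points (λ x → δ (v₀ e) x * c x) + t) (∑-+ points (λ x → δ (v₁ e) x * c x) (λ x → δ (v₂ e) x * c x))) ⟩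
    ∑ points (λ x → δ (v₀ e) x * c x) + (∑ points (λ x → δ (v₁ e) x * c x) + ∑ points (λ x → δ (v₂ e) x * c x))
      ≡⟨ cong₂ _+_ (∑-δ {c = c} unique (complete _)) (cong₂ _+_ (∑-δ {c = c} unique (complete _)) (∑-δ {c = c} unique (complete _))) ⟩
    c (v₀ e) + (c (v₁ e) + c (v₂ e))
      ≡⟨ sym (+-assoc _ _ _) ⟩
    c (v₀ e) + c (v₁ e) + c (v₂ e) ∎
    where open ≡-Reasoning

  deg-self : ∀ es x → codeg es x x ≡ deg es x
  deg-self es x = ∑-cong es (λ {e} _ → idem e)
    where
    idem : ∀ e → inc e x * inc e x ≡ inc e x
    idem e with inc-cases e x
    ... | inj₁ (_ , p) rewrite p = *-identityˡ _
    ... | inj₂ (_ , p) rewrite p = zeroˡ _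

module IncidenceCast (H : LinearTripleSystem) (F : OrderedField) where
  open LinearTripleSystem H
  open OrderedField F
  open FieldSolver F
  private
    module N = Incidence H ℕ-orderedSemiring
    module R = Incidence H orderedSemiring

  ι-inc : ∀ e x → ι (N.inc e x) ≡ R.inc e x
  ι-inc e x with N.inc-cases e x
  ... | inj₁ (i , p) = trans (cong ι p) (sym (R.inc-∈ i))
  ... | inj₂ (i , p) = trans (cong ι p) (sym (R.inc-∉ i))

  ι-deg : ∀ es x → ι (N.deg es x) ≡ R.deg es x
  ι-deg []       x = refl
  ι-deg (e ∷ es) x = trans (ι-+ (N.inc e x) (N.deg es x)) (cong₂ _+_ (ι-inc e x) (ι-deg es x))

ℚ-orderedSemiring : OrderedSemiring
ℚ-orderedSemiring = record
  { Carrier = ℚ ; _+_ = ℚ._+_ ; _*_ = ℚ._*_ ; 0# = ℚ.0ℚ ; 1# = ℚ.1ℚ ; _≤_ = ℚ._≤_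
  ; isCommutativeSemiring = IsCommutativeRing.isCommutativeSemiring ℚ.+-*-isCommutativeRing
  ; ≤-refl = ℚ.≤-refl ; ≤-trans = ℚ.≤-trans ; +-mono-≤ = ℚ.+-mono-≤ ; 0≤1 = toWitness {a? = ℚ.0ℚ ℚ.≤? ℚ.1ℚ} _
  }

ℚ-reciprocal : ∀ n → ∃ λ a → ℚ.0ℚ ℚ.≤ a × a ℚ.* OrderedSemiring.ι ℚ-orderedSemiring (suc n) ≡ ℚ.1ℚ
ℚ-reciprocal n = (ℚ.1/ p) , ℚ.<⇒≤ (ℚ.positive⁻¹ (ℚ.1/ p) {{ℚ.1/pos⇒pos p}}) , ℚ.*-inverseˡ p
  where
  open OrderedSemiring ℚ-orderedSemiring using (ι)
  p = ι (suc n)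

  positive : ∀ n → ℚ.0ℚ ℚ.< ι (suc n)
  positive zero    = toWitness {a? = ℚ.0ℚ ℚ.<? ℚ.1ℚ} _
  positive (suc n) = ℚ.+-mono-< (positive 0) (positive n)

  instance
    p>0 : ℚ.Positive p
    p>0 = ℚ.positive (positive n)
    p≢0 : ℚ.NonZero p
    p≢0 = ℚ.pos⇒nonZero p

ℚ-orderedField : OrderedField
ℚ-orderedField = record
  { orderedSemiring = ℚ-orderedSemiring ; -_ = ℚ.-_ ; isCommutativeRing = ℚ.+-*-isCommutativeRing
  ; _≟_ = ℚ._≟_ ; _≤?_ = ℚ._≤?_ ; ≤-total = ℚ.≤-total
  ; *-nonneg = λ {a} {b} p q → ℚ.nonNegative⁻¹ (a ℚ.* b) {{ℚ.nonNeg*nonNeg⇒nonNeg a {{ℚ.nonNegative p}} b {{ℚ.nonNegative q}}}}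
  ; 1≰0 = toWitnessFalse {a? = ℚ.1ℚ ℚ.≤? ℚ.0ℚ} _ ; reciprocal = ℚ-reciprocal
  }

-- Effect of exposing one edge on the weights and links of the others

module Exposure (H : LinearTripleSystem) (F : OrderedField) where
  open LinearTripleSystem H renaming (_≟_ to _≟ₓ_)
  open OrderedField F
  open FieldSolver F
  open OrderedFieldProperties F
  open Sum orderedSemiring
  open Incidence H orderedSemiring

  -- Both outcomes have this form: `τ = w` when `e` is passed over, and `τ = - 1`, which sets z to 0
  -- on `e`, when it is selected. At odds 1 : w the mean of `τ` is 0.
  scale : Carrier → E → (X → Carrier) → X → Carrier
  scale τ e z x = z x * (1# + τ * inc e x)

  triple : (X → Carrier) → E → Carrier
  triple z f = z (v₀ f) * (z (v₁ f) * z (v₂ f))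

  -- This is `triple z f` divided by `z x` for `x` on `f` (see `link-∈`), written without division
  -- because `z x` may be 0.
  link : (X → Carrier) → E → X → Carrier
  link z f x = δ (v₀ f) x * (z (v₁ f) * z (v₂ f)) + δ (v₁ f) x * (z (v₀ f) * z (v₂ f)) + δ (v₂ f) x * (z (v₀ f) * z (v₁ f))

  hits : E → E → Carrier
  hits e f = inc e (v₀ f) + inc e (v₁ f) + inc e (v₂ f)

  Δlink : (X → Carrier) → E → E → X → Carrier
  Δlink z e f x =
    δ (v₀ f) x * (z (v₁ f) * z (v₂ f) * (inc e (v₁ f) + inc e (v₂ f))) +
    δ (v₁ f) x * (z (v₀ f) * z (v₂ f) * (inc e (v₀ f) + inc e (v₂ f))) +
    δ (v₂ f) x * (z (v₀ f) * z (v₁ f) * (inc e (v₀ f) + inc e (v₁ f)))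

  ∈₀ : ∀ {e} → v₀ e ∈ₑ e
  ∈₀ = inj₁ refl
  ∈₁ : ∀ {e} → v₁ e ∈ₑ e
  ∈₁ = inj₂ (inj₁ refl)
  ∈₂ : ∀ {e} → v₂ e ∈ₑ e
  ∈₂ = inj₂ (inj₂ refl)

  -- Linearity enters the nibble here: the terms of degree two and more in `τ` carry such a product,
  -- so links and triples of `f` are affine in `τ`.
  inc*inc-≢ : ∀ {e f x y} → e ≢ f → x ≢ y → x ∈ₑ f → y ∈ₑ f → inc e x * inc e y ≡ 0#
  inc*inc-≢ {e} {f} {x} {y} e≢f x≢y i j with inc*inc-cases e x y
  ... | inj₁ ((k , l) , _) = contradiction (linear x≢y k l i j) e≢f
  ... | inj₂ (_ , p) = p

  private
    scale-pair : ∀ τ e z x y → inc e x * inc e y ≡ 0# →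
                 scale τ e z x * scale τ e z y ≡ z x * z y + τ * (z x * z y * (inc e x + inc e y))
    scale-pair τ e z x y p = trans
      (solve 5 (λ τ a b i j → (a :* (con (ℤ.+ 1) :+ τ :* i)) :* (b :* (con (ℤ.+ 1) :+ τ :* j)) :=
                (a :* b :+ τ :* (a :* b :* (i :+ j))) :+ τ :* τ :* (a :* b) :* (i :* j)) refl τ (z x) (z y) (inc e x) (inc e y))
      (trans (cong (λ t → (z x * z y + τ * (z x * z y * (inc e x + inc e y))) + τ * τ * (z x * z y) * t) p)
        (trans (cong (λ t → (z x * z y + τ * (z x * z y * (inc e x + inc e y))) + t) (zeroʳ _)) (+-identityʳ _)))

  link-scale : ∀ {e f} → e ≢ f → ∀ τ z x → link (scale τ e z) f x ≡ link z f x + τ * Δlink z e f x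
  link-scale {e} {f} e≢f τ z x = trans
    (cong₂ _+_ (cong₂ _+_
      (cong (δ (v₀ f) x *_) (scale-pair τ e z _ _ (inc*inc-≢ e≢f (v₁≢v₂ f) ∈₁ ∈₂)))
      (cong (δ (v₁ f) x *_) (scale-pair τ e z _ _ (inc*inc-≢ e≢f (v₀≢v₂ f) ∈₀ ∈₂))))
      (cong (δ (v₂ f) x *_) (scale-pair τ e z _ _ (inc*inc-≢ e≢f (v₀≢v₁ f) ∈₀ ∈₁))))
    (solve 10 (λ d₀ d₁ d₂ p₀ p₁ p₂ τ q₀ q₁ q₂ →
      d₀ :* (p₀ :+ τ :* q₀) :+ d₁ :* (p₁ :+ τ :* q₁) :+ d₂ :* (p₂ :+ τ :* q₂) :=
      (d₀ :* p₀ :+ d₁ :* p₁ :+ d₂ :* p₂) :+ τ :* (d₀ :* q₀ :+ d₁ :* q₁ :+ d₂ :* q₂)) refl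
      (δ (v₀ f) x) (δ (v₁ f) x) (δ (v₂ f) x) _ _ _ τ _ _ _)

  triple-scale : ∀ {e f} → e ≢ f → ∀ τ z → triple (scale τ e z) f ≡ triple z f + τ * (triple z f * hits e f)
  triple-scale {e} {f} e≢f τ z = trans
    (cong (scale τ e z (v₀ f) *_) (scale-pair τ e z _ _ (inc*inc-≢ e≢f (v₁≢v₂ f) ∈₁ ∈₂)))
    (trans
      (solve 7 (λ τ a b c i j k →
        (a :* (con (ℤ.+ 1) :+ τ :* i)) :* (b :* c :+ τ :* (b :* c :* (j :+ k))) :=
        (a :* (b :* c) :+ τ :* (a :* (b :* c) :* (i :+ j :+ k))) :+ τ :* τ :* (a :* b :* c) :* (i :* j :+ i :* k)) refl
        τ (z (v₀ f)) (z (v₁ f)) (z (v₂ f)) (inc e (v₀ f)) (inc e (v₁ f)) (inc e (v₂ f)))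
      (trans (cong₂ (λ s t → (triple z f + τ * (triple z f * hits e f)) + τ * τ * (z (v₀ f) * z (v₁ f) * z (v₂ f)) * (s + t))
               (inc*inc-≢ e≢f (v₀≢v₁ f) ∈₀ ∈₁) (inc*inc-≢ e≢f (v₀≢v₂ f) ∈₀ ∈₂))
        (solve 2 (λ p q → p :+ q :* (con (ℤ.+ 0) :+ con (ℤ.+ 0)) := p) refl _ _)))

  δ-sym : ∀ x y → δ x y ≡ δ y x
  δ-sym x y with x ≟ₓ y
  ... | yes p = sym (δ-≡ (sym p))
  ... | no  p = sym (δ-≢ (λ q → p (sym q)))

  hits-sym : ∀ e f → hits e f ≡ inc f (v₀ e) + inc f (v₁ e) + inc f (v₂ e)
  hits-sym e f
    rewrite δ-sym (v₀ e) (v₀ f) | δ-sym (v₀ e) (v₁ f) | δ-sym (v₀ e) (v₂ f)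
          | δ-sym (v₁ e) (v₀ f) | δ-sym (v₁ e) (v₁ f) | δ-sym (v₁ e) (v₂ f)
          | δ-sym (v₂ e) (v₀ f) | δ-sym (v₂ e) (v₁ f) | δ-sym (v₂ e) (v₂ f) =
    solve 9 (λ a b c d e f g h i → (a :+ b :+ c) :+ (d :+ e :+ f) :+ (g :+ h :+ i) := (a :+ d :+ g) :+ (b :+ e :+ h) :+ (c :+ f :+ i)) refl
      (δ (v₀ f) (v₀ e)) _ _ _ _ _ _ _ _

  δ-nonneg : ∀ x y → 0# ≤ δ x y
  δ-nonneg x y with x ≟ₓ y
  ... | yes _ = 0≤1
  ... | no _  = ≤-refl

  δ-vanish : ∀ {x y c} → (x ≡ y → c ≡ 0#) → δ x y * c ≡ 0#
  δ-vanish {x} {y} {c} p with x ≟ₓ y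
  ... | yes q = trans (*-identityˡ c) (p q)
  ... | no _  = zeroˡ c

  -- An edge `f` through `x` already meets `e` in `x`, so its other two points are off `e` and keep
  -- their z.
  Δlink-∈ : ∀ {e f x} z → e ≢ f → x ∈ₑ e → Δlink z e f x ≡ 0#
  Δlink-∈ {e} {f} {x} z e≢f x∈e = trans (cong₂ _+_ (cong₂ _+_
      (δ-vanish λ p → trans (cong (λ t → _ * t) (avoid₂ p ∈₀ ∈₁ ∈₂ (v₀≢v₁ f) (v₀≢v₂ f))) (zeroʳ _))
      (δ-vanish λ p → trans (cong (λ t → _ * t) (avoid₂ p ∈₁ ∈₀ ∈₂ (λ q → v₀≢v₁ f (sym q)) (v₁≢v₂ f))) (zeroʳ _)))
      (δ-vanish λ p → trans (cong (λ t → _ * t) (avoid₂ p ∈₂ ∈₀ ∈₁ (λ q → v₀≢v₂ f (sym q)) (λ q → v₁≢v₂ f (sym q)))) (zeroʳ _)))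
    (trans (+-identityʳ _) (+-identityʳ _))
    where
    avoid : ∀ {y w} → y ≡ x → y ∈ₑ f → w ∈ₑ f → y ≢ w → inc e w ≡ 0#
    avoid refl i j y≢w = inc-∉ λ k → e≢f (linear y≢w x∈e k i j)

    avoid₂ : ∀ {y w u} → y ≡ x → y ∈ₑ f → w ∈ₑ f → u ∈ₑ f → y ≢ w → y ≢ u → inc e w + inc e u ≡ 0#
    avoid₂ p i j k y≢w y≢u = trans (cong₂ _+_ (avoid p i j y≢w) (avoid p i k y≢u)) (+-identityʳ _)

  Δlink-nonneg : ∀ {z} e f x → (∀ y → 0# ≤ z y) → 0# ≤ Δlink z e f x
  Δlink-nonneg {z} e f x z≥0 = +-nonneg (+-nonneg (part _ _ _) (part _ _ _)) (part _ _ _)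
    where
    part : ∀ u v w → 0# ≤ δ u x * (z v * z w * (inc e v + inc e w))
    part u v w = *-nonneg (δ-nonneg u x) (*-nonneg (*-nonneg (z≥0 v) (z≥0 w)) (+-nonneg (inc-nonneg e v) (inc-nonneg e w)))

  Δlink-≤ : ∀ {z Y} e f x → (∀ y → 0# ≤ z y) → (∀ y → z y ≤ Y) → Δlink z e f x ≤ Y * Y * (inc f x * hits e f)
  Δlink-≤ {z} {Y} e f x z≥0 z≤Y = ≤-trans
      (+-mono-≤ (+-mono-≤
        (part (v₀ f) (v₁ f) (v₂ f) (≤-by (inc e (v₀ f)) (inc-nonneg e _) (solve 3 (λ a b c → a :+ b :+ c := (b :+ c) :+ a) refl _ _ _)))
        (part (v₁ f) (v₀ f) (v₂ f) (≤-by (inc e (v₁ f)) (inc-nonneg e _) (solve 3 (λ a b c → a :+ b :+ c := (a :+ c) :+ b) refl _ _ _))))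
        (part (v₂ f) (v₀ f) (v₁ f) (≤-by (inc e (v₂ f)) (inc-nonneg e _) refl)))
      (≤-reflexive (solve 5 (λ a b c y h → a :* (y :* h) :+ b :* (y :* h) :+ c :* (y :* h) := y :* ((a :+ b :+ c) :* h)) refl
        (δ (v₀ f) x) (δ (v₁ f) x) (δ (v₂ f) x) (Y * Y) (hits e f)))
    where
    Y≥0 : 0# ≤ Y
    Y≥0 = ≤-trans (z≥0 x) (z≤Y x)

    part : ∀ u v w → inc e v + inc e w ≤ hits e f →
           δ u x * (z v * z w * (inc e v + inc e w)) ≤ δ u x * (Y * Y * hits e f)
    part u v w p = *-monoʳ-nonneg (δ-nonneg u x)
      (*-mono-nonneg (*-nonneg Y≥0 Y≥0) (+-nonneg (inc-nonneg e v) (inc-nonneg e w)) (*-mono-nonneg Y≥0 (z≥0 w) (z≤Y v) (z≤Y w)) p)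

  three : Carrier
  three = 1# + 1# + 1#

  ∑-hits : ∀ e es x → ∑ es (λ f → inc f x * hits e f) ≡ codeg es x (v₀ e) + codeg es x (v₁ e) + codeg es x (v₂ e)
  ∑-hits e es x = trans
    (∑-cong es λ {f} _ → trans (cong (inc f x *_) (hits-sym e f))
      (solve 4 (λ i a b c → i :* (a :+ b :+ c) := i :* a :+ i :* b :+ i :* c) refl (inc f x) (inc f (v₀ e)) (inc f (v₁ e)) (inc f (v₂ e))))
    (trans (∑-+ es _ _) (cong (_+ codeg es x (v₂ e)) (∑-+ es _ _)))

  -- Each of the three points of `e` lies with `x` in at most one edge.
  ∑-hits-∉ : ∀ {e es x} → Unique es → ¬ x ∈ₑ e → ∑ es (λ f → inc f x * hits e f) ≤ three
  ∑-hits-∉ {e} {es} {x} u x∉ = ≤-trans (≤-reflexive (∑-hits e es x))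
    (+-mono-≤ (+-mono-≤ (codeg≤1 u λ p → x∉ (inj₁ (sym p))) (codeg≤1 u λ p → x∉ (inj₂ (inj₁ (sym p)))))
      (codeg≤1 u λ p → x∉ (inj₂ (inj₂ (sym p)))))

  -- Double counting: the incidences with points of `e` number at most `3 d`, and each is seen from
  -- the three points of its edge.
  ∑∑-hits : ∀ {d} e es → (∀ x → deg es x ≤ d) →
            ∑ points (λ x → ∑ es (λ f → inc f x * hits e f)) ≤ three * (three * d)
  ∑∑-hits {d} e es deg≤d = ≤-trans (≤-reflexive (begin
    ∑ points (λ x → ∑ es (λ f → inc f x * hits e f))   ≡⟨ ∑-swap points es _ ⟩
    ∑ es (λ f → ∑ points (λ x → inc f x * hits e f))   ≡⟨ ∑-cong es (λ {f} _ → ∑-inc f (λ _ → hits e f)) ⟩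
    ∑ es (λ f → hits e f + hits e f + hits e f)        ≡⟨ ∑-cong es (λ {f} _ → solve 1 (λ h → h :+ h :+ h := con (ℤ.+ 3) :* h) refl (hits e f)) ⟩
    ∑ es (λ f → (1# + 1# + 1#) * hits e f)             ≡⟨ ∑-*ˡ es three (hits e) ⟩
    three * ∑ es (hits e)                              ≡⟨ cong (three *_) (trans (∑-cong es (λ {f} _ → hits-sym e f)) (trans (∑-+ es _ _) (cong (_+ deg es (v₂ e)) (∑-+ es _ _)))) ⟩
    three * (deg es (v₀ e) + deg es (v₁ e) + deg es (v₂ e)) ∎))
    (*-monoʳ-nonneg three≥0 (≤-trans (+-mono-≤ (+-mono-≤ (deg≤d _) (deg≤d _)) (deg≤d _))
      (≤-reflexive (solve 1 (λ h → h :+ h :+ h := con (ℤ.+ 3) :* h) refl d))))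
    where
    open ≡-Reasoning
    three≥0 : 0# ≤ three
    three≥0 = +-nonneg (+-nonneg 0≤1 0≤1) 0≤1

-- ρ is the weight of a fresh edge, so loads start at most ρ d ≤ 1 - 2ζ, and edges at an element of
-- load above 1 - ζ are skipped; this keeps the inverse survival probabilities z below Y = 2 / ζ.
-- The expected potential drops by at most κ per exposed edge.
record NibbleConstants (F : OrderedField) : Set where
  open OrderedField F
  field
    ρ ζ Z d : Carrier
    ρ≥0    : 0# ≤ ρ
    ζ≥0    : 0# ≤ ζ
    Z≥0    : 0# ≤ Z
    Z*ζ≡1  : Z * ζ ≡ 1#
    ρd+2ζ≤1 : ρ * d + (ζ + ζ) ≤ 1#
    ρY³≤1   : ρ * ((Z + Z) * ((Z + Z) * (Z + Z))) ≤ 1#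

  Y Y³ A κ : Carrier
  Y  = Z + Z
  Y³ = Y * (Y * Y)
  -- An overloaded point ends with a deviation of at least `ζ = 1 / Z`, for which the factor `A`
  -- charges at least `Y³`. In `κ` the square bounds `w²` and the rest bounds `A w` times the sum of
  -- squared load changes; for fixed `Z` both are of order `ρ²`.
  A  = Y³ * (Z * Z)
  κ  = ρ * Y³ * (ρ * Y³) + A * (ρ * Y³) * ((1# + 1# + 1#) * (ρ * (Y * Y)) * ((1# + 1# + 1#) * ((1# + 1# + 1#) * (Y * Y))))

-- The derandomised nibble

module Nibble (H : LinearTripleSystem) (F : OrderedField) (K : NibbleConstants F) where
  open LinearTripleSystem H renaming (_≟_ to _≟ₓ_)
  open OrderedField F
  open FieldSolver F
  open OrderedFieldProperties F
  open Sum orderedSemiring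
  open Incidence H orderedSemiring
  open Exposure H F
  open NibbleConstants K

  θ : Carrier
  θ = 1# - ζ

  overloaded : Carrier → Carrier
  overloaded a with a ≤? θ
  ... | yes _ = 0#
  ... | no  _ = 1#

  overloaded-≰ : ∀ {a} → ¬ a ≤ θ → overloaded a ≡ 1#
  overloaded-≰ {a} n with a ≤? θ
  ... | yes p = contradiction p n
  ... | no  _ = refl

  overloaded-nonneg : ∀ a → 0# ≤ overloaded a
  overloaded-nonneg a with a ≤? θ
  ... | yes _ = ≤-refl
  ... | no  _ = 0≤1

  overloaded-mono : ∀ {a b} → a ≤ b → overloaded a ≤ overloaded b
  overloaded-mono {a} {b} p with a ≤? θ
  ... | yes _ = overloaded-nonneg b
  ... | no  n = ≤-reflexive (sym (overloaded-≰ λ q → n (≤-trans p q)))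

  Y≥0 : 0# ≤ Y
  Y≥0 = +-nonneg Z≥0 Z≥0

  Y³≥0 : 0# ≤ Y³
  Y³≥0 = *-nonneg Y≥0 (*-nonneg Y≥0 Y≥0)

  A≥0 : 0# ≤ A
  A≥0 = *-nonneg Y³≥0 (*-nonneg Z≥0 Z≥0)

  ρ≥0*Y³ : 0# ≤ ρ * Y³
  ρ≥0*Y³ = *-nonneg ρ≥0 Y³≥0

  κ≥0 : 0# ≤ κ
  κ≥0 = +-nonneg (*-nonneg ρ≥0*Y³ ρ≥0*Y³)
    (*-nonneg (*-nonneg A≥0 ρ≥0*Y³) (*-nonneg (*-nonneg 3≥0 (*-nonneg ρ≥0 (*-nonneg Y≥0 Y≥0))) (*-nonneg 3≥0 (*-nonneg 3≥0 (*-nonneg Y≥0 Y≥0)))))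
    where
    3≥0 : 0# ≤ three
    3≥0 = +-nonneg (+-nonneg 0≤1 0≤1) 0≤1

  load : List E → (X → Carrier) → (X → Carrier) → X → Carrier
  load es z a x = a x + ρ * ∑ es (λ f → link z f x)

  weight : List E → (X → Carrier) → Carrier
  weight es z = ρ * ∑ es (triple z)

  -- The load of a point off the exposed edge is a martingale; its total squared deviation pays for the skipped edges.
  penalty : (X → Carrier) → List E → (X → Carrier) → (X → Carrier) → Carrier
  penalty lam es z a = A * ∑ points (λ x → (load es z a x - lam x) * (load es z a x - lam x))

  -- A credit against skipped edges. The unexposed edges at an overloaded point weigh at most
  -- `Y³ * (ρ * deg es x)`, and the point holds the rest of `Y³`; skipping an edge there releases
  -- `ρ * Y³`, at least the weight lost.
  bonus : List E → (X → Carrier) → Carrier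
  bonus es a = ∑ points (λ x → overloaded (a x) * (Y³ - Y³ * (ρ * deg es x)))

  expose : E → (X → Carrier) → (X → Carrier) → X → Carrier
  expose e z a x = a x + ρ * link z e x

  Δload : E → List E → (X → Carrier) → X → Carrier
  Δload e es z x = ρ * ∑ es (λ f → Δlink z e f x)

  load-expose : ∀ e es z a x → load es z (expose e z a) x ≡ load (e ∷ es) z a x
  load-expose e es z a x = solve 4 (λ a r l s → a :+ r :* l :+ r :* s := a :+ r :* (l :+ s)) refl (a x) ρ (link z e x) _

  load-scale : ∀ {e es} → All (e ≢_) es → ∀ τ z a x → load es (scale τ e z) a x ≡ load es z a x + τ * Δload e es z x
  load-scale {e} {es} e∉ τ z a x = trans
    (cong (λ t → a x + ρ * t) (trans (∑-cong es λ i → link-scale (All.lookup e∉ i) τ z x)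
      (trans (∑-+ es _ _) (cong (∑ es (λ f → link z f x) +_) (∑-*ˡ es τ (λ f → Δlink z e f x))))))
    (solve 5 (λ a r l t s → a :+ r :* (l :+ t :* s) := (a :+ r :* l) :+ t :* (r :* s)) refl (a x) ρ _ τ _)

  Δweight : E → List E → (X → Carrier) → Carrier
  Δweight e es z = ρ * ∑ es (λ f → triple z f * hits e f)

  weight-scale : ∀ {e es} → All (e ≢_) es → ∀ τ z → weight es (scale τ e z) ≡ weight es z + τ * Δweight e es z
  weight-scale {e} {es} e∉ τ z = trans
    (cong (ρ *_) (trans (∑-cong es λ i → triple-scale (All.lookup e∉ i) τ z)
      (trans (∑-+ es _ _) (cong (∑ es (triple z) +_) (∑-*ˡ es τ (λ f → triple z f * hits e f))))))
    (solve 4 (λ r l t s → r :* (l :+ t :* s) := r :* l :+ t :* (r :* s)) refl ρ _ τ _)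

  ∑-square-shift : ∀ (D B : X → Carrier) τ →
    ∑ points (λ x → (D x + τ * B x) * (D x + τ * B x)) ≡
    ∑ points (λ x → D x * D x) + (τ + τ) * ∑ points (λ x → D x * B x) + τ * τ * ∑ points (λ x → B x * B x)
  ∑-square-shift D B τ = trans
    (∑-cong points λ {x} _ → solve 3 (λ D B t → (D :+ t :* B) :* (D :+ t :* B) := D :* D :+ (t :+ t) :* (D :* B) :+ t :* t :* (B :* B)) refl (D x) (B x) τ)
    (trans (∑-+ points _ _) (cong₂ _+_ (trans (∑-+ points _ _) (cong (∑ points (λ x → D x * D x) +_) (∑-*ˡ points (τ + τ) _))) (∑-*ˡ points (τ * τ) _)))

  -- Loads are affine in `τ`, so the penalty is quadratic in `τ`. At odds 1 : w the linear term
  -- averages out, and only the quadratic one is a cost.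
  penalty-scale : ∀ {e es} → All (e ≢_) es → ∀ τ lam z a → let D = λ x → load (e ∷ es) z a x - lam x in
    penalty lam es (scale τ e z) (expose e z a) ≡
    A * (∑ points (λ x → D x * D x) + (τ + τ) * ∑ points (λ x → D x * Δload e es z x) + τ * τ * ∑ points (λ x → Δload e es z x * Δload e es z x))
  penalty-scale {e} {es} e∉ τ lam z a = cong (A *_) (trans
    (∑-cong points λ {x} _ → cong (λ t → t * t) (trans
      (cong (_- lam x) (trans (load-scale e∉ τ z (expose e z a) x) (cong (_+ τ * Δload e es z x) (load-expose e es z a x))))
      (solve 3 (λ l b m → l :+ b :- m := (l :- m) :+ b) refl (load (e ∷ es) z a x) (τ * Δload e es z x) (lam x))))
    (∑-square-shift _ (Δload e es z) τ))

  module _ {e : E} {es : List E} (e∉ : All (e ≢_) es) (u : Unique es) (deg≤d : ∀ x → deg es x ≤ d)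
           {z : X → Carrier} (z≥0 : ∀ x → 0# ≤ z x) (z≤Y : ∀ x → z x ≤ Y) where

    private
      B : X → Carrier
      B = Δload e es z

      T : X → Carrier
      T x = ∑ es (λ f → inc f x * hits e f)

      YY≥0 : 0# ≤ ρ * (Y * Y)
      YY≥0 = *-nonneg ρ≥0 (*-nonneg Y≥0 Y≥0)

    Δload-nonneg : ∀ x → 0# ≤ B x
    Δload-nonneg x = *-nonneg ρ≥0 (∑-nonneg es λ {f} _ → Δlink-nonneg e f x z≥0)

    Δload-≤ : ∀ x → B x ≤ ρ * (Y * Y) * T x
    Δload-≤ x = ≤-trans (*-monoʳ-nonneg ρ≥0 (≤-trans (∑-mono es λ {f} _ → Δlink-≤ e f x z≥0 z≤Y)
        (≤-reflexive (∑-*ˡ es (Y * Y) _)))) (≤-reflexive (sym (*-assoc _ _ _)))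

    -- Off `e` one factor is bounded through `∑-hits-∉`; on `e` the change is 0.
    Δload²-≤ : ∀ x → B x * B x ≤ three * (ρ * (Y * Y)) * B x
    Δload²-≤ x with x ∈ₑ? e
    ... | yes x∈ = ≤-reflexive (trans (cong (B x *_) B≡0) (trans (zeroʳ _) (sym (trans (cong (three * (ρ * (Y * Y)) *_) B≡0) (zeroʳ _)))))
      where
      B≡0 : B x ≡ 0#
      B≡0 = trans (cong (ρ *_) (∑-zero es λ i → Δlink-∈ z (All.lookup e∉ i) x∈)) (zeroʳ _)
    ... | no x∉ = ≤-trans (*-monoʳ-nonneg (Δload-nonneg x) (≤-trans (Δload-≤ x)
        (≤-trans (*-monoʳ-nonneg YY≥0 (∑-hits-∉ u x∉)) (≤-reflexive (*-comm _ _))))) (≤-reflexive (*-comm _ _))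

    -- Largest change times total change: the former is of order `ρ`, the latter of order `ρ d ≤ 1`.
    ∑-Δload²-≤ : ∑ points (λ x → B x * B x) ≤ three * (ρ * (Y * Y)) * (three * (three * (Y * Y)))
    ∑-Δload²-≤ = ≤-trans (∑-mono points λ {x} _ → Δload²-≤ x)
      (≤-trans (≤-reflexive (∑-*ˡ points _ B)) (*-monoʳ-nonneg (*-nonneg 3≥0 YY≥0) ∑B≤))
      where
      3≥0 : 0# ≤ three
      3≥0 = +-nonneg (+-nonneg 0≤1 0≤1) 0≤1

      ρd≤1 : ρ * d ≤ 1#
      ρd≤1 = ≤-trans (≤-by (ζ + ζ) (+-nonneg ζ≥0 ζ≥0) refl) ρd+2ζ≤1

      ∑B≤ : ∑ points B ≤ three * (three * (Y * Y))
      ∑B≤ = ≤-trans (∑-mono points λ {x} _ → Δload-≤ x) (≤-trans (≤-reflexive (∑-*ˡ points _ T))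
        (≤-trans (*-monoʳ-nonneg YY≥0 (∑∑-hits e es deg≤d))
        (≤-trans (≤-reflexive (solve 4 (λ r y t d → r :* y :* (t :* (t :* d)) := (t :* (t :* y)) :* (r :* d)) refl ρ (Y * Y) three d))
        (≤-trans (*-monoʳ-nonneg (*-nonneg 3≥0 (*-nonneg 3≥0 (*-nonneg Y≥0 Y≥0))) ρd≤1) (≤-reflexive (trans (*-comm _ _) (*-identityˡ _)))))))

  -- The method of conditional expectations. Selection is expected to gain `w / (1 + w) ≥ w - w²`
  -- matched edges, and the deviations are expected to grow by `w Q₂`; `κ` covers both losses. The
  -- condition `w ≢ 0#` keeps selection to edges with no matched point.
  choice : ∀ {w W C Q₀ Q₁ Q₂} → 0# ≤ w → w * w + A * w * Q₂ ≤ κ →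
    let T = W + w - A * Q₀ - κ in
    T ≤ 0# + (W + w * C) - A * (Q₀ + (w + w) * Q₁ + w * w * Q₂) ⊎
    (w ≢ 0# × T ≤ 1# + (W + (- 1#) * C) - A * (Q₀ + ((- 1#) + (- 1#)) * Q₁ + (- 1#) * (- 1#) * Q₂))
  choice {w} {W} {C} {Q₀} {Q₁} {Q₂} w≥0 err = decide (w ≟ 0#) (≤-total T V₂)
    where
    T V₁ V₂ : Carrier
    T  = W + w - A * Q₀ - κ
    V₁ = 0# + (W + w * C) - A * (Q₀ + (w + w) * Q₁ + w * w * Q₂)
    V₂ = 1# + (W + (- 1#) * C) - A * (Q₀ + ((- 1#) + (- 1#)) * Q₁ + (- 1#) * (- 1#) * Q₂)

    -- The expectation of the potential, scaled by 1 + w: outcomes V₁ and V₂ have odds 1 : w.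
    average : (1# + w) * T ≤ V₁ + w * V₂
    average = ≤-by _ (+-nonneg (*-nonneg (+-nonneg 0≤1 w≥0) (difference-nonneg err)) (*-nonneg (*-nonneg w≥0 w≥0) w≥0))
      (solve 8 (λ w W C Q₀ Q₁ Q₂ A κ →
        con (ℤ.+ 0) :+ (W :+ w :* C) :- A :* (Q₀ :+ (w :+ w) :* Q₁ :+ w :* w :* Q₂)
        :+ w :* (con (ℤ.+ 1) :+ (W :+ (:- con (ℤ.+ 1)) :* C) :- A :* (Q₀ :+ (:- con (ℤ.+ 1) :+ :- con (ℤ.+ 1)) :* Q₁ :+ (:- con (ℤ.+ 1)) :* (:- con (ℤ.+ 1)) :* Q₂))
        := (con (ℤ.+ 1) :+ w) :* (W :+ w :- A :* Q₀ :- κ)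
           :+ ((con (ℤ.+ 1) :+ w) :* (κ :- (w :* w :+ A :* w :* Q₂)) :+ w :* w :* w)) refl w W C Q₀ Q₁ Q₂ A κ)

    decide : Dec (w ≡ 0#) → T ≤ V₂ ⊎ V₂ ≤ T → T ≤ V₁ ⊎ (w ≢ 0# × T ≤ V₂)
    -- At odds 0 the edge may have a matched point and must be passed over; `average` then compares
    -- `T` with `V₁` alone.
    decide (yes w≡0) _ = inj₁ (≤-trans (≤-reflexive (sym (trans (cong (λ t → (1# + t) * T) w≡0)
        (solve 1 (λ t → (con (ℤ.+ 1) :+ con (ℤ.+ 0)) :* t := t) refl T))))
      (≤-trans average (≤-reflexive (trans (cong (λ t → V₁ + t * V₂) w≡0) (trans (cong (V₁ +_) (zeroˡ V₂)) (+-identityʳ V₁))))))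
    decide (no w≢0) (inj₁ p) = inj₂ (w≢0 , p)
    decide (no w≢0) (inj₂ p) = inj₁ (+-cancelʳ-≤ (w * T)
      (≤-trans (≤-reflexive (solve 2 (λ w t → t :+ w :* t := (con (ℤ.+ 1) :+ w) :* t) refl w T))
        (≤-trans average (+-mono-≤ ≤-refl (*-monoʳ-nonneg w≥0 p)))))

  scale-∈ : ∀ {τ e x} z → x ∈ₑ e → scale τ e z x ≡ z x * (1# + τ)
  scale-∈ {τ} {e} {x} z i = trans (cong (λ t → z x * (1# + τ * t)) (inc-∈ i))
    (solve 2 (λ z t → z :* (con (ℤ.+ 1) :+ t :* con (ℤ.+ 1)) := z :* (con (ℤ.+ 1) :+ t)) refl (z x) τ)

  scale-∉ : ∀ {τ e x} z → ¬ x ∈ₑ e → scale τ e z x ≡ z x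
  scale-∉ {τ} {e} {x} z i = trans (cong (λ t → z x * (1# + τ * t)) (inc-∉ i))
    (solve 2 (λ z t → z :* (con (ℤ.+ 1) :+ t :* con (ℤ.+ 0)) := z) refl (z x) τ)

  link-∈ : ∀ {e x} z → x ∈ₑ e → z x * link z e x ≡ triple z e
  link-∈ {e} z (inj₁ refl)
    rewrite δ-≡ {v₀ e} refl | δ-≢ (λ p → v₀≢v₁ e (sym p)) | δ-≢ (λ p → v₀≢v₂ e (sym p)) =
      solve 3 (λ a b c → a :* (con (ℤ.+ 1) :* (b :* c) :+ con (ℤ.+ 0) :* (a :* c) :+ con (ℤ.+ 0) :* (a :* b)) := a :* (b :* c)) refl (z (v₀ e)) (z (v₁ e)) (z (v₂ e))
  link-∈ {e} z (inj₂ (inj₁ refl))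
    rewrite δ-≡ {v₁ e} refl | δ-≢ (v₀≢v₁ e) | δ-≢ (λ p → v₁≢v₂ e (sym p)) =
      solve 3 (λ a b c → b :* (con (ℤ.+ 0) :* (b :* c) :+ con (ℤ.+ 1) :* (a :* c) :+ con (ℤ.+ 0) :* (a :* b)) := a :* (b :* c)) refl (z (v₀ e)) (z (v₁ e)) (z (v₂ e))
  link-∈ {e} z (inj₂ (inj₂ refl))
    rewrite δ-≡ {v₂ e} refl | δ-≢ (v₀≢v₂ e) | δ-≢ (v₁≢v₂ e) =
      solve 3 (λ a b c → c :* (con (ℤ.+ 0) :* (b :* c) :+ con (ℤ.+ 0) :* (a :* c) :+ con (ℤ.+ 1) :* (a :* b)) := a :* (b :* c)) refl (z (v₀ e)) (z (v₁ e)) (z (v₂ e))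

  link-nonneg : ∀ {z} → (∀ y → 0# ≤ z y) → ∀ f x → 0# ≤ link z f x
  link-nonneg z≥0 f x = +-nonneg (+-nonneg
    (*-nonneg (δ-nonneg _ _) (*-nonneg (z≥0 _) (z≥0 _))) (*-nonneg (δ-nonneg _ _) (*-nonneg (z≥0 _) (z≥0 _))))
    (*-nonneg (δ-nonneg _ _) (*-nonneg (z≥0 _) (z≥0 _)))

  -- z x is 1 over the probability that x is still unmatched (0 if x is matched), and a x is
  -- the part of the load of x contributed by the exposed edges.
  record State (z a : X → Carrier) : Set where
    field
      z≥0   : ∀ x → 0# ≤ z x
      z≤Y   : ∀ x → z x ≤ Y
      bound : ∀ x → z x * (1# - a x) ≤ 1#

  open State

  expose-≥ : ∀ {z a} → State z a → ∀ e x → a x ≤ expose e z a x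
  expose-≥ s e x = ≤-by _ (*-nonneg ρ≥0 (link-nonneg (z≥0 s) e x)) refl

  bound-antitone : ∀ {z a b} → 0# ≤ z → a ≤ b → z * (1# - a) ≤ 1# → z * (1# - b) ≤ 1#
  bound-antitone {z} {a} {b} z≥0 p q = ≤-trans (≤-by _ (*-nonneg z≥0 (difference-nonneg p))
    (solve 3 (λ z a b → z :* (con (ℤ.+ 1) :- a) := z :* (con (ℤ.+ 1) :- b) :+ z :* (b :- a)) refl z a b)) q

  skip-state : ∀ {z a} → State z a → ∀ e → State z (expose e z a)
  skip-state s e = record { z≥0 = z≥0 s ; z≤Y = z≤Y s
    ; bound = λ x → bound-antitone (z≥0 s x) (expose-≥ s e x) (bound s x) }

  select-state : ∀ {z a} → State z a → ∀ e → State (scale (- 1#) e z) (expose e z a)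
  select-state {z} {a} s e = record { z≥0 = pos ; z≤Y = up ; bound = bd }
    where
    at-∈ : ∀ {x} → x ∈ₑ e → scale (- 1#) e z x ≡ 0#
    at-∈ {x} i = trans (scale-∈ z i) (trans (cong (z x *_) (-‿inverseʳ 1#)) (zeroʳ _))
    pos : ∀ x → 0# ≤ scale (- 1#) e z x
    pos x with x ∈ₑ? e
    ... | yes i = ≤-reflexive (sym (at-∈ i))
    ... | no  n = ≤-trans (z≥0 s x) (≤-reflexive (sym (scale-∉ z n)))
    up : ∀ x → scale (- 1#) e z x ≤ Y
    up x with x ∈ₑ? e
    ... | yes i = ≤-trans (≤-reflexive (at-∈ i)) Y≥0
    ... | no  n = ≤-trans (≤-reflexive (scale-∉ z n)) (z≤Y s x)
    bd : ∀ x → scale (- 1#) e z x * (1# - expose e z a x) ≤ 1#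
    bd x with x ∈ₑ? e
    ... | yes i = ≤-trans (≤-reflexive (trans (cong (_* (1# - expose e z a x)) (at-∈ i)) (zeroˡ _))) 0≤1
    ... | no  n = ≤-trans (≤-reflexive (cong (_* (1# - expose e z a x)) (scale-∉ z n))) (bound (skip-state s e) x)

  module _ {z a : X → Carrier} (s : State z a) {e : E} where
    w : Carrier
    w = ρ * triple z e

    w≥0 : 0# ≤ w
    w≥0 = *-nonneg ρ≥0 (*-nonneg (z≥0 s _) (*-nonneg (z≥0 s _) (z≥0 s _)))

    w≤ρY³ : w ≤ ρ * Y³
    w≤ρY³ = *-monoʳ-nonneg ρ≥0 (*-mono-nonneg Y≥0 (*-nonneg (z≥0 s _) (z≥0 s _)) (z≤Y s _)
      (*-mono-nonneg Y≥0 (z≥0 s _) (z≤Y s _) (z≤Y s _)))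

    w≤1 : w ≤ 1#
    w≤1 = ≤-trans w≤ρY³ ρY³≤1

    -- Here `1 - a x ≥ ζ`, so the invariant gives `z x * ζ ≤ 1`.
    open-≤Z : ∀ {x} → a x ≤ θ → z x ≤ Z
    open-≤Z {x} p = ≤-trans (≤-reflexive (trans (sym (*-identityˡ _)) (trans (cong (_* z x) (sym Z*ζ≡1))
        (solve 3 (λ Z ζ z → Z :* ζ :* z := Z :* (z :* ζ)) refl Z ζ (z x)))))
      (≤-trans (*-monoʳ-nonneg Z≥0 (≤-trans (*-monoʳ-nonneg (z≥0 s x) ζ≤1-a) (bound s x))) (≤-reflexive (trans (*-comm _ _) (*-identityˡ _))))
      where
      ζ≤1-a : ζ ≤ 1# - a x
      ζ≤1-a = ≤-by _ (difference-nonneg p) (solve 2 (λ ζ a → con (ℤ.+ 1) :- a := ζ :+ ((con (ℤ.+ 1) :- ζ) :- a)) refl ζ (a x))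

    pass-state : (∀ x → x ∈ₑ e → a x ≤ θ) → State (scale w e z) (expose e z a)
    pass-state act = record { z≥0 = pos ; z≤Y = up ; bound = bd }
      where
      pos : ∀ x → 0# ≤ scale w e z x
      pos x = *-nonneg (z≥0 s x) (+-nonneg 0≤1 (*-nonneg w≥0 (inc-nonneg e x)))
      up : ∀ x → scale w e z x ≤ Y
      up x with x ∈ₑ? e
      ... | yes i = ≤-trans (≤-reflexive (scale-∈ z i)) (≤-trans
              -- A point below the threshold has `z x ≤ Z`, and one exposure at most doubles it,
              -- hence `Y = Z + Z`.
              (*-mono-nonneg Z≥0 (+-nonneg 0≤1 w≥0) (open-≤Z (act x i)) (+-mono-≤ ≤-refl w≤1))
              (≤-reflexive (solve 1 (λ z → z :* (con (ℤ.+ 1) :+ con (ℤ.+ 1)) := z :+ z) refl Z)))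
      ... | no  n = ≤-trans (≤-reflexive (scale-∉ z n)) (z≤Y s x)
      bd : ∀ x → scale w e z x * (1# - expose e z a x) ≤ 1#
      bd x with x ∈ₑ? e
      ... | no  n = ≤-trans (≤-reflexive (cong (_* (1# - expose e z a x)) (scale-∉ z n))) (bound (skip-state s e) x)
      -- By `link-∈` the left side is `(1 + w) * (z x * (1 - a x) - w)`, at most
      -- `(1 + w) * (1 - w) = 1 - w²`.
      ... | yes i = ≤-by _ (+-nonneg (*-nonneg (+-nonneg 0≤1 w≥0) (difference-nonneg (bound s x))) (*-nonneg w≥0 w≥0))
        (trans (solve 3 (λ w z a → con (ℤ.+ 1) :=
                  (con (ℤ.+ 1) :+ w) :* (z :* (con (ℤ.+ 1) :- a) :- w) :+ ((con (ℤ.+ 1) :+ w) :* (con (ℤ.+ 1) :- z :* (con (ℤ.+ 1) :- a)) :+ w :* w)) refl w (z x) (a x))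
          (cong (_+ ((1# + w) * (1# - z x * (1# - a x)) + w * w)) (sym (trans
            (cong (_* (1# - expose e z a x)) (scale-∈ z i))
            (trans (solve 5 (λ w z a r l → z :* (con (ℤ.+ 1) :+ w) :* (con (ℤ.+ 1) :- (a :+ r :* l)) := (con (ℤ.+ 1) :+ w) :* (z :* (con (ℤ.+ 1) :- a) :- r :* (z :* l))) refl w (z x) (a x) ρ (link z e x))
              (cong (λ t → (1# + w) * (z x * (1# - a x) - ρ * t)) (link-∈ z i)))))))

  bonus-mono : ∀ {e} es (a b : X → Carrier) → (∀ x → ρ * deg es x ≤ 1#) → (∀ x → a x ≤ b x) → ∀ x →
    overloaded (a x) * (Y³ - Y³ * (ρ * deg (e ∷ es) x)) ≤ overloaded (b x) * (Y³ - Y³ * (ρ * deg es x))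
  bonus-mono {e} es a b p q x = ≤-trans
    (*-monoʳ-nonneg (overloaded-nonneg (a x)) (≤-by _ (*-nonneg Y³≥0 (*-nonneg ρ≥0 (inc-nonneg e x)))
      (solve 4 (λ y r i d → y :- y :* (r :* d) := y :- y :* (r :* (i :+ d)) :+ y :* (r :* i)) refl Y³ ρ (inc e x) (deg es x))))
    (≤-trans (≤-reflexive (*-comm _ _)) (≤-trans (*-monoʳ-nonneg pos (overloaded-mono (q x))) (≤-reflexive (*-comm _ _))))
    where
    pos : 0# ≤ Y³ - Y³ * (ρ * deg es x)
    pos = difference-nonneg (≤-trans (*-monoʳ-nonneg Y³≥0 (p x)) (≤-reflexive (trans (*-comm _ _) (*-identityˡ _))))

  -- `x₀` stays overloaded because `a` only grows, and its remaining degree falls by one.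
  bonus-skip : ∀ {e es a b x₀} → (∀ x → ρ * deg es x ≤ 1#) → (∀ x → a x ≤ b x) → x₀ ∈ₑ e → ¬ a x₀ ≤ θ →
    ρ * Y³ + bonus (e ∷ es) a ≤ bonus es b
  bonus-skip {e} {es} {a} {b} {x₀} p q i n = ∑-mono-strict (complete x₀) (λ {x} _ → bonus-mono es a b p q x)
    (≤-reflexive (trans
      (cong₂ (λ s t → ρ * Y³ + s * (Y³ - Y³ * (ρ * (t + deg es x₀)))) (overloaded-≰ n) (inc-∈ i))
      (trans (solve 3 (λ r y d → r :* y :+ con (ℤ.+ 1) :* (y :- y :* (r :* (con (ℤ.+ 1) :+ d))) := con (ℤ.+ 1) :* (y :- y :* (r :* d))) refl ρ Y³ (deg es x₀))
        (cong (_* (Y³ - Y³ * (ρ * deg es x₀))) (sym (overloaded-≰ λ m → n (≤-trans (q x₀) m)))))))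

  -- With all edges exposed the load is `a x`. If it is at least `1 - ζ` while `lam x ≤ 1 - 2 ζ`,
  -- the deviation is at least `ζ`, and `A * ζ² = Y³` repays the full credit.
  bonus≤penalty : ∀ {lam z a} → (∀ x → lam x + (ζ + ζ) ≤ 1#) → bonus [] a ≤ penalty lam [] z a
  bonus≤penalty {lam} {z} {a} lam≤ = ≤-trans (∑-mono points λ {x} _ → pointwise x) (≤-reflexive (∑-*ˡ points A _))
    where
    pointwise : ∀ x → overloaded (a x) * (Y³ - Y³ * (ρ * 0#)) ≤ A * ((a x + ρ * 0# - lam x) * (a x + ρ * 0# - lam x))
    pointwise x with a x ≤? θ
    ... | yes _ = ≤-trans (≤-reflexive (zeroˡ _)) (*-nonneg A≥0 (square-nonneg _))
    ... | no  n = ≤-trans (≤-reflexive (trans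
        (solve 2 (λ y r → con (ℤ.+ 1) :* (y :- y :* (r :* con (ℤ.+ 0))) := y :* (con (ℤ.+ 1) :* con (ℤ.+ 1))) refl Y³ ρ)
        (trans (cong (λ t → Y³ * (t * t)) (sym Z*ζ≡1))
          (solve 3 (λ y Z ζ → y :* ((Z :* ζ) :* (Z :* ζ)) := y :* (Z :* Z) :* (ζ :* ζ)) refl Y³ Z ζ))))
      (*-monoʳ-nonneg A≥0 (*-mono-nonneg (≤-trans ζ≥0 ζ≤) ζ≥0 ζ≤ ζ≤))
      where
      θ≤a : θ ≤ a x
      θ≤a = [ (λ p → contradiction p n) , (λ p → p) ]′ (≤-total (a x) θ)
      ζ≤ : ζ ≤ a x + ρ * 0# - lam x
      ζ≤ = ≤-by _ (+-nonneg (difference-nonneg θ≤a) (difference-nonneg (lam≤ x)))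
        (solve 4 (λ ζ a r l → a :+ r :* con (ℤ.+ 0) :- l := ζ :+ ((a :- (con (ℤ.+ 1) :- ζ)) :+ (con (ℤ.+ 1) :- (l :+ (ζ :+ ζ))))) refl ζ (a x) ρ (lam x))

  -- Selecting an edge sets z to 0 on it, and zeros persist under `scale`; the last component
  -- therefore keeps later edges off all earlier selections.
  Matching : List E → (X → Carrier) → List E → Set
  Matching es z M = All (_∈ es) M × AllPairs Disjoint M × All (λ f → ∀ x → x ∈ₑ f → z x ≢ 0#) M

  matching-weaken : ∀ {e es z z′ M} → (∀ x → z x ≡ 0# → z′ x ≡ 0#) → Matching es z′ M → Matching (e ∷ es) z M
  matching-weaken p (i , disj , nz) = All.map there i , disj , All.map (λ h x x∈ zx≡0 → h x x∈ (p x zx≡0)) nz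

  scale-zero : ∀ {τ e} z x → z x ≡ 0# → scale τ e z x ≡ 0#
  scale-zero {τ} {e} z x p = trans (cong (_* (1# + τ * inc e x)) p) (zeroˡ _)

  matching-extend : ∀ {e es z M} → (∀ x → x ∈ₑ e → z x ≢ 0#) → Matching es (scale (- 1#) e z) M → Matching (e ∷ es) z (e ∷ M)
  matching-extend {e} {es} {z} h m@(i , disj , nz) with matching-weaken {e} (scale-zero z) m
  ... | i′ , disj′ , nz′ = here refl ∷ i′ , All.map disjoint nz ∷ disj′ , h ∷ nz′
    where
    disjoint : ∀ {f} → (∀ x → x ∈ₑ f → scale (- 1#) e z x ≢ 0#) → Disjoint e f
    disjoint g x x∈e x∈f = g x x∈f (trans (scale-∈ z x∈e) (trans (cong (z x *_) (-‿inverseʳ 1#)) (zeroʳ _)))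

  triple-≢0 : ∀ {z e x} → triple z e ≢ 0# → x ∈ₑ e → z x ≢ 0#
  triple-≢0 {z} {e} {x} h i p = h (trans (sym (link-∈ z i)) (trans (cong (_* link z e x) p) (zeroˡ _)))

  potential-step : ∀ {T W′ P′ n k c b b′ W Q} →
    T ≡ W - Q - κ → T ≤ c + W′ - P′ → W′ + b′ ≤ n + P′ + k → b ≤ b′ → W + b ≤ c + n + Q + (κ + k)
  potential-step {W′ = W′} {P′} {n} {k} {c} {b} {b′} {W} {Q} refl p q r =
    ≤-by _ (+-nonneg (+-nonneg (difference-nonneg p) (difference-nonneg q)) (difference-nonneg r))
      (solve 10 (λ W′ P′ n k c b b′ W Q κ → c :+ n :+ Q :+ (κ :+ k) :=
        W :+ b :+ (((c :+ W′ :- P′) :- (W :- Q :- κ)) :+ ((n :+ P′ :+ k) :- (W′ :+ b′)) :+ (b′ :- b))) refl W′ P′ n k c b b′ W Q κ)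

  skip-step : ∀ {n p k w W b b′ y} → W + b′ ≤ n + p + k → w ≤ y → y + b ≤ b′ → W + w + b ≤ n + p + (κ + k)
  skip-step {n} {p} {k} {w} {W} {b} {b′} {y} r s t =
    ≤-by _ (+-nonneg (+-nonneg (difference-nonneg r) (difference-nonneg s)) (+-nonneg (difference-nonneg t) κ≥0))
      (solve 9 (λ n p k w W b b′ y κ → n :+ p :+ (κ :+ k) :=
        W :+ w :+ b :+ ((n :+ p :+ k :- (W :+ b′)) :+ (y :- w) :+ ((b′ :- (y :+ b)) :+ κ))) refl n p k w W b b′ y κ)

  find-closed : ∀ (a : X → Carrier) e → (∃ λ x → x ∈ₑ e × ¬ a x ≤ θ) ⊎ (∀ x → x ∈ₑ e → a x ≤ θ)
  find-closed a e with a (v₀ e) ≤? θ | a (v₁ e) ≤? θ | a (v₂ e) ≤? θ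
  ... | no n  | _     | _     = inj₁ (_ , ∈₀ , n)
  ... | yes _ | no n  | _     = inj₁ (_ , ∈₁ , n)
  ... | yes _ | yes _ | no n  = inj₁ (_ , ∈₂ , n)
  ... | yes p | yes q | yes r = inj₂ λ { _ (inj₁ refl) → p ; _ (inj₂ (inj₁ refl)) → q ; _ (inj₂ (inj₂ refl)) → r }

  -- The potential argument read backwards from the end. At the start the penalty is 0 and the
  -- weight is `ρ` times the number of edges, so this bounds the matching from below with a loss of
  -- `κ` per edge.
  Outcome : (X → Carrier) → List E → (X → Carrier) → (X → Carrier) → Set
  Outcome lam es z a = ∃ λ M → Matching es z M ×
    weight es z + bonus es a ≤ ι (length M) + penalty lam es z a + ι (length es) * κ

  module Step (lam : X → Carrier) {e : E} {es : List E} (e∉ : All (e ≢_) es) (u : Unique es) (deg≤d : ∀ x → deg es x ≤ d)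
              (ih : ∀ {z a} → State z a → Outcome lam es z a) {z a : X → Carrier} (s : State z a) where
    private
      ρdeg≤1 : ∀ x → ρ * deg es x ≤ 1#
      ρdeg≤1 x = ≤-trans (*-monoʳ-nonneg ρ≥0 (deg≤d x)) (≤-trans (≤-by (ζ + ζ) (+-nonneg ζ≥0 ζ≥0) refl) ρd+2ζ≤1)

      a′ : X → Carrier
      a′ = expose e z a

      w₀ : Carrier
      w₀ = ρ * triple z e

      weight-∷ : weight (e ∷ es) z ≡ weight es z + w₀
      weight-∷ = solve 3 (λ r t s → r :* (t :+ s) := r :* s :+ r :* t) refl ρ (triple z e) (∑ es (triple z))

      ι-∷ : ι (length (e ∷ es)) * κ ≡ κ + ι (length es) * κ
      ι-∷ = trans (cong (_* κ) (ι-suc (length es))) (solve 2 (λ n κ → (con (ℤ.+ 1) :+ n) :* κ := κ :+ n :* κ) refl (ι (length es)) κ)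

      D B : X → Carrier
      D x = load (e ∷ es) z a x - lam x
      B = Δload e es z

      Q₀ Q₁ Q₂ : Carrier
      Q₀ = ∑ points (λ x → D x * D x)
      Q₁ = ∑ points (λ x → D x * B x)
      Q₂ = ∑ points (λ x → B x * B x)

      error : w₀ * w₀ + A * w₀ * Q₂ ≤ κ
      error = +-mono-≤ (*-mono-nonneg ρ≥0*Y³ (w≥0 s) (w≤ρY³ s) (w≤ρY³ s))
        (*-mono-nonneg (*-nonneg A≥0 ρ≥0*Y³) (∑-nonneg points λ {x} _ → square-nonneg (B x)) (*-monoʳ-nonneg A≥0 (w≤ρY³ s))
          (∑-Δload²-≤ e∉ u deg≤d (z≥0 s) (z≤Y s)))

      finish : ∀ {m} c τ n → m ≡ c + n →
        weight es z + w₀ - A * Q₀ - κ ≤ c + (weight es z + τ * Δweight e es z) - A * (Q₀ + (τ + τ) * Q₁ + τ * τ * Q₂) →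
        weight es (scale τ e z) + bonus es a′ ≤ n + penalty lam es (scale τ e z) a′ + ι (length es) * κ →
        weight (e ∷ es) z + bonus (e ∷ es) a ≤ m + A * Q₀ + ι (length (e ∷ es)) * κ
      finish c τ n m≡ p q = ≤-trans
        (≤-trans (≤-reflexive (cong (_+ bonus (e ∷ es) a) weight-∷))
          (potential-step refl p
            (≤-trans (≤-reflexive (cong (_+ bonus es a′) (sym (weight-scale e∉ τ z))))
              (≤-trans q (≤-reflexive (cong (λ t → n + t + ι (length es) * κ) (penalty-scale e∉ τ lam z a)))))
            (∑-mono points λ {x} _ → bonus-mono es a a′ ρdeg≤1 (expose-≥ s e) x)))
        (≤-reflexive (cong₂ (λ m k → m + A * Q₀ + k) (sym m≡) (sym ι-∷)))

      same : penalty lam es z a′ ≡ A * Q₀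
      same = cong (A *_) (∑-cong points λ {x} _ → cong (λ t → (t - lam x) * (t - lam x)) (load-expose e es z a x))

      skip-inequality : ∀ {n x} → x ∈ₑ e → ¬ a x ≤ θ →
        weight es z + bonus es a′ ≤ n + penalty lam es z a′ + ι (length es) * κ →
        weight (e ∷ es) z + bonus (e ∷ es) a ≤ n + A * Q₀ + ι (length (e ∷ es)) * κ
      skip-inequality {n} x∈e n≰ q = ≤-trans (≤-reflexive (cong (_+ bonus (e ∷ es) a) weight-∷))
        (≤-trans
          (skip-step q (w≤ρY³ s {e}) (bonus-skip {es = es} ρdeg≤1 (expose-≥ s e) x∈e n≰))
          (≤-reflexive (cong₂ (λ p k → n + p + k) same (sym ι-∷))))

      skip : ∀ {x} → x ∈ₑ e → ¬ a x ≤ θ → Outcome lam es z a′ → Outcome lam (e ∷ es) z a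
      skip x∈e n (M , m , q) = M , matching-weaken (λ _ p → p) m , skip-inequality x∈e n q

      pass : weight es z + w₀ - A * Q₀ - κ ≤ 0# + (weight es z + w₀ * Δweight e es z) - A * (Q₀ + (w₀ + w₀) * Q₁ + w₀ * w₀ * Q₂) →
             Outcome lam es (scale w₀ e z) a′ → Outcome lam (e ∷ es) z a
      pass p (M , m , q) = M , matching-weaken (scale-zero z) m , finish 0# w₀ (ι (length M)) (sym (+-identityˡ _)) p q

      select : w₀ ≢ 0# →
               weight es z + w₀ - A * Q₀ - κ ≤ 1# + (weight es z + - 1# * Δweight e es z) - A * (Q₀ + (- 1# + - 1#) * Q₁ + - 1# * - 1# * Q₂) →
               Outcome lam es (scale (- 1#) e z) a′ → Outcome lam (e ∷ es) z a
      select w≢0 p (M , m , q) = e ∷ M ,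
        matching-extend (λ x → triple-≢0 (λ t≡0 → w≢0 (trans (cong (ρ *_) t≡0) (zeroʳ ρ)))) m ,
        finish (1#) (- 1#) (ι (length M)) (ι-suc (length M)) p q

    -- The hypothesis `ih` covers every state, so the branch can be chosen by potential before its
    -- continuation is built.
    step : Outcome lam (e ∷ es) z a
    step = [ (λ { (_ , x∈e , n) → skip x∈e n (ih (skip-state s e)) })
           , (λ open-e → [ (λ p → pass p (ih (pass-state s open-e)))
                         , (λ (w≢0 , p) → select w≢0 p (ih (select-state s e))) ]′
                         (choice {C = Δweight e es z} {Q₁ = Q₁} (w≥0 s {e}) error)) ]′ (find-closed a e)

  -- `lam` stays fixed while loads move: it is the reference for deviations and will be the vector
  -- of initial loads.
  nibble : ∀ {lam} → (∀ x → lam x + (ζ + ζ) ≤ 1#) → ∀ es → Unique es → (∀ x → deg es x ≤ d) →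
    ∀ {z a} → State z a → Outcome lam es z a
  nibble {lam} lam≤ [] _ _ {z} {a} s = [] , ([] , [] , []) ,
    ≤-trans (+-mono-≤ (≤-reflexive (zeroʳ ρ)) (bonus≤penalty {z = z} lam≤))
      (≤-reflexive (solve 2 (λ p κ → con (ℤ.+ 0) :+ p := con (ℤ.+ 0) :+ p :+ con (ℤ.+ 0) :* κ) refl (penalty lam [] z a) κ))
  nibble {lam} lam≤ (e ∷ es) (e∉ ∷ u) deg≤d s = Step.step lam e∉ u deg-tail (nibble lam≤ es u deg-tail) s
    where
    deg-tail : ∀ x → deg es x ≤ d
    deg-tail x = ≤-trans (≤-by (inc e x) (inc-nonneg e x) (+-comm _ _)) (deg≤d x)

-- Choice of the nibble constants and the resulting matching size

module NibbleSize (F : OrderedField) (N : ℕ) where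
  open OrderedField F
  open FieldSolver F
  open OrderedFieldProperties F

  -- With `ζ = 1 / (2 n₂)` and `ρ = n₁ / (n₂ d)` one has `ρ d + 2 ζ = 1`. `Cₙ` is `κ / ρ²`, and
  -- `n₁² Cₙ ≤ d` keeps the total error `κ m` below `ρ m / n₁`. The two losses `n₁ / n₂` and
  -- `(n₁ - 1) / n₁` multiply to `N / (N + 1)`.
  n₁ n₂ Zₙ Yₙ Y³ₙ Cₙ threshold : ℕ
  n₁ = suc (N ℕ.+ N)
  n₂ = suc n₁
  Zₙ = n₂ ℕ.+ n₂
  Yₙ = Zₙ ℕ.+ Zₙ
  Y³ₙ = Yₙ ℕ.* (Yₙ ℕ.* Yₙ)
  Cₙ = Y³ₙ ℕ.* Y³ₙ ℕ.+ Y³ₙ ℕ.* (Zₙ ℕ.* Zₙ) ℕ.* Y³ₙ ℕ.* (3 ℕ.* (Yₙ ℕ.* Yₙ) ℕ.* (3 ℕ.* (3 ℕ.* (Yₙ ℕ.* Yₙ))))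
  -- The successor excludes the degree bound 0, so `nibble-matching` may match on `suc d`.
  threshold = suc (n₁ ℕ.* (n₁ ℕ.* Cₙ))

  module Constants (d′ : ℕ) (d≥ : threshold ℕ.≤ suc d′) where
    d : ℕ
    d = suc d′

    σ ζ ρ : Carrier
    σ = proj₁ (reciprocal (d′ ℕ.+ n₁ ℕ.* d))
    ζ = proj₁ (reciprocal (n₁ ℕ.+ n₂))
    ρ = ι n₁ * σ

    σ≥0 : 0# ≤ σ
    σ≥0 = proj₁ (proj₂ (reciprocal (d′ ℕ.+ n₁ ℕ.* d)))

    σ-inverse : σ * (ι n₂ * ι d) ≡ 1#
    σ-inverse = trans (cong (σ *_) (sym (ι-* n₂ d))) (proj₂ (proj₂ (reciprocal (d′ ℕ.+ n₁ ℕ.* d))))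

    ζ≥0 : 0# ≤ ζ
    ζ≥0 = proj₁ (proj₂ (reciprocal (n₁ ℕ.+ n₂)))

    ζ-inverse : ζ * (ι n₂ + ι n₂) ≡ 1#
    ζ-inverse = trans (cong (ζ *_) (sym (ι-+ n₂ n₂))) (proj₂ (proj₂ (reciprocal (n₁ ℕ.+ n₂))))

    Z*ζ≡1 : ι Zₙ * ζ ≡ 1#
    Z*ζ≡1 = trans (*-comm _ _) (trans (cong (ζ *_) (ι-+ n₂ n₂)) ζ-inverse)

    dσ≡2ζ : ι d * σ ≡ ζ + ζ
    dσ≡2ζ = begin
      ι d * σ                              ≡⟨ sym (*-identityʳ′ _) ⟩
      ι d * σ * 1#                         ≡⟨ cong (ι d * σ *_) (sym ζ-inverse) ⟩
      ι d * σ * (ζ * (ι n₂ + ι n₂))        ≡⟨ solve 4 (λ d s z n → d :* s :* (z :* (n :+ n)) := (z :+ z) :* (s :* (n :* d))) refl (ι d) σ ζ (ι n₂) ⟩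
      (ζ + ζ) * (σ * (ι n₂ * ι d))         ≡⟨ cong ((ζ + ζ) *_) σ-inverse ⟩
      (ζ + ζ) * 1#                         ≡⟨ *-identityʳ′ _ ⟩
      ζ + ζ                                ∎
      where
      open ≡-Reasoning
      *-identityʳ′ : ∀ a → a * 1# ≡ a
      *-identityʳ′ a = trans (*-comm a 1#) (*-identityˡ a)

    ρd+2ζ≡1 : ρ * ι d + (ζ + ζ) ≡ 1#
    ρd+2ζ≡1 = begin
      ι n₁ * σ * ι d + (ζ + ζ)        ≡⟨ cong (ι n₁ * σ * ι d +_) (sym dσ≡2ζ) ⟩
      ι n₁ * σ * ι d + ι d * σ        ≡⟨ solve 3 (λ n s d → n :* s :* d :+ d :* s := s :* ((con (ℤ.+ 1) :+ n) :* d)) refl (ι n₁) σ (ι d) ⟩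
      σ * ((1# + ι n₁) * ι d)         ≡⟨ cong (λ t → σ * (t * ι d)) (sym (ι-suc n₁)) ⟩
      σ * (ι n₂ * ι d)                ≡⟨ σ-inverse ⟩
      1#                              ∎
      where open ≡-Reasoning

    -- n₁ n₁ m ≤ d makes n₁ ρ m = n₁ n₁ m σ at most d σ n₂ = 1.
    ρ-small : ∀ {m} → n₁ ℕ.* (n₁ ℕ.* m) ℕ.≤ d → ι n₁ * (ρ * ι m) ≤ 1#
    ρ-small {m} p = ≤-trans
      (≤-reflexive (trans (solve 3 (λ n s m → n :* (n :* s :* m) := s :* (n :* (n :* m))) refl (ι n₁) σ (ι m))
        (cong (σ *_) (trans (cong (ι n₁ *_) (sym (ι-* n₁ m))) (sym (ι-* n₁ (n₁ ℕ.* m)))))))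
      (≤-trans (*-monoʳ-nonneg σ≥0 (ι-mono-≤ {n₁ ℕ.* (n₁ ℕ.* m)} {n₂ ℕ.* d} (ℕ.≤-trans p (ℕ.m≤n*m d n₂))))
        (≤-reflexive (trans (cong (σ *_) (ι-* n₂ d)) σ-inverse)))

    Y Y³ C : Carrier
    Y  = ι Zₙ + ι Zₙ
    Y³ = Y * (Y * Y)
    C  = Y³ * Y³ + Y³ * (ι Zₙ * ι Zₙ) * Y³ * ((1# + 1# + 1#) * (Y * Y) * ((1# + 1# + 1#) * ((1# + 1# + 1#) * (Y * Y))))

    ρ≥0 : 0# ≤ ρ
    ρ≥0 = *-nonneg (ι-nonneg n₁) σ≥0

    private
      record _↦_ (n : ℕ) (a : Carrier) : Set where
        constructor cast
        field uncast : ι n ≡ a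
      open _↦_

      infixl 7 _*↦_
      infixl 6 _+↦_

      _*↦_ : ∀ {m n a b} → m ↦ a → n ↦ b → (m ℕ.* n) ↦ (a * b)
      _*↦_ {m} {n} (cast refl) (cast refl) = cast (ι-* m n)

      _+↦_ : ∀ {m n a b} → m ↦ a → n ↦ b → (m ℕ.+ n) ↦ (a + b)
      _+↦_ {m} {n} (cast refl) (cast refl) = cast (ι-+ m n)

      3↦ : 3 ↦ (1# + 1# + 1#)
      3↦ = cast (sym (+-assoc 1# 1# 1#))

      Z↦ : Zₙ ↦ ι Zₙ
      Z↦ = cast refl

      Y↦ : Yₙ ↦ Y
      Y↦ = Z↦ +↦ Z↦

      Y³↦ : Y³ₙ ↦ Y³
      Y³↦ = Y↦ *↦ (Y↦ *↦ Y↦)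

      C↦ : Cₙ ↦ C
      C↦ = Y³↦ *↦ Y³↦ +↦ Y³↦ *↦ (Z↦ *↦ Z↦) *↦ Y³↦ *↦ (3↦ *↦ (Y↦ *↦ Y↦) *↦ (3↦ *↦ (3↦ *↦ (Y↦ *↦ Y↦))))

      Y³ₙ≤Cₙ : Y³ₙ ℕ.≤ Cₙ
      Y³ₙ≤Cₙ = ℕ.≤-trans (ℕ.m≤m*n Y³ₙ Y³ₙ) (ℕ.m≤m+n _ _)

    n₁ρC≤1 : ι n₁ * (ρ * C) ≤ 1#
    n₁ρC≤1 = ≤-trans (≤-reflexive (cong (λ t → ι n₁ * (ρ * t)) (sym (uncast C↦))))
      (ρ-small (ℕ.≤-trans (ℕ.n≤1+n _) d≥))

    ρY³≤1 : ρ * Y³ ≤ 1#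
    ρY³≤1 = ≤-trans (≤-trans (≤-reflexive (trans (cong (ρ *_) (sym (uncast Y³↦))) (sym (*-identityˡ _))))
      (*-mono-nonneg (ι-nonneg n₁) (*-nonneg ρ≥0 (ι-nonneg Y³ₙ)) (ι-mono-≤ {1} {n₁} (ℕ.s≤s ℕ.z≤n)) ≤-refl))
      (ρ-small (ℕ.≤-trans (ℕ.*-monoʳ-≤ n₁ (ℕ.*-monoʳ-≤ n₁ Y³ₙ≤Cₙ)) (ℕ.≤-trans (ℕ.n≤1+n _) d≥)))

    constants : NibbleConstants F
    constants = record { ρ = ρ ; ζ = ζ ; Z = ι Zₙ ; d = ι d ; ρ≥0 = ρ≥0 ; ζ≥0 = ζ≥0 ; Z≥0 = ι-nonneg Zₙ
      ; Z*ζ≡1 = Z*ζ≡1 ; ρd+2ζ≤1 = ≤-reflexive ρd+2ζ≡1 ; ρY³≤1 = ρY³≤1 }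

    κ≡ρρC : NibbleConstants.κ constants ≡ ρ * (ρ * C)
    κ≡ρρC = solve 4 (λ r y yy zz →
        r :* y :* (r :* y) :+ y :* zz :* (r :* y) :* (con (ℤ.+ 3) :* (r :* yy) :* (con (ℤ.+ 3) :* (con (ℤ.+ 3) :* yy))) :=
        r :* (r :* (y :* y :+ y :* zz :* y :* (con (ℤ.+ 3) :* yy :* (con (ℤ.+ 3) :* (con (ℤ.+ 3) :* yy)))))) refl ρ Y³ (Y * Y) (ι Zₙ * ι Zₙ)

    module _ (H : LinearTripleSystem) where
      open LinearTripleSystem H hiding (_≟_)
      open Sum orderedSemiring
      open Incidence H orderedSemiring
      open Exposure H F using (link)
      open Nibble H F constants
      private module ℕI = Incidence H ℕ-orderedSemiring

      one zero′ : X → Carrier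
      one   _ = 1#
      zero′ _ = 0#

      private
        link-one : ∀ f x → link one f x ≡ inc f x
        link-one f x = solve 3 (λ a b c → a :* (con (ℤ.+ 1) :* con (ℤ.+ 1)) :+ b :* (con (ℤ.+ 1) :* con (ℤ.+ 1)) :+ c :* (con (ℤ.+ 1) :* con (ℤ.+ 1)) := a :+ b :+ c) refl _ _ _

        load-start : ∀ es x → load es one zero′ x ≡ ρ * deg es x
        load-start es x = trans (+-identityˡ _) (cong (ρ *_) (∑-cong es λ {f} _ → link-one f x))

        weight-start : ∀ es → weight es one ≡ ρ * ι (length es)
        weight-start es = cong (ρ *_) (count es)
          where
          count : ∀ es → ∑ es (λ _ → 1# * (1# * 1#)) ≡ ι (length es)
          count []       = refl
          count (e ∷ es) = trans (cong₂ _+_ (trans (*-identityˡ _) (*-identityˡ _)) (count es)) (sym (ι-suc (length es)))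

        start : State one zero′
        start = record
          { z≥0 = λ _ → 0≤1
          ; z≤Y = λ _ → ≤-trans (ι-mono-≤ {1} {Yₙ} (ℕ.s≤s ℕ.z≤n)) (≤-reflexive (uncast Y↦))
          ; bound = λ _ → ≤-reflexive (solve 0 (con (ℤ.+ 1) :* (con (ℤ.+ 1) :- con (ℤ.+ 0)) := con (ℤ.+ 1)) refl)
          }

        penalty-start : ∀ es → penalty (load es one zero′) es one zero′ ≡ 0#
        penalty-start es = trans (cong (A *_) (∑-zero points λ _ → solve 1 (λ l → (l :- l) :* (l :- l) := con (ℤ.+ 0)) refl _)) (zeroʳ A)
          where open NibbleConstants constants using (A)

        bonus-nonneg : ∀ es a → (∀ x → ρ * deg es x ≤ 1#) → 0# ≤ bonus es a
        bonus-nonneg es a p = ∑-nonneg points λ {x} _ → *-nonneg (overloaded-nonneg (a x))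
          (difference-nonneg (≤-trans (*-monoʳ-nonneg Y³≥0 (p x)) (≤-reflexive (trans (*-comm _ _) (*-identityˡ _)))))

        -- Multiplied by `n₁`, the error is at most `ρ m` since `n₁ ρ C ≤ 1`; hence `n₁ M ≥ (n₁ - 1)
        -- ρ m = ρ k m ≥ ρ n₂ d r = n₁ r`.
        conclude : ∀ {m M r k} → 0# ≤ m → ρ * m ≤ M + m * (ρ * (ρ * C)) → ι n₂ * (ι d * r) ≤ k * m → ι n₁ ≡ 1# + k → ι n₁ * r ≤ ι n₁ * M
        conclude {m} {M} {r} {k} m≥0 p q n₁≡ = ≤-trans
          (≤-reflexive (trans (sym (*-identityˡ _)) (trans (cong (_* (ι n₁ * r)) (sym σ-inverse))
            (solve 5 (λ s n d r l → s :* (n :* d) :* (l :* r) := l :* s :* (n :* (d :* r))) refl σ (ι n₂) (ι d) r (ι n₁)))))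
          (≤-trans (*-monoʳ-nonneg ρ≥0 q) (+-cancelʳ-≤ (ρ * m)
            (≤-trans (≤-reflexive (trans (solve 3 (λ r k m → r :* (k :* m) :+ r :* m := (con (ℤ.+ 1) :+ k) :* (r :* m)) refl ρ k m) (cong (_* (ρ * m)) (sym n₁≡))))
              (≤-trans (*-monoʳ-nonneg (ι-nonneg n₁) p)
                (≤-trans (≤-reflexive (solve 5 (λ n M m r C → n :* (M :+ m :* (r :* (r :* C))) := n :* M :+ r :* m :* (n :* (r :* C))) refl (ι n₁) M m ρ C))
                  (+-mono-≤ ≤-refl (≤-trans (*-monoʳ-nonneg (*-nonneg ρ≥0 m≥0) n₁ρC≤1) (≤-reflexive (trans (*-comm _ _) (*-identityˡ _))))))))))

      large-matching : ∀ r es → Unique es → (∀ x → ℕI.deg es x ℕ.≤ d) → suc N ℕ.* (d ℕ.* r) ℕ.≤ N ℕ.* length es →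
        ∃ λ M → All (_∈ es) M × AllPairs Disjoint M × r ℕ.≤ length M
      large-matching r es u deg≤d enough = result (nibble lam≤ es u degR≤ start)
        where
        degR≤ : ∀ x → deg es x ≤ ι d
        degR≤ x = ≤-trans (≤-reflexive (sym (IncidenceCast.ι-deg H F es x))) (ι-mono-≤ (deg≤d x))

        lam≤ : ∀ x → load es one zero′ x + (ζ + ζ) ≤ 1#
        lam≤ x = ≤-trans (+-mono-≤ (≤-trans (≤-reflexive (load-start es x)) (*-monoʳ-nonneg ρ≥0 (degR≤ x))) ≤-refl) (≤-reflexive ρd+2ζ≡1)

        ρdeg≤1 : ∀ x → ρ * deg es x ≤ 1#
        ρdeg≤1 x = ≤-trans (≤-by (ζ + ζ) (+-nonneg ζ≥0 ζ≥0) refl)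
          (≤-trans (+-mono-≤ (*-monoʳ-nonneg ρ≥0 (degR≤ x)) ≤-refl) (≤-reflexive ρd+2ζ≡1))

        enough′ : ι n₂ * (ι d * ι r) ≤ ι (N ℕ.+ N) * ι (length es)
        enough′ = ≤-trans (≤-reflexive (trans (cong (ι n₂ *_) (sym (ι-* d r))) (sym (ι-* n₂ (d ℕ.* r)))))
          (≤-trans (ι-mono-≤ doubled) (≤-reflexive (ι-* (N ℕ.+ N) (length es))))
          where
          doubled : n₂ ℕ.* (d ℕ.* r) ℕ.≤ (N ℕ.+ N) ℕ.* length es
          doubled = ℕ.≤-trans (ℕ.≤-reflexive (trans (cong (ℕ._* (d ℕ.* r)) (cong suc (sym (ℕ.+-suc N N)))) (ℕ.*-distribʳ-+ (d ℕ.* r) (suc N) (suc N))))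
            (ℕ.≤-trans (ℕ.+-mono-≤ enough enough) (ℕ.≤-reflexive (sym (ℕ.*-distribʳ-+ (length es) N N))))

        result : Outcome (load es one zero′) es one zero′ → ∃ λ M → All (_∈ es) M × AllPairs Disjoint M × r ℕ.≤ length M
        result (M , (M⊆ , disj , _) , q) = M , M⊆ , disj , ℕ.*-cancelˡ-≤ {r} {length M} n₁ (ι-cancel-≤ {n₁ ℕ.* r} {n₁ ℕ.* length M}
          (≤-trans (≤-reflexive (ι-* n₁ r)) (≤-trans
            (conclude (ι-nonneg (length es)) bound′ enough′ (ι-suc (N ℕ.+ N)))
            (≤-reflexive (sym (ι-* n₁ (length M)))))))
          where
          bound′ : ρ * ι (length es) ≤ ι (length M) + ι (length es) * (ρ * (ρ * C))
          bound′ = ≤-trans (≤-trans (≤-by _ (bonus-nonneg es zero′ ρdeg≤1) (cong (_+ bonus es zero′) (weight-start es))) q)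
            (≤-reflexive (cong₂ _+_ (trans (cong (ι (length M) +_) (penalty-start es)) (+-identityʳ _)) (cong (ι (length es) *_) κ≡ρρC)))

-- The o(1) loss is packaged as a slack factor `1 + 1 / N` in the number of edges, with `d₀`
-- depending on `N` alone.
nibble-matching : ∀ N → ∃ λ d₀ → ∀ (H : LinearTripleSystem) → let open LinearTripleSystem H in ∀ d r (es : List E) →
  d₀ ℕ.≤ d → Unique es → (∀ x → Incidence.deg H ℕ-orderedSemiring es x ℕ.≤ d) → suc N ℕ.* (d ℕ.* r) ℕ.≤ N ℕ.* length es →
  ∃ λ M → All (_∈ es) M × AllPairs Disjoint M × r ℕ.≤ length M
nibble-matching N = threshold , λ { H (suc d) r es d≥ → Constants.large-matching d d≥ H r es }
  where open NibbleSize ℚ-orderedField N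

-- Truncation of degrees and greedy extension

module MatchingTheory where
  open import Data.Nat
  open import Data.Nat.Properties
  open Sum ℕ-orderedSemiring

  module _ {A : Set} where

    ∑-const : ∀ (xs : List A) c → ∑ xs (λ _ → c) ≡ length xs * c
    ∑-const []       c = refl
    ∑-const (x ∷ xs) c = cong (c +_) (∑-const xs c)

    ∑-≤-const : ∀ (xs : List A) {f} c → (∀ {x} → x ∈ xs → f x ≤ c) → ∑ xs f ≤ length xs * c
    ∑-≤-const xs c p = ≤-trans (∑-mono xs p) (≤-reflexive (∑-const xs c))

    ∑-filter : ∀ {P : Pred A 0ℓ} (P? : Decidable P) (xs : List A) {f} → (∀ x → ¬ P x → f x ≡ 0) → ∑ xs f ≡ ∑ (filter P? xs) f
    ∑-filter P? []       p = refl
    ∑-filter P? (x ∷ xs) {f} p with P? x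
    ... | yes _ = cong (_ +_) (∑-filter P? xs p)
    ... | no  n = trans (cong (_+ ∑ xs f) (p x n)) (∑-filter P? xs p)

    ∑-≤-filters : ∀ {P Q : Pred A 0ℓ} (P? : Decidable P) (Q? : Decidable Q) (xs : List A) {f} c →
      (∀ x → f x ≤ c) → (∀ x → ¬ P x → ¬ Q x → f x ≡ 0) → ∑ xs f ≤ (length (filter P? xs) + length (filter Q? xs)) * c
    ∑-≤-filters P? Q? [] c b p = z≤n
    ∑-≤-filters P? Q? (x ∷ xs) {f} c b p with P? x | Q? x
    ... | yes _ | yes _ = ≤-trans (+-mono-≤ (b x) (∑-≤-filters P? Q? xs c b p))
          (+-monoʳ-≤ c (*-monoˡ-≤ c (+-monoʳ-≤ (length (filter P? xs)) (n≤1+n _))))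
    ... | yes _ | no _  = +-mono-≤ (b x) (∑-≤-filters P? Q? xs c b p)
    ... | no _  | yes _ = ≤-trans (+-mono-≤ (b x) (∑-≤-filters P? Q? xs c b p))
          (≤-reflexive (cong (_* c) (sym (+-suc (length (filter P? xs)) (length (filter Q? xs))))))
    ... | no m  | no n  = ≤-trans (≤-reflexive (cong (_+ ∑ xs f) (p x m n))) (∑-≤-filters P? Q? xs c b p)

    delete : ∀ {x} (xs : List A) → x ∈ xs → List A
    delete (x ∷ xs) (here _)  = xs
    delete (x ∷ xs) (there i) = x ∷ delete xs i

    ∑-delete : ∀ {x} {xs : List A} (i : x ∈ xs) f → ∑ xs f ≡ f x + ∑ (delete xs i) f
    ∑-delete (here refl) f = refl
    ∑-delete {x} {y ∷ xs} (there i) f = trans (cong (f y +_) (∑-delete i f))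
      (+-*-Solver.solve 3 (λ a b c → a :+ (b :+ c) := b :+ (a :+ c)) refl (f y) (f x) (∑ (delete xs i) f))
      where open +-*-Solver

    length-delete : ∀ {x} {xs : List A} (i : x ∈ xs) → length xs ≡ suc (length (delete xs i))
    length-delete (here _)  = refl
    length-delete (there i) = cong suc (length-delete i)

    delete-⊆ : ∀ {x y} {xs : List A} (i : x ∈ xs) → y ∈ delete xs i → y ∈ xs
    delete-⊆ (here _)  j         = there j
    delete-⊆ (there i) (here p)  = here p
    delete-⊆ (there i) (there j) = there (delete-⊆ i j)

    unique-delete : ∀ {x} {xs : List A} (i : x ∈ xs) → Unique xs → Unique (delete xs i)
    unique-delete (here _)  (_ ∷ u)  = u
    unique-delete (there i) (x∉ ∷ u) = All.tabulate (λ j → All.lookup x∉ (delete-⊆ i j)) ∷ unique-delete i u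

  module Truncation (H : LinearTripleSystem) (d : ℕ) where
    open LinearTripleSystem H renaming (_≟_ to _≟ₓ_)
    open Incidence H ℕ-orderedSemiring

    excess : List E → ℕ
    excess es = ∑ points (λ x → deg es x ∸ d)

    deg-delete : ∀ {e es} (i : e ∈ es) x → deg es x ≡ inc e x + deg (delete es i) x
    deg-delete i x = ∑-delete i (λ f → inc f x)

    deg-delete-≤ : ∀ {e es} (i : e ∈ es) x → deg (delete es i) x ≤ deg es x
    deg-delete-≤ {e} i x = ≤-trans (m≤n+m _ (inc e x)) (≤-reflexive (sym (deg-delete i x)))

    incident : ∀ {es x} → 0 < deg es x → ∃ λ e → e ∈ es × x ∈ₑ e
    incident {es} {x} p with Any.any? (x ∈ₑ?_) es
    ... | yes q = find q
    ... | no  n = contradiction (∑-zero es λ {e} i → inc-∉ λ x∈ → n (Any.map (λ { refl → x∈ }) i)) (>⇒≢ p)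

    excess-drop : ∀ {e es} (i : e ∈ es) {x} → x ∈ₑ e → d < deg es x → suc (deg (delete es i) x ∸ d) ≤ deg es x ∸ d
    excess-drop {e} {es} i {x} x∈ p = ≤-reflexive (trans (sym (+-∸-assoc 1 d≤)) (cong (_∸ d) (sym deg≡)))
      where
      deg≡ : deg es x ≡ suc (deg (delete es i) x)
      deg≡ = trans (deg-delete i x) (cong (_+ deg (delete es i) x) (inc-∈ x∈))
      d≤ : d ≤ deg (delete es i) x
      d≤ = s≤s⁻¹ (≤-trans p (≤-reflexive deg≡))

    -- Every deletion is made at a point above `d`, so it lowers the excess by at least one.
    truncate : ∀ es → Unique es → ∃ λ es′ → (∀ {e} → e ∈ es′ → e ∈ es) × Unique es′ × (∀ x → deg es′ x ≤ d) × length es ≤ length es′ + excess es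
    truncate es u = go (length es) es u ≤-refl
      where
      go : ∀ n es → Unique es → length es ≤ n → ∃ λ es′ → (∀ {e} → e ∈ es′ → e ∈ es) × Unique es′ × (∀ x → deg es′ x ≤ d) × length es ≤ length es′ + excess es
      go n es u len with All.all? (λ x → deg es x ≤? d) points
      ... | yes p = es , (λ i → i) , u , (λ x → All.lookup p (complete x)) , m≤m+n _ _
      ... | no ¬p with find (All.¬All⇒Any¬ (λ x → deg es x ≤? d) points ¬p)
      ... | x , x∈pts , ¬q with incident {es} {x} (≤-trans (s≤s z≤n) (≰⇒> ¬q))
      go zero    [] u len | no _ | _ | _ , () , _
      go (suc n) es u len | no _ | x , x∈pts , ¬q | e , i , x∈e
        with go n (delete es i) (unique-delete i u) (s≤s⁻¹ (≤-trans (≤-reflexive (sym (length-delete i))) len))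
      ... | es′ , sub , u′ , deg≤ , len≤ = es′ , (λ j → delete-⊆ i (sub j)) , u′ , deg≤ , (begin
        length es                                  ≡⟨ length-delete i ⟩
        suc (length (delete es i))                 ≤⟨ s≤s len≤ ⟩
        suc (length es′ + excess (delete es i))    ≡⟨ sym (+-suc _ _) ⟩
        length es′ + suc (excess (delete es i))    ≤⟨ +-monoʳ-≤ (length es′) (∑-mono-strict x∈pts (λ {y} _ → ∸-monoˡ-≤ d (deg-delete-≤ i y)) (excess-drop i x∈e (≰⇒> ¬q))) ⟩
        length es′ + excess es                     ∎)
        where open ≤-Reasoning

    Independent : List E → Set
    Independent es = ∀ {e x y} → e ∈ es → x ∈ₑ e → y ∈ₑ e → d < deg es x → d < deg es y → x ≡ y

    -- In the application `v₂ e` is a colour, of degree at most `q < d`; on an edge only `v₀` and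
    -- `v₁` can then both exceed `d`.
    Light : List E → Set
    Light es = ∀ e → deg es (v₂ e) < d

    light-⊆ : ∀ es es′ → (∀ x → deg es′ x ≤ deg es x) → Light es → Light es′
    light-⊆ es es′ p l e = ≤-<-trans (p (v₂ e)) (l e)

    -- `high` holds because a deletion takes an edge from two points above `d` and one below. Thanks
    -- to it, points that drop out of the heavy set still count with degree at least `d` in
    -- `touching`.
    record Thinning (es es* : List E) : Set where
      field
        sub      : ∀ {e} → e ∈ es* → e ∈ es
        uniq     : Unique es*
        deg≤     : ∀ x → deg es* x ≤ deg es x
        high     : ∀ x → d ≤ deg es x → d ≤ deg es* x
        tradeoff : length es + length es + excess es* ≤ length es* + length es* + excess es
        indep    : Independent es*

    open Thinning

    -- Deleting an edge with two elements of degree above d costs one edge but lowers the excess by two.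
    thin : ∀ es → Unique es → Light es → ∃ (Thinning es)
    thin es u l = go (length es) es u l ≤-refl
      where
      Crowded : List E → E → Set
      Crowded es e = d < deg es (v₀ e) × d < deg es (v₁ e)

      crowded? : ∀ es → Decidable (Crowded es)
      crowded? es e = (d <? deg es (v₀ e)) ×-dec (d <? deg es (v₁ e))

      independent : ∀ {es} → Light es → ¬ Any (Crowded es) es → Independent es
      independent {es} l n {e} {x} {y} e∈ x∈ y∈ p q = at x∈ y∈ p q
        where
        not-both : d < deg es (v₀ e) → d < deg es (v₁ e) → ⊥
        not-both p q = n (Any.map (λ { refl → p , q }) e∈)
        at : ∀ {x y} → x ∈ₑ e → y ∈ₑ e → d < deg es x → d < deg es y → x ≡ y
        at (inj₂ (inj₂ refl)) _ p _ = contradiction p (<⇒≯ (l e))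
        at (inj₁ _) (inj₂ (inj₂ refl)) _ q = contradiction q (<⇒≯ (l e))
        at (inj₂ (inj₁ _)) (inj₂ (inj₂ refl)) _ q = contradiction q (<⇒≯ (l e))
        at (inj₁ refl) (inj₁ refl) _ _ = refl
        at (inj₂ (inj₁ refl)) (inj₂ (inj₁ refl)) _ _ = refl
        at (inj₁ refl) (inj₂ (inj₁ refl)) p q = ⊥-elim (not-both p q)
        at (inj₂ (inj₁ refl)) (inj₁ refl) p q = ⊥-elim (not-both q p)

      go : ∀ n es → Unique es → Light es → length es ≤ n → ∃ (Thinning es)
      go n es u l len with Any.any? (crowded? es) es
      ... | no ¬c = es , record { sub = λ i → i ; uniq = u ; deg≤ = λ _ → ≤-refl ; high = λ _ p → p ; tradeoff = ≤-refl ; indep = independent l ¬c }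
      ... | yes c with find c
      go zero    [] u l len | yes _ | _ , () , _
      go (suc n) es u l len | yes _ | e , i , p , q
        with go n (delete es i) (unique-delete i u) (light-⊆ es (delete es i) (deg-delete-≤ i) l) (s≤s⁻¹ (≤-trans (≤-reflexive (sym (length-delete i))) len))
      ... | es* , t = es* , record
        { sub = λ j → delete-⊆ i (sub t j) ; uniq = uniq t
        ; deg≤ = λ w → ≤-trans (deg≤ t w) (deg-delete-≤ i w)
        ; high = λ w r → high t w (high′ w r)
        ; tradeoff = trade
        ; indep = indep t }
        where
        es′ = delete es i

        drop : ∀ {w} → w ∈ₑ e → d < deg es w → d ≤ deg es′ w
        drop {w} w∈ r = s≤s⁻¹ (≤-trans r (≤-reflexive (trans (deg-delete i w) (cong (_+ deg es′ w) (inc-∈ w∈)))))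

        high′ : ∀ w → d ≤ deg es w → d ≤ deg es′ w
        high′ w r with w ∈ₑ? e
        ... | yes w∈@(inj₁ refl)          = drop w∈ p
        ... | yes w∈@(inj₂ (inj₁ refl))   = drop w∈ q
        ... | yes (inj₂ (inj₂ refl)) = contradiction r (<⇒≱ (l e))
        ... | no  w∉ = ≤-trans r (≤-reflexive (trans (deg-delete i w) (cong (_+ deg es′ w) (inc-∉ w∉))))

        excess-lower : 2 + excess es′ ≤ excess es
        excess-lower = lower₂
          where
          -- `f` adds one unit at `v₀ e` to the new excess, so that the two unit drops are taken one
          -- point at a time.
          f g : X → ℕ
          f x = δ (v₀ e) x + (deg es′ x ∸ d)
          g x = deg es x ∸ d
          f≤g : ∀ x → f x ≤ g x
          f≤g x with v₀ e ≟ₓ x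
          ... | yes refl = excess-drop i (inj₁ refl) p
          ... | no _     = ∸-monoˡ-≤ d (deg-delete-≤ i x)
          lower₁ : 1 + ∑ points f ≤ ∑ points g
          lower₁ = ∑-mono-strict (complete (v₁ e)) (λ {x} _ → f≤g x)
            (≤-trans (≤-reflexive (cong (λ t → suc (t + (deg es′ (v₁ e) ∸ d))) (δ-≢ (v₀≢v₁ e)))) (excess-drop i (inj₂ (inj₁ refl)) q))
          lower₂ : 2 + excess es′ ≤ excess es
          lower₂ = ≤-trans (s≤s (∑-mono-strict {f = λ x → deg es′ x ∸ d} {g = f} (complete (v₀ e)) (λ {x} _ → m≤n+m _ (δ (v₀ e) x))
              (≤-reflexive (cong (_+ (deg es′ (v₀ e) ∸ d)) (sym (δ-≡ {v₀ e} refl)))))) lower₁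

        trade : length es + length es + excess es* ≤ length es* + length es* + excess es
        trade = begin
          length es + length es + excess es*                      ≡⟨ cong (λ t → t + t + excess es*) (length-delete i) ⟩
          suc (length es′) + suc (length es′) + excess es*        ≡⟨ solve 2 (λ a b → con 1 :+ a :+ (con 1 :+ a) :+ b := con 2 :+ (a :+ a :+ b)) refl (length es′) (excess es*) ⟩
          2 + (length es′ + length es′ + excess es*)              ≤⟨ +-monoʳ-≤ 2 (tradeoff t) ⟩
          2 + (length es* + length es* + excess es′)              ≡⟨ solve 2 (λ a b → con 2 :+ (a :+ a :+ b) := a :+ a :+ (con 2 :+ b)) refl (length es*) (excess es′) ⟩
          length es* + length es* + (2 + excess es′)              ≤⟨ +-monoʳ-≤ (length es* + length es*) excess-lower ⟩
          length es* + length es* + excess es                     ∎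
          where
          open ≤-Reasoning
          open +-*-Solver

    -- This is `(κ - 1) (κ - 2) ≥ 0`. Halved, it is the Bonferroni inequality: points minus pairs of
    -- points count an edge at most once.
    3κ≤2+κ² : ∀ κ → 3 * κ ≤ 2 + κ * κ
    3κ≤2+κ² 0 = z≤n
    3κ≤2+κ² 1 = ≤-refl
    3κ≤2+κ² 2 = ≤-refl
    3κ≤2+κ² κ@(suc (suc (suc n))) = ≤-trans (*-monoˡ-≤ κ {3} {κ} (s≤s (s≤s (s≤s z≤n)))) (m≤n+m (κ * κ) 2)

    -- Summed over e, with κ e the number of elements of e in J: 3 κ e ≤ 2 + (κ e)².
    ∑-deg-codeg : ∀ es J → 3 * ∑ J (deg es) ≤ 2 * length es + ∑ J (λ x → ∑ J (codeg es x))
    ∑-deg-codeg es J = begin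
      3 * ∑ J (deg es)                                          ≡⟨ cong (3 *_) (∑-swap J es (λ x e → inc e x)) ⟩
      3 * ∑ es κ                                                ≡⟨ sym (∑-*ˡ es 3 κ) ⟩
      ∑ es (λ e → 3 * κ e)                                      ≤⟨ ∑-mono es (λ {e} _ → 3κ≤2+κ² (κ e)) ⟩
      ∑ es (λ e → 2 + κ e * κ e)                                ≡⟨ ∑-+ es (λ _ → 2) (λ e → κ e * κ e) ⟩
      ∑ es (λ _ → 2) + ∑ es (λ e → κ e * κ e)                   ≡⟨ cong₂ _+_ (trans (∑-const es 2) (*-comm (length es) 2)) pairs ⟩
      2 * length es + ∑ J (λ x → ∑ J (codeg es x))              ∎
      where
      open ≤-Reasoning
      κ : E → ℕ
      κ e = ∑ J (inc e)
      pairs : ∑ es (λ e → κ e * κ e) ≡ ∑ J (λ x → ∑ J (codeg es x))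
      pairs = trans (∑-cong es λ {e} _ → trans (sym (∑-*ʳ J (κ e) (inc e))) (∑-cong J λ {x} _ → sym (∑-*ˡ J (inc e x) (inc e))))
        (trans (∑-swap es J (λ e x → ∑ J (λ y → inc e x * inc e y))) (∑-cong J λ {x} _ → ∑-swap es J (λ e y → inc e x * inc e y)))

    module _ {es* : List E} (uniq* : Unique es*) (indep* : Independent es*) where

      heavy : List X
      heavy = filter (λ x → d <? deg es* x) points

      heavy-∈ : ∀ {x} → x ∈ heavy → d < deg es* x
      heavy-∈ i = proj₂ (∈-filter⁻ (λ x → d <? deg es* x) {xs = points} i)

      codeg-heavy : ∀ {x y} → x ∈ heavy → y ∈ heavy → x ≢ y → codeg es* x y ≡ 0
      codeg-heavy {x} {y} i j x≢y = ∑-zero es* λ {e} e∈ → zero-at e∈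
        where
        zero-at : ∀ {e} → e ∈ es* → inc e x * inc e y ≡ 0
        zero-at {e} e∈ with inc*inc-cases e x y
        ... | inj₁ ((x∈ , y∈) , _) = contradiction (indep* e∈ x∈ y∈ (heavy-∈ i) (heavy-∈ j)) x≢y
        ... | inj₂ (_ , p) = p

      excess≡ : excess es* ≡ ∑ heavy (λ x → deg es* x ∸ d)
      excess≡ = ∑-filter (λ x → d <? deg es* x) points (λ x n → m≤n⇒m∸n≡0 (≮⇒≥ n))

      excess-heavy-≤ : ∀ Δ → (∀ x → deg es* x ≤ d + Δ) → excess es* ≤ length heavy * Δ
      excess-heavy-≤ Δ p = ≤-trans (≤-reflexive excess≡) (∑-≤-const heavy Δ λ {x} _ → ≤-trans (∸-monoˡ-≤ d (p x)) (≤-reflexive (m+n∸m≡n d Δ)))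

      _∈?_ : ∀ x (ys : List X) → Dec (x ∈ ys)
      x ∈? ys = Any.any? (x ≟ₓ_) ys

      -- Bonferroni for the edges that meet `heavy` or `L`. Independence leaves no common edge for
      -- two heavy points, other pairs have at most one, and `l * (2 * i + l)` bounds the ordered
      -- pairs that involve `L`. Heavy degrees are `d` plus their excess.
      touching : ∀ L → Unique L → (∀ {x} → x ∈ L → x ∉ heavy) → (∀ {x} → x ∈ L → d ≤ deg es* x) →
        2 * ((length heavy + length L) * d + excess es*) ≤ 2 * length es* + length L * (2 * length heavy + length L)
      touching L uL L∩heavy L-deg = +-cancelˡ-≤ (∑ J (deg es*)) _ _ (begin
        ∑ J (deg es*) + 2 * ((i + l) * d + excess es*)      ≤⟨ +-monoʳ-≤ (∑ J (deg es*)) (*-monoʳ-≤ 2 lower) ⟩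
        3 * ∑ J (deg es*)                                   ≤⟨ ∑-deg-codeg es* J ⟩
        2 * length es* + ∑ J (λ x → ∑ J (codeg es* x))      ≤⟨ +-monoʳ-≤ (2 * length es*) upper ⟩
        2 * length es* + (∑ J (deg es*) + l * (2 * i + l))  ≡⟨ solve 3 (λ a b c → a :+ (b :+ c) := b :+ (a :+ c)) refl (2 * length es*) (∑ J (deg es*)) (l * (2 * i + l)) ⟩
        ∑ J (deg es*) + (2 * length es* + l * (2 * i + l))  ∎)
        where
        open ≤-Reasoning
        open +-*-Solver
        J = heavy ++ L
        i = length heavy
        l = length L

        uheavy : Unique heavy
        uheavy = Unique.filter⁺ (λ x → d <? deg es* x) unique

        lower : (i + l) * d + excess es* ≤ ∑ J (deg es*)
        lower = begin
          (i + l) * d + excess es*                                   ≡⟨ cong ((i + l) * d +_) excess≡ ⟩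
          (i + l) * d + ∑ heavy (λ x → deg es* x ∸ d)                ≡⟨ solve 4 (λ i l d s → (i :+ l) :* d :+ s := (i :* d :+ s) :+ l :* d) refl i l d (∑ heavy (λ x → deg es* x ∸ d)) ⟩
          (i * d + ∑ heavy (λ x → deg es* x ∸ d)) + l * d            ≡⟨ cong₂ _+_ (trans (cong (_+ ∑ heavy (λ x → deg es* x ∸ d)) (sym (∑-const heavy d))) (sym (∑-+ heavy (λ _ → d) _))) (sym (∑-const L d)) ⟩
          ∑ heavy (λ x → d + (deg es* x ∸ d)) + ∑ L (λ _ → d)        ≤⟨ +-mono-≤ (∑-mono heavy λ j → ≤-reflexive (m+[n∸m]≡n (<⇒≤ (heavy-∈ j)))) (∑-mono L L-deg) ⟩
          ∑ heavy (deg es*) + ∑ L (deg es*)                          ≡⟨ sym (∑-++ heavy L (deg es*)) ⟩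
          ∑ J (deg es*)                                              ∎

        codeg-self : ∀ {x y} → y ≡ x → codeg es* x y ≤ deg es* x
        codeg-self {x} refl = ≤-reflexive (deg-self es* x)

        ones : ∀ {ys x} → (∀ {y} → y ∈ ys → y ≢ x) → ∑ ys (codeg es* x) ≤ length ys
        ones {ys} {x} p = ≤-trans (∑-≤-const ys 1 λ j → codeg≤1 uniq* λ q → p j (sym q)) (≤-reflexive (*-identityʳ _))

        row-heavy : ∀ {x} → x ∈ heavy → ∑ J (codeg es* x) ≤ deg es* x + l
        row-heavy {x} j = ≤-trans (≤-reflexive (∑-++ heavy L (codeg es* x))) (+-mono-≤
          (≤-trans (∑-bound-except {g = λ _ → 0} uheavy (λ _ → z≤n) z≤n (λ k y≢x → ≤-reflexive (codeg-heavy j k λ q → y≢x (sym q))) (λ _ → codeg-self) (x ∈? heavy))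
            (≤-reflexive (trans (cong (deg es* x +_) (∑-zero heavy λ _ → refl)) (+-identityʳ _))))
          (ones λ k q → L∩heavy k (subst (_∈ heavy) (sym q) j)))

        row-L : ∀ {x} → x ∈ L → ∑ J (codeg es* x) ≤ deg es* x + (i + l)
        row-L {x} j = ≤-trans (≤-reflexive (∑-++ heavy L (codeg es* x))) (≤-trans (+-mono-≤
            (ones λ k q → L∩heavy j (subst (_∈ heavy) q k))
            (≤-trans (∑-bound-except {g = λ _ → 1} uL (λ _ → z≤n) z≤n (λ k y≢x → codeg≤1 uniq* λ q → y≢x (sym q)) (λ _ → codeg-self) (x ∈? L))
              (≤-reflexive (cong (deg es* x +_) (trans (∑-const L 1) (*-identityʳ l))))))
          (≤-reflexive (solve 3 (λ i d l → i :+ (d :+ l) := d :+ (i :+ l)) refl i (deg es* x) l)))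

        upper : ∑ J (λ x → ∑ J (codeg es* x)) ≤ ∑ J (deg es*) + l * (2 * i + l)
        upper = begin
          ∑ J (λ x → ∑ J (codeg es* x))                                              ≡⟨ ∑-++ heavy L _ ⟩
          ∑ heavy (λ x → ∑ J (codeg es* x)) + ∑ L (λ x → ∑ J (codeg es* x))          ≤⟨ +-mono-≤ (∑-mono heavy row-heavy) (∑-mono L row-L) ⟩
          ∑ heavy (λ x → deg es* x + l) + ∑ L (λ x → deg es* x + (i + l))            ≡⟨ cong₂ _+_ (trans (∑-+ heavy (deg es*) _) (cong (∑ heavy (deg es*) +_) (∑-const heavy l))) (trans (∑-+ L (deg es*) _) (cong (∑ L (deg es*) +_) (∑-const L (i + l)))) ⟩
          (∑ heavy (deg es*) + i * l) + (∑ L (deg es*) + l * (i + l))                ≡⟨ solve 4 (λ a b i l → (a :+ i :* l) :+ (b :+ l :* (i :+ l)) := (a :+ b) :+ l :* (con 2 :* i :+ l)) refl (∑ heavy (deg es*)) (∑ L (deg es*)) i l ⟩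
          (∑ heavy (deg es*) + ∑ L (deg es*)) + l * (2 * i + l)                      ≡⟨ cong (_+ l * (2 * i + l)) (sym (∑-++ heavy L (deg es*))) ⟩
          ∑ J (deg es*) + l * (2 * i + l)                                            ∎

  -- Arithmetic of the surplus of edges over `d r`

  module Arithmetic where
    open +-*-Solver

    -- `i` is the size of I, `i + e` is r, `r + s` is q, `λ′` counts the points pushed down to at
    -- most `d` by thinning, and `m` is the number of edges after truncation.
    module _ (i e s g Δ λ′ m : ℕ) where
      private
        r d : ℕ
        r = i + e
        d = 2 * (r + s) + g

        expand : 2 * ((i + 2 * e) * d) ≡ (2 * (d * r + e * g) + 2 * e * (2 * i + 2 * e)) + 4 * (e * s)
        expand = solve 4 (λ i e s g → let r = i :+ e ; d = con 2 :* (r :+ s) :+ g in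
          con 2 :* ((i :+ con 2 :* e) :* d) := (con 2 :* (d :* r :+ e :* g) :+ con 2 :* e :* (con 2 :* i :+ con 2 :* e)) :+ con 4 :* (e :* s)) refl i e s g

        -- The hypothesis says `m ≥ d (r + e) - 2 e r`, and `d - 2 r ≥ g`.
        large : 2 * ((i + 2 * e) * d) ≤ 2 * m + 2 * e * (2 * i + 2 * e) → d * r + e * g ≤ m
        large p = *-cancelˡ-≤ 2 (+-cancelʳ-≤ (2 * e * (2 * i + 2 * e)) _ _
          (≤-trans (≤-trans (m≤m+n _ (4 * (e * s))) (≤-reflexive (sym expand))) p))

        -- Of the two bounds, `p′` improves and `q′` worsens with the shortfall `t`; the weights
        -- `2 d` and `2 Δ` make `t` cancel.
        small : ∀ t → λ′ + t ≡ 2 * e → 2 * ((d + Δ) * r) ≤ 2 * m + Δ * (2 * i + λ′) → 2 * ((i + λ′) * d) ≤ 2 * m + λ′ * (2 * i + λ′) →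
                (2 * d + Δ) * (d * r) + g * (e * Δ) ≤ (2 * d + Δ) * m
        small t λ+t≡2e p q = *-cancelˡ-≤ 2 (+-cancelʳ-≤ (2 * (d * (Δ * t))) _ _ (begin
          2 * ((2 * d + Δ) * (d * r) + g * (e * Δ)) + 2 * (d * (Δ * t))
            ≡⟨ solve 6 (λ d r g e Δ t → con 2 :* ((con 2 :* d :+ Δ) :* (d :* r) :+ g :* (e :* Δ)) :+ con 2 :* (d :* (Δ :* t)) := con 2 :* d :* (con 2 :* (d :* r) :+ Δ :* t) :+ con 2 :* Δ :* (d :* r :+ e :* g)) refl d r g e Δ t ⟩
          2 * d * (2 * (d * r) + Δ * t) + 2 * Δ * (d * r + e * g)
            ≤⟨ +-mono-≤ (*-monoʳ-≤ (2 * d) p′) (*-monoʳ-≤ (2 * Δ) q′) ⟩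
          2 * d * (2 * m) + 2 * Δ * (m + d * t)
            ≡⟨ solve 4 (λ d m Δ t → con 2 :* d :* (con 2 :* m) :+ con 2 :* Δ :* (m :+ d :* t) := con 2 :* ((con 2 :* d :+ Δ) :* m) :+ con 2 :* (d :* (Δ :* t))) refl d m Δ t ⟩
          2 * ((2 * d + Δ) * m) + 2 * (d * (Δ * t)) ∎))
          where
          open ≤-Reasoning
          p′ : 2 * (d * r) + Δ * t ≤ 2 * m
          p′ = +-cancelʳ-≤ (2 * (Δ * r)) _ _ (begin
            2 * (d * r) + Δ * t + 2 * (Δ * r)     ≡⟨ solve 4 (λ d r Δ t → con 2 :* (d :* r) :+ Δ :* t :+ con 2 :* (Δ :* r) := con 2 :* ((d :+ Δ) :* r) :+ Δ :* t) refl d r Δ t ⟩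
            2 * ((d + Δ) * r) + Δ * t             ≤⟨ +-monoˡ-≤ (Δ * t) p ⟩
            2 * m + Δ * (2 * i + λ′) + Δ * t      ≡⟨ solve 5 (λ m Δ i l t → con 2 :* m :+ Δ :* (con 2 :* i :+ l) :+ Δ :* t := con 2 :* m :+ Δ :* (con 2 :* i :+ (l :+ t))) refl m Δ i λ′ t ⟩
            2 * m + Δ * (2 * i + (λ′ + t))        ≡⟨ cong (λ k → 2 * m + Δ * (2 * i + k)) λ+t≡2e ⟩
            2 * m + Δ * (2 * i + 2 * e)           ≡⟨ solve 4 (λ m Δ i e → con 2 :* m :+ Δ :* (con 2 :* i :+ con 2 :* e) := con 2 :* m :+ con 2 :* (Δ :* (i :+ e))) refl m Δ i e ⟩
            2 * m + 2 * (Δ * r)                   ∎)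
          λ≤2e : λ′ ≤ 2 * e
          λ≤2e = ≤-trans (m≤m+n λ′ t) (≤-reflexive λ+t≡2e)
          q′ : d * r + e * g ≤ m + d * t
          q′ = *-cancelˡ-≤ 2 (+-cancelʳ-≤ (2 * e * (2 * i + 2 * e)) _ _ (begin
            2 * (d * r + e * g) + 2 * e * (2 * i + 2 * e)    ≤⟨ m≤m+n _ (4 * (e * s)) ⟩
            (2 * (d * r + e * g) + 2 * e * (2 * i + 2 * e)) + 4 * (e * s) ≡⟨ sym expand ⟩
            2 * ((i + 2 * e) * d)                            ≡⟨ cong (λ k → 2 * ((i + k) * d)) (sym λ+t≡2e) ⟩
            2 * ((i + (λ′ + t)) * d)                         ≡⟨ solve 4 (λ i l t d → con 2 :* ((i :+ (l :+ t)) :* d) := con 2 :* ((i :+ l) :* d) :+ con 2 :* (d :* t)) refl i λ′ t d ⟩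
            2 * ((i + λ′) * d) + 2 * (d * t)                 ≤⟨ +-monoˡ-≤ (2 * (d * t)) q ⟩
            2 * m + λ′ * (2 * i + λ′) + 2 * (d * t)          ≤⟨ +-monoˡ-≤ (2 * (d * t)) (+-monoʳ-≤ (2 * m) (*-mono-≤ λ≤2e (+-monoʳ-≤ (2 * i) λ≤2e))) ⟩
            2 * m + 2 * e * (2 * i + 2 * e) + 2 * (d * t)    ≡⟨ solve 4 (λ m d t x → con 2 :* m :+ x :+ con 2 :* (d :* t) := con 2 :* (m :+ d :* t) :+ x) refl m d t (2 * e * (2 * i + 2 * e)) ⟩
            2 * (m + d * t) + 2 * e * (2 * i + 2 * e)        ∎))

      -- The first bound gives a surplus of `Δ (e - λ′ / 2)`, gone at `λ′ = 2 e`. From there on the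
      -- second bound at `l = 2 e` suffices; below it the two are combined.
      surplus : 2 * ((d + Δ) * r) ≤ 2 * m + Δ * (2 * i + λ′) → (∀ l → l ≤ λ′ → 2 * ((i + l) * d) ≤ 2 * m + l * (2 * i + l)) →
                (2 * d + Δ) * (d * r) + g * (e * Δ) ≤ (2 * d + Δ) * m
      surplus p q with 2 * e ≤? λ′
      ... | no  n = let (t , eq) = m≤n⇒∃[o]m+o≡n (<⇒≤ (≰⇒> n)) in small t eq p (q λ′ ≤-refl)
      ... | yes y = begin
        (2 * d + Δ) * (d * r) + g * (e * Δ)          ≤⟨ +-monoʳ-≤ ((2 * d + Δ) * (d * r)) (m≤m+n (g * (e * Δ)) (2 * d * (e * g))) ⟩
        (2 * d + Δ) * (d * r) + (g * (e * Δ) + 2 * d * (e * g)) ≡⟨ solve 5 (λ d Δ r e g → (con 2 :* d :+ Δ) :* (d :* r) :+ (g :* (e :* Δ) :+ con 2 :* d :* (e :* g)) := (con 2 :* d :+ Δ) :* (d :* r :+ e :* g)) refl d Δ r e g ⟩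
        (2 * d + Δ) * (d * r + e * g)                ≤⟨ *-monoʳ-≤ (2 * d + Δ) (large (q (2 * e) y)) ⟩
        (2 * d + Δ) * m                              ∎
        where open ≤-Reasoning

    -- The factors come from `d ≤ (2 c + 1) g`, `2 d + g ≤ (4 c + 3) g` and `q ≤ c g`.
    density : ℕ → ℕ
    density c = (2 * c + 1) * ((4 * c + 3) * c)

    surplus⇒density : ∀ c q g Δ e r m → 1 ≤ g → g ≤ Δ → q ≤ c * g → g * r ≤ q * e → let d = 2 * q + g in
      (2 * d + Δ) * (d * r) + g * (e * Δ) ≤ (2 * d + Δ) * m → suc (density c) * (d * r) ≤ density c * m
    surplus⇒density c q g@(suc _) Δ@(suc _) e r m _ g≤Δ q≤cg gr≤qe h = begin
      d * r + N * (d * r)          ≤⟨ +-monoˡ-≤ (N * (d * r)) dr≤NP ⟩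
      N * P + N * (d * r)          ≡⟨ solve 3 (λ N P x → N :* P :+ N :* x := N :* (x :+ P)) refl N P (d * r) ⟩
      N * (d * r + P)              ≡⟨ cong (N *_) m≡ ⟩
      N * m                        ∎
      where
      open ≤-Reasoning
      N d : ℕ
      N = density c
      d = 2 * q + g

      dr≤m : d * r ≤ m
      dr≤m = *-cancelˡ-≤ (2 * d + Δ) {{≢-nonZero λ z → contradiction (m+n≡0⇒n≡0 (2 * d) z) λ ()}} (≤-trans (m≤m+n _ (g * (e * Δ))) h)

      P : ℕ
      P = proj₁ (m≤n⇒∃[o]m+o≡n dr≤m)
      m≡ : d * r + P ≡ m
      m≡ = proj₂ (m≤n⇒∃[o]m+o≡n dr≤m)

      geΔ≤ : g * (e * Δ) ≤ (2 * d + Δ) * P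
      geΔ≤ = +-cancelˡ-≤ ((2 * d + Δ) * (d * r)) _ _ (≤-trans h (≤-reflexive (trans (cong ((2 * d + Δ) *_) (sym m≡)) (*-distribˡ-+ (2 * d + Δ) (d * r) P))))

      -- `Δ / (2 d + Δ)` grows with `Δ`, so `Δ` may be lowered to `g`.
      gge≤ : g * (g * e) ≤ (2 * d + g) * P
      gge≤ = *-cancelˡ-≤ Δ (begin
        Δ * (g * (g * e))        ≡⟨ solve 3 (λ Δ g e → Δ :* (g :* (g :* e)) := g :* (g :* (e :* Δ))) refl Δ g e ⟩
        g * (g * (e * Δ))        ≤⟨ *-monoʳ-≤ g geΔ≤ ⟩
        g * ((2 * d + Δ) * P)    ≡⟨ solve 4 (λ g d Δ P → g :* ((con 2 :* d :+ Δ) :* P) := (g :* (con 2 :* d) :+ g :* Δ) :* P) refl g d Δ P ⟩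
        (g * (2 * d) + g * Δ) * P ≤⟨ *-monoˡ-≤ P (+-monoˡ-≤ (g * Δ) (*-monoˡ-≤ (2 * d) g≤Δ)) ⟩
        (Δ * (2 * d) + g * Δ) * P ≡⟨ solve 4 (λ g d Δ P → (Δ :* (con 2 :* d) :+ g :* Δ) :* P := Δ :* ((con 2 :* d :+ g) :* P)) refl g d Δ P ⟩
        Δ * ((2 * d + g) * P)    ∎)

      gr≤ : g * r ≤ (4 * c + 3) * c * P
      gr≤ = *-cancelˡ-≤ g (*-cancelˡ-≤ g (begin
        g * (g * (g * r))                              ≤⟨ *-monoʳ-≤ g (*-monoʳ-≤ g gr≤qe) ⟩
        g * (g * (q * e))                              ≡⟨ solve 3 (λ g q e → g :* (g :* (q :* e)) := q :* (g :* (g :* e))) refl g q e ⟩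
        q * (g * (g * e))                              ≤⟨ *-mono-≤ q≤cg gge≤ ⟩
        c * g * ((2 * d + g) * P)                      ≡⟨ solve 4 (λ c g q P → c :* g :* ((con 2 :* (con 2 :* q :+ g) :+ g) :* P) := c :* g :* ((con 4 :* q :+ con 3 :* g) :* P)) refl c g q P ⟩
        c * g * ((4 * q + 3 * g) * P)                  ≤⟨ *-monoʳ-≤ (c * g) (*-monoˡ-≤ P (+-monoˡ-≤ (3 * g) (*-monoʳ-≤ 4 q≤cg))) ⟩
        c * g * ((4 * (c * g) + 3 * g) * P)            ≡⟨ solve 3 (λ c g P → c :* g :* ((con 4 :* (c :* g) :+ con 3 :* g) :* P) := g :* (g :* ((con 4 :* c :+ con 3) :* c :* P))) refl c g P ⟩
        g * (g * ((4 * c + 3) * c * P))                ∎))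

      dr≤NP : d * r ≤ N * P
      dr≤NP = begin
        (2 * q + g) * r                  ≤⟨ *-monoˡ-≤ r (+-monoˡ-≤ g (*-monoʳ-≤ 2 q≤cg)) ⟩
        (2 * (c * g) + g) * r            ≡⟨ solve 3 (λ c g r → (con 2 :* (c :* g) :+ g) :* r := (con 2 :* c :+ con 1) :* (g :* r)) refl c g r ⟩
        (2 * c + 1) * (g * r)            ≤⟨ *-monoʳ-≤ (2 * c + 1) gr≤ ⟩
        (2 * c + 1) * ((4 * c + 3) * c * P) ≡⟨ sym (*-assoc (2 * c + 1) ((4 * c + 3) * c) P) ⟩
        N * P                            ∎

  -- Greedy matching of an independent set of points of large degree

  module Greedy (H : LinearTripleSystem) where
    open LinearTripleSystem H renaming (_≟_ to _≟ₓ_)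
    open Incidence H ℕ-orderedSemiring

    others : ∀ {e v} → v ∈ₑ e → List X
    others {e} (inj₁ _)        = v₁ e ∷ v₂ e ∷ []
    others {e} (inj₂ (inj₁ _)) = v₀ e ∷ v₂ e ∷ []
    others {e} (inj₂ (inj₂ _)) = v₀ e ∷ v₁ e ∷ []

    length-others : ∀ {e v} (i : v ∈ₑ e) → length (others i) ≡ 2
    length-others (inj₁ _)        = refl
    length-others (inj₂ (inj₁ _)) = refl
    length-others (inj₂ (inj₂ _)) = refl

    ∈-others : ∀ {e v x} (i : v ∈ₑ e) → x ∈ₑ e → x ≡ v ⊎ x ∈ others i
    ∈-others (inj₁ p)        (inj₁ q)        = inj₁ (trans (sym q) p)
    ∈-others (inj₁ p)        (inj₂ (inj₁ q)) = inj₂ (here (sym q))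
    ∈-others (inj₁ p)        (inj₂ (inj₂ q)) = inj₂ (there (here (sym q)))
    ∈-others (inj₂ (inj₁ p)) (inj₁ q)        = inj₂ (here (sym q))
    ∈-others (inj₂ (inj₁ p)) (inj₂ (inj₁ q)) = inj₁ (trans (sym q) p)
    ∈-others (inj₂ (inj₁ p)) (inj₂ (inj₂ q)) = inj₂ (there (here (sym q)))
    ∈-others (inj₂ (inj₂ p)) (inj₁ q)        = inj₂ (here (sym q))
    ∈-others (inj₂ (inj₂ p)) (inj₂ (inj₁ q)) = inj₂ (there (here (sym q)))
    ∈-others (inj₂ (inj₂ p)) (inj₂ (inj₂ q)) = inj₁ (trans (sym q) p)

    others-∈ : ∀ {e v x} (i : v ∈ₑ e) → x ∈ others i → x ∈ₑ e × x ≢ v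
    others-∈ {e} (inj₁ refl)        (here refl)         = inj₂ (inj₁ refl) , λ p → v₀≢v₁ e (sym p)
    others-∈ {e} (inj₁ refl)        (there (here refl)) = inj₂ (inj₂ refl) , λ p → v₀≢v₂ e (sym p)
    others-∈ {e} (inj₂ (inj₁ refl)) (here refl)         = inj₁ refl , v₀≢v₁ e
    others-∈ {e} (inj₂ (inj₁ refl)) (there (here refl)) = inj₂ (inj₂ refl) , λ p → v₁≢v₂ e (sym p)
    others-∈ {e} (inj₂ (inj₂ refl)) (here refl)         = inj₁ refl , v₀≢v₂ e
    others-∈ {e} (inj₂ (inj₂ refl)) (there (here refl)) = inj₂ (inj₁ refl) , v₁≢v₂ e

    elements : E → List X
    elements e = v₀ e ∷ v₁ e ∷ v₂ e ∷ []

    ∈-elements : ∀ {e x} → x ∈ₑ e → x ∈ elements e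
    ∈-elements (inj₁ p)        = here (sym p)
    ∈-elements (inj₂ (inj₁ p)) = there (here (sym p))
    ∈-elements (inj₂ (inj₂ p)) = there (there (here (sym p)))

    elements-∈ : ∀ {e x} → x ∈ elements e → x ∈ₑ e
    elements-∈ (here p)                 = inj₁ (sym p)
    elements-∈ (there (here p))         = inj₂ (inj₁ (sym p))
    elements-∈ (there (there (here p))) = inj₂ (inj₂ (sym p))

    -- A point of `U` shares at most one edge with `v`, so `U` blocks at most `length U` of the
    -- edges at `v`.
    pick : ∀ {es v} U → Unique es → v ∉ U → length U < deg es v → ∃ λ e → e ∈ es × v ∈ₑ e × (∀ {x} → x ∈ U → ¬ x ∈ₑ e)
    pick {es} {v} U u v∉U p with Any.any? (λ e → (v ∈ₑ? e) ×-dec All.all? (λ x → ¬? (x ∈ₑ? e)) U) es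
    ... | yes q = let (e , e∈ , v∈ , av) = find q in e , e∈ , v∈ , All.lookup av
    ... | no ¬q = contradiction p (≤⇒≯ (begin
      deg es v                                        ≤⟨ ∑-mono es blocked ⟩
      ∑ es (λ e → ∑ U (λ x → inc e v * inc e x))      ≡⟨ ∑-swap es U (λ e x → inc e v * inc e x) ⟩
      ∑ U (codeg es v)                                ≤⟨ ∑-≤-const U 1 (λ i → codeg≤1 u λ { refl → v∉U i }) ⟩
      length U * 1                                    ≡⟨ *-identityʳ _ ⟩
      length U                                        ∎))
      where
      open ≤-Reasoning
      blocked : ∀ {e} → e ∈ es → inc e v ≤ ∑ U (λ x → inc e v * inc e x)
      blocked {e} e∈ with inc-cases e v
      ... | inj₂ (_ , z) = ≤-trans (≤-reflexive z) z≤n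
      ... | inj₁ (v∈ , o) with Any.any? (λ x → x ∈ₑ? e) U
      ...   | yes h = let (x , x∈U , x∈e) = find h in
              ≤-trans (≤-reflexive (trans o (sym (trans (cong₂ _*_ o (inc-∈ x∈e)) refl))))
                (∑-member {f = λ x → inc e v * inc e x} x∈U (λ _ → z≤n))
      ...   | no ¬h = contradiction (Any.map (λ { refl → v∈ , All.¬Any⇒All¬ U ¬h }) e∈) ¬q

    -- U lists the elements outside I used by M; each new edge adds two of them.
    extend : ∀ {es I} d → Unique es → (∀ {v} → v ∈ I → d < deg es v) →
      (∀ {e x y} → e ∈ es → x ∈ₑ e → y ∈ₑ e → x ∈ I → y ∈ I → x ≡ y) →
      ∀ vs → Unique vs → (∀ {v} → v ∈ vs → v ∈ I) → ∀ M U → AllPairs Disjoint M →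
      (∀ {x} → x ∈ U → x ∉ I) → (∀ {f x} → f ∈ M → x ∈ₑ f → x ∈ U ⊎ (x ∈ I × x ∉ vs)) → length U + 2 * length vs ≤ 2 + d →
      ∃ λ M′ → (∀ {f} → f ∈ M′ → f ∈ es ⊎ f ∈ M) × AllPairs Disjoint M′ × length M′ ≡ length vs + length M
    extend d u big ind [] _ _ M U disj _ _ _ = M , inj₂ , disj , refl
    extend {es} {I} d u big ind (v ∷ vs) (v∉vs ∷ uvs) vs⊆I M U disj U∩I M⊆ room
      with pick {es} {v} U u (λ v∈U → U∩I v∈U (vs⊆I (here refl))) (≤-<-trans U≤d (big (vs⊆I (here refl))))
      where
      U≤d : length U ≤ d
      U≤d = +-cancelʳ-≤ 2 _ _ (≤-trans (+-monoʳ-≤ (length U) (*-monoʳ-≤ 2 (s≤s (z≤n {length vs})))) (≤-trans room (≤-reflexive (+-comm 2 d))))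
    ... | e , e∈ , v∈e , avoid
      with extend {es} {I} d u big ind vs uvs (λ i → vs⊆I (there i)) (e ∷ M) (others v∈e ++ U)
             (All.tabulate disjoint ∷ disj) U′∩I M′⊆ room′
      where
      v∈I = vs⊆I (here refl)

      disjoint : ∀ {f} → f ∈ M → Disjoint e f
      disjoint f∈ x x∈e x∈f with M⊆ f∈ x∈f
      ... | inj₁ x∈U         = avoid x∈U x∈e
      ... | inj₂ (x∈I , x∉vs) = x∉vs (here (ind e∈ x∈e v∈e x∈I v∈I))

      U′∩I : ∀ {x} → x ∈ others v∈e ++ U → x ∉ I
      U′∩I i x∈I with ∈-++⁻ (others v∈e) i
      ... | inj₂ x∈U = U∩I x∈U x∈I
      ... | inj₁ o   = let (x∈e , x≢v) = others-∈ v∈e o in x≢v (ind e∈ x∈e v∈e x∈I v∈I)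

      M′⊆ : ∀ {f x} → f ∈ e ∷ M → x ∈ₑ f → x ∈ others v∈e ++ U ⊎ (x ∈ I × x ∉ vs)
      M′⊆ (here refl) x∈f with ∈-others v∈e x∈f
      ... | inj₁ refl = inj₂ (v∈I , λ v∈vs → All.lookup v∉vs v∈vs refl)
      ... | inj₂ o    = inj₁ (∈-++⁺ˡ o)
      M′⊆ (there f∈) x∈f with M⊆ f∈ x∈f
      ... | inj₁ x∈U          = inj₁ (∈-++⁺ʳ (others v∈e) x∈U)
      ... | inj₂ (x∈I , x∉vs) = inj₂ (x∈I , λ x∈vs → x∉vs (there x∈vs))

      room′ : length (others v∈e ++ U) + 2 * length vs ≤ 2 + d
      room′ = ≤-trans (≤-reflexive (trans (cong (_+ 2 * length vs) (trans (length-++ (others v∈e)) (cong (_+ length U) (length-others v∈e))))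
        (+-*-Solver.solve 2 (λ a b → con 2 :+ a :+ con 2 :* b := a :+ con 2 :* (con 1 :+ b)) refl (length U) (length vs)))) room
        where open +-*-Solver
    ... | M′ , sub , disj′ , len = M′ , (λ i → back (sub i)) , disj′ , trans len (+-suc (length vs) (length M))
      where
      back : ∀ {f} → f ∈ es ⊎ f ∈ e ∷ M → f ∈ es ⊎ f ∈ M
      back (inj₁ i)           = inj₁ i
      back (inj₂ (here refl)) = inj₁ e∈
      back (inj₂ (there i))   = inj₂ i

  length-filter-+-∑ : ∀ {A : Set} {P : Pred A 0ℓ} (P? : Decidable P) (xs : List A) {f} →
    (∀ x → ¬ P x → 1 ≤ f x) → length xs ≤ length (filter P? xs) + ∑ xs f
  length-filter-+-∑ P? [] p = z≤n
  length-filter-+-∑ P? (x ∷ xs) {f} p with P? x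
  ... | yes _ = s≤s (≤-trans (length-filter-+-∑ P? xs p) (+-monoʳ-≤ (length (filter P? xs)) (m≤n+m _ (f x))))
  ... | no  n = ≤-trans (+-mono-≤ (p x n) (length-filter-+-∑ P? xs p))
    (≤-reflexive (+-*-Solver.solve 3 (λ a b c → b :+ (a :+ c) := a :+ (b :+ c)) refl (length (filter P? xs)) (f x) (∑ xs f)))
    where open +-*-Solver

  ∑-filter-≤ : ∀ {A : Set} {P : Pred A 0ℓ} (P? : Decidable P) (xs : List A) f → ∑ (filter P? xs) f ≤ ∑ xs f
  ∑-filter-≤ P? [] f = z≤n
  ∑-filter-≤ P? (x ∷ xs) f with P? x
  ... | yes _ = +-monoʳ-≤ (f x) (∑-filter-≤ P? xs f)
  ... | no _  = ≤-trans (∑-filter-≤ P? xs f) (m≤n+m _ (f x))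

  ∈-take : ∀ {A : Set} {x} n (xs : List A) → x ∈ take n xs → x ∈ xs
  ∈-take (suc n) (y ∷ xs) (here p)  = here p
  ∈-take (suc n) (y ∷ xs) (there i) = there (∈-take n xs i)

  -- Induction for a matching of exact size

  module Matchings (c : ℕ) where
    open Arithmetic

    threshold : ℕ
    threshold = proj₁ (nibble-matching (density c))

    module _ (H : LinearTripleSystem) (q g Δ : ℕ) (1≤g : 1 ≤ g) (g≤q : g ≤ q) (q≤cg : q ≤ c * g) (g≤Δ : g ≤ Δ) (large : threshold ≤ 2 * q + g) where
      open LinearTripleSystem H renaming (_≟_ to _≟ₓ_)
      open Incidence H ℕ-orderedSemiring
      open Truncation H (2 * q + g)
      open Greedy H

      d : ℕ
      d = 2 * q + g

      HasMatching : ℕ → List E → Set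
      HasMatching r es = ∃ λ M → (∀ {f} → f ∈ M → f ∈ es) × AllPairs Disjoint M × length M ≡ r

      has-take : ∀ {r es M} → All (_∈ es) M → AllPairs Disjoint M → r ≤ length M → HasMatching r es
      has-take {r} {es} {M} sub disj p = take r M , (λ i → All.lookup sub (∈-take r M i)) , AllPairs.take⁺ r disj ,
        trans (length-take r M) (m≤n⇒m⊓n≡m p)

      module _ {es es* : List E} (t : Thinning es es*) (deg≤ : ∀ x → deg es x ≤ d + Δ) where
        private
          module T = Thinning t
          I = heavy T.uniq T.indep
          i = length I

          heavy? : Decidable (λ x → d < deg es* x)
          heavy? x = d <? deg es* x

          light? : Decidable (λ x → d < deg es x × ¬ d < deg es* x)
          light? x = (d <? deg es x) ×-dec ¬? (d <? deg es* x)

          L = filter light? points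

          excess-≤ : excess es ≤ (i + length L) * Δ
          excess-≤ = ∑-≤-filters heavy? light? points Δ
            (λ x → ≤-trans (∸-monoˡ-≤ d (deg≤ x)) (≤-reflexive (m+n∸m≡n d Δ)))
            (λ x n m → m≤n⇒m∸n≡0 (≮⇒≥ λ p → m (p , n)))

        -- The last hypothesis makes `r - i` a constant fraction of `r`; the surplus is then a
        -- constant fraction of `d r`, which is the slack the nibble asks for.
        dense : ∀ {r} → (d + Δ) * r ≤ length es → r ≤ q → i ≤ r → (∀ e → i + e ≡ r → g * r ≤ q * e) → HasMatching r es
        dense {r} many r≤q i≤r far with m≤n⇒∃[o]m+o≡n i≤r | m≤n⇒∃[o]m+o≡n r≤q | truncate es* T.uniq
        ... | e , i+e≡r | s , r+s≡q | es′ , sub′ , uniq′ , deg′ , len′ =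
          let (M , M⊆ , disj , r≤) = proj₂ (nibble-matching (density c)) H d r es′ large uniq′ deg′ enough
          in has-take (All.map (λ j → T.sub (sub′ j)) M⊆) disj r≤
          where
          open ≤-Reasoning
          open +-*-Solver using (solve; _:+_; _:*_; _:=_; con)
          m λ′ X* : ℕ
          m  = length es′
          λ′ = length L
          X* = excess es*

          -- A point above `d` in `es` lies in I or in `L`, so thinning is charged `(i + λ′) * Δ`.
          -- Truncation costs `X*` edges, counted twice; one copy cancels and the other is at most
          -- `i * Δ`.
          above : 2 * ((d + Δ) * r) ≤ 2 * m + Δ * (2 * i + λ′)
          above = ≤-trans (*-monoʳ-≤ 2 many) (+-cancelʳ-≤ X* _ _ (begin
            2 * length es + X*                          ≡⟨ solve 2 (λ a b → con 2 :* a :+ b := a :+ a :+ b) refl (length es) X* ⟩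
            length es + length es + X*                  ≤⟨ T.tradeoff ⟩
            length es* + length es* + excess es         ≤⟨ +-mono-≤ (+-mono-≤ len′ len′) excess-≤ ⟩
            m + X* + (m + X*) + (i + λ′) * Δ            ≡⟨ solve 5 (λ m X i l Δ → m :+ X :+ (m :+ X) :+ (i :+ l) :* Δ := X :+ (con 2 :* m :+ (i :+ l) :* Δ :+ X)) refl m X* i λ′ Δ ⟩
            X* + (2 * m + (i + λ′) * Δ + X*)            ≤⟨ +-monoˡ-≤ _ (excess-heavy-≤ T.uniq T.indep Δ λ x → ≤-trans (T.deg≤ x) (deg≤ x)) ⟩
            i * Δ + (2 * m + (i + λ′) * Δ + X*)         ≡⟨ solve 5 (λ m X i l Δ → i :* Δ :+ (con 2 :* m :+ (i :+ l) :* Δ :+ X) := con 2 :* m :+ Δ :* (con 2 :* i :+ l) :+ X) refl m X* i λ′ Δ ⟩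
            2 * m + Δ * (2 * i + λ′) + X*               ∎))

          -- The excess on the left of `touching` pays exactly for the edges lost in truncation.
          touch : ∀ l → l ≤ λ′ → 2 * ((i + l) * d) ≤ 2 * m + l * (2 * i + l)
          touch l l≤ = +-cancelʳ-≤ (2 * X*) _ _ (begin
            2 * ((i + l) * d) + 2 * X*                  ≡⟨ sym (*-distribˡ-+ 2 ((i + l) * d) X*) ⟩
            2 * ((i + l) * d + X*)                      ≤⟨ subst (λ k → 2 * ((i + k) * d + X*) ≤ 2 * length es* + k * (2 * i + k)) len-l
                                                             (touching T.uniq T.indep (take l L) (Unique.take⁺ l (Unique.filter⁺ light? unique))
                                                               (λ j k → proj₂ (in-L j) (heavy-∈ T.uniq T.indep k)) (λ j → T.high _ (<⇒≤ (proj₁ (in-L j))))) ⟩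
            2 * length es* + l * (2 * i + l)            ≤⟨ +-monoˡ-≤ _ (*-monoʳ-≤ 2 len′) ⟩
            2 * (m + X*) + l * (2 * i + l)              ≡⟨ solve 3 (λ m X k → con 2 :* (m :+ X) :+ k := con 2 :* m :+ k :+ con 2 :* X) refl m X* (l * (2 * i + l)) ⟩
            2 * m + l * (2 * i + l) + 2 * X*            ∎)
            where
            len-l : length (take l L) ≡ l
            len-l = trans (length-take l L) (m≤n⇒m⊓n≡m l≤)
            in-L : ∀ {x} → x ∈ take l L → d < deg es x × ¬ d < deg es* x
            in-L j = proj₂ (∈-filter⁻ light? {xs = points} (∈-take l L j))

          surplus′ : (2 * d + Δ) * (d * r) + g * (e * Δ) ≤ (2 * d + Δ) * m
          surplus′ = transport i+e≡r r+s≡q above touch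
            where
            transport : ∀ {r q} → i + e ≡ r → r + s ≡ q → let d = 2 * q + g in
              2 * ((d + Δ) * r) ≤ 2 * m + Δ * (2 * i + λ′) → (∀ l → l ≤ λ′ → 2 * ((i + l) * d) ≤ 2 * m + l * (2 * i + l)) →
              (2 * d + Δ) * (d * r) + g * (e * Δ) ≤ (2 * d + Δ) * m
            transport refl refl = surplus i e s g Δ λ′ m

          enough : suc (density c) * (d * r) ≤ density c * m
          enough = surplus⇒density c q g Δ e r m 1≤g g≤Δ q≤cg (far e i+e≡r) surplus′

        module _ {I′ : List X} {r r′ : ℕ} (uI′ : Unique I′) (I′⊆I : ∀ {x} → x ∈ I′ → x ∈ I) (split : length I′ + r′ ≡ r)
                 (room : 3 * r ≤ 2 + d + length I′) where

          avoids? : Decidable (λ e → All (λ x → ¬ x ∈ₑ e) I′)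
          avoids? e = All.all? (λ x → ¬? (x ∈ₑ? e)) I′

          rest : List E
          rest = filter avoids? es

          -- Each point of `I′` takes at most `d + Δ` edges with it and lowers the size to be
          -- reached by one, so the density hypothesis is inherited.
          rest-many : (d + Δ) * r ≤ length es → (d + Δ) * r′ ≤ length rest
          rest-many many = +-cancelʳ-≤ (length I′ * (d + Δ)) _ _ (begin
            (d + Δ) * r′ + length I′ * (d + Δ)                   ≡⟨ +-*-Solver.solve 3 (λ D r i → D :* r :+ i :* D := D :* (i :+ r)) refl (d + Δ) r′ (length I′) ⟩
            (d + Δ) * (length I′ + r′)                           ≡⟨ cong ((d + Δ) *_) split ⟩
            (d + Δ) * r                                          ≤⟨ many ⟩
            length es                                            ≤⟨ length-filter-+-∑ avoids? es hit ⟩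
            length rest + ∑ es (λ e → ∑ I′ (inc e))              ≡⟨ cong (length rest +_) (∑-swap es I′ inc) ⟩
            length rest + ∑ I′ (deg es)                          ≤⟨ +-monoʳ-≤ (length rest) (∑-≤-const I′ (d + Δ) λ {x} _ → deg≤ x) ⟩
            length rest + length I′ * (d + Δ)                    ∎)
            where
            open ≤-Reasoning
            open +-*-Solver using (_:+_; _:*_; _:=_)
            hit : ∀ e → ¬ All (λ x → ¬ x ∈ₑ e) I′ → 1 ≤ ∑ I′ (inc e)
            hit e n with find (All.¬All⇒Any¬ (λ x → ¬? (x ∈ₑ? e)) I′ n)
            ... | x , x∈I′ , ¬¬x∈e = ≤-trans (≤-reflexive (sym (inc-∈ (decidable-stable (x ∈ₑ? e) ¬¬x∈e))))
                  (∑-member {f = inc e} x∈I′ (λ _ → z≤n))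

          augment : HasMatching r′ rest → HasMatching r es
          augment (M , M⊆ , disj , len) = result (extend d T.uniq (λ j → heavy-∈ T.uniq T.indep (I′⊆I j))
              (λ e∈ x∈ y∈ j k → T.indep e∈ x∈ y∈ (heavy-∈ T.uniq T.indep (I′⊆I j)) (heavy-∈ T.uniq T.indep (I′⊆I k)))
              I′ uI′ (λ j → j) M (used M) disj used-∉ (λ f∈ x∈ → inj₁ (∈-used f∈ x∈)) room′)
            where
            used : List E → List X
            used []       = []
            used (f ∷ fs) = elements f ++ used fs

            length-used : ∀ fs → length (used fs) ≡ 3 * length fs
            length-used []       = refl
            length-used (f ∷ fs) = trans (cong (3 +_) (length-used fs)) (sym (*-suc 3 (length fs)))

            ∈-used : ∀ {fs f x} → f ∈ fs → x ∈ₑ f → x ∈ used fs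
            ∈-used {f ∷ _} (here refl) x∈ = ∈-++⁺ˡ (∈-elements x∈)
            ∈-used {f ∷ _} (there j)   x∈ = ∈-++⁺ʳ (elements f) (∈-used j x∈)

            used-∈ : ∀ {fs x} → x ∈ used fs → ∃ λ f → f ∈ fs × x ∈ₑ f
            used-∈ {f ∷ fs} j with ∈-++⁻ (elements f) j
            ... | inj₁ k = f , here refl , elements-∈ k
            ... | inj₂ k = let (f′ , f′∈ , x∈) = used-∈ k in f′ , there f′∈ , x∈

            used-∉ : ∀ {x} → x ∈ used M → x ∉ I′
            used-∉ j x∈I′ = let (f , f∈ , x∈f) = used-∈ j in
              All.lookup (proj₂ (∈-filter⁻ avoids? {xs = es} (M⊆ f∈))) x∈I′ x∈f

            -- Three points for each edge of `M` and two for each greedy edge: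
            -- `3 r′ + 2 |I′| = 3 r - |I′|`. The summand 2 is there because the last edge must avoid
            -- only the points used before it.
            room′ : length (used M) + 2 * length I′ ≤ 2 + d
            room′ = +-cancelʳ-≤ (length I′) _ _ (≤-trans (≤-reflexive (trans
              (cong (λ k → k + 2 * length I′ + length I′) (trans (length-used M) (cong (3 *_) len)))
              (trans (+-*-Solver.solve 2 (λ a b → con 3 :* a :+ con 2 :* b :+ b := con 3 :* (b :+ a)) refl r′ (length I′)) (cong (3 *_) split)))) room)
              where open +-*-Solver using (_:+_; _:*_; _:=_; con)

            result : (∃ λ M′ → (∀ {f} → f ∈ M′ → f ∈ es* ⊎ f ∈ M) × AllPairs Disjoint M′ × length M′ ≡ length I′ + length M) → HasMatching r es
            result (M′ , sub , disj′ , len′) = M′ , (λ j → [ T.sub , (λ f∈ → proj₁ (∈-filter⁻ avoids? (M⊆ f∈))) ]′ (sub j)) , disj′ ,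
              trans len′ (trans (cong (length I′ +_) len) split)

      matching : ∀ r es → r ≤ q → Unique es → (∀ x → deg es x ≤ d + Δ) → (∀ e → deg es (v₂ e) ≤ q) →
                 (d + Δ) * r ≤ length es → HasMatching r es
      matching r es = go r r es ≤-refl
        where
        -- The bound `n` makes the strong induction on `r` structural; `r` falls by the size of
        -- `I′`, which is at least one.
        go : ∀ n r es → r ≤ n → r ≤ q → Unique es → (∀ x → deg es x ≤ d + Δ) → (∀ e → deg es (v₂ e) ≤ q) →
             (d + Δ) * r ≤ length es → HasMatching r es
        go n zero es _ _ _ _ _ _ = [] , (λ ()) , [] , refl
        go (suc n) r@(suc r-1) es r≤n r≤q u deg≤ col≤ many
          with thin es u (λ e → ≤-<-trans (col≤ e) (≤-trans (s≤s (m≤m+n q (q + 0))) (≤-trans (≤-reflexive (+-comm 1 (2 * q))) (+-monoʳ-≤ (2 * q) 1≤g))))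
        ... | es* , t = choose (r ≤? i) (1 ≤? i) (3 * r ≤? 2 + d + i)
          where
          module T = Thinning t
          I = heavy T.uniq T.indep
          i = length I

          uI : Unique I
          uI = Unique.filter⁺ (λ x → d <? deg es* x) unique

          recurse : ∀ {I′ r′} (uI′ : Unique I′) (I′⊆I : ∀ {x} → x ∈ I′ → x ∈ I) (split : length I′ + r′ ≡ r) →
            1 ≤ length I′ → 3 * r ≤ 2 + d + length I′ → HasMatching r es
          recurse {I′} {r′} uI′ I′⊆I split 1≤ room = augment t deg≤ uI′ I′⊆I split room
            (go n r′ (rest t deg≤ uI′ I′⊆I split room) (s≤s⁻¹ (≤-trans r′<r r≤n)) (≤-trans (<⇒≤ r′<r) r≤q)
              (Unique.filter⁺ (avoids? t deg≤ uI′ I′⊆I split room) u)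
              (λ x → ≤-trans (∑-filter-≤ (avoids? t deg≤ uI′ I′⊆I split room) es (λ e → inc e x)) (deg≤ x))
              (λ e → ≤-trans (∑-filter-≤ (avoids? t deg≤ uI′ I′⊆I split room) es (λ f → inc f (v₂ e))) (col≤ e))
              (rest-many t deg≤ uI′ I′⊆I split room many))
            where
            r′<r : r′ < r
            r′<r = ≤-trans (+-monoˡ-≤ r′ 1≤) (≤-reflexive split)

          choose : Dec (r ≤ i) → Dec (1 ≤ i) → Dec (3 * r ≤ 2 + d + i) → HasMatching r es
          -- Here `r` heavy points are matched greedily from the empty matching; there is room since
          -- `2 r ≤ 2 q ≤ d`.
          choose (yes r≤i) _ _ = recurse {take r I} {0} (Unique.take⁺ r uI) (∈-take r I) (trans (+-identityʳ _) len)
              (≤-trans (s≤s z≤n) (≤-reflexive (sym len))) (≤-trans 3r≤ (≤-reflexive (cong (2 + d +_) (sym len))))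
            where
            len : length (take r I) ≡ r
            len = trans (length-take r I) (m≤n⇒m⊓n≡m r≤i)
            3r≤ : 3 * r ≤ 2 + d + r
            3r≤ = ≤-trans (≤-reflexive (+-comm r (2 * r))) (+-monoˡ-≤ r (≤-trans (*-monoʳ-≤ 2 r≤q) (≤-trans (m≤m+n (2 * q) g) (m≤n+m d 2))))
          choose (no r≰i) (yes 1≤i) (yes room) = let (r′ , split) = m≤n⇒∃[o]m+o≡n (<⇒≤ (≰⇒> r≰i)) in
            recurse {I} {r′} uI (λ j → j) split 1≤i room
          -- With no heavy points `e` equals `r`, and the ratio required is `g ≤ q`.
          choose (no r≰i) (no i≡0) _ = dense t deg≤ many r≤q (<⇒≤ (≰⇒> r≰i)) (λ e p →
            ≤-trans (*-monoˡ-≤ r g≤q) (≤-reflexive (cong (q *_) (trans (sym p) (cong (_+ e) (n<1⇒n≡0 (≰⇒> i≡0)))))))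
          choose (no r≰i) (yes _) (no tight) = dense t deg≤ many r≤q (<⇒≤ (≰⇒> r≰i)) (λ e p →
            ≤-trans (*-mono-≤ (g≤e e p) r≤q) (≤-reflexive (*-comm e q)))
            where
            -- Failure of the greedy condition means `2 + d + i < 3 r = 2 r + i + e`, where
            -- `d ≥ 2 r + g`.
            g≤e : ∀ e → i + e ≡ r → g ≤ e
            g≤e e p = +-cancelˡ-≤ (2 * r + i) _ _ (begin
              2 * r + i + g        ≡⟨ solve 3 (λ r i g → con 2 :* r :+ i :+ g := con 2 :* r :+ g :+ i) refl r i g ⟩
              2 * r + g + i        ≤⟨ +-monoˡ-≤ i (+-monoˡ-≤ g (*-monoʳ-≤ 2 r≤q)) ⟩
              d + i                ≤⟨ m≤n+m (d + i) 2 ⟩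
              2 + d + i            ≤⟨ <⇒≤ (≰⇒> tight) ⟩
              3 * r                ≡⟨ trans (+-comm r (2 * r)) (cong (2 * r +_) (sym p)) ⟩
              2 * r + (i + e)      ≡⟨ sym (+-assoc (2 * r) i e) ⟩
              2 * r + i + e        ∎)
              where
              open ≤-Reasoning
              open +-*-Solver using (solve; _:+_; _:*_; _:=_; con)

-- Coloured graphs

open import Defs
open import Data.Nat using (_≤_)
open import Data.Fin as Fin using (Fin; toℕ)
import Data.Fin.Properties as Fin
open import Data.Rational using (mkℚ; Positive; _+_; _*_; toℚᵘ) renaming (_≤_ to _≤ℚ_)
open MatchingTheory

module ColouredTriples {n m k : ℕ} (G : ColouredGraph n m k) (proper : ColouredGraph.Proper G) where
  open ColouredGraph G

  Point : Set
  Point = Fin n ⊎ Fin k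

  private
    u v : Fin m → Fin n
    u e = proj₁ (ends e)
    v e = proj₂ (ends e)

  _contains_ : Fin m → Point → Set
  e contains x = inj₁ (u e) ≡ x ⊎ inj₁ (v e) ≡ x ⊎ inj₂ (colour e) ≡ x

  contains-vertex : ∀ {e a} → e contains inj₁ a → e ∋ᵥ a
  contains-vertex (inj₁ refl)        = inj₁ refl
  contains-vertex (inj₂ (inj₁ refl)) = inj₂ refl

  contains-colour : ∀ {e c} → e contains inj₂ c → colour e ≡ c
  contains-colour (inj₂ (inj₂ refl)) = refl

  vertex-contained : ∀ {e a} → e ∋ᵥ a → e contains inj₁ a
  vertex-contained (inj₁ refl) = inj₁ refl
  vertex-contained (inj₂ refl) = inj₂ (inj₁ refl)

  -- Two distinct shared vertices are both ends of both edges; `ordered` rules out opposite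
  -- orientations, and `simple` concludes.
  ends-determined : ∀ {e f a b} → a ≢ b → e ∋ᵥ a → e ∋ᵥ b → f ∋ᵥ a → f ∋ᵥ b → e ≡ f
  ends-determined {e} {f} {a} {b} a≢b = λ p q r s → simple (×-≡,≡→≡ (same p q r s))
    where
    same : e ∋ᵥ a → e ∋ᵥ b → f ∋ᵥ a → f ∋ᵥ b → u e ≡ u f × v e ≡ v f
    same (inj₁ p) (inj₁ q) _ _ = contradiction (trans (sym p) q) a≢b
    same (inj₂ p) (inj₂ q) _ _ = contradiction (trans (sym p) q) a≢b
    same _ _ (inj₁ p) (inj₁ q) = contradiction (trans (sym p) q) a≢b
    same _ _ (inj₂ p) (inj₂ q) = contradiction (trans (sym p) q) a≢b
    same (inj₁ p) (inj₂ q) (inj₁ r) (inj₂ s) = trans p (sym r) , trans q (sym s)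
    same (inj₂ p) (inj₁ q) (inj₂ r) (inj₁ s) = trans q (sym s) , trans p (sym r)
    same (inj₁ refl) (inj₂ refl) (inj₂ r) (inj₁ s) = contradiction
      (subst₂ (λ x y → toℕ x ℕ.< toℕ y) s r (ordered f)) (ℕ.<⇒≯ (ordered e))
    same (inj₂ refl) (inj₁ refl) (inj₁ r) (inj₂ s) = contradiction
      (subst₂ (λ x y → toℕ x ℕ.< toℕ y) r s (ordered f)) (ℕ.<⇒≯ (ordered e))

  colour-determined : ∀ {e f a} → e ∋ᵥ a → f ∋ᵥ a → colour e ≡ colour f → e ≡ f
  colour-determined {e} {f} {a} p q same with e Fin.≟ f
  ... | yes e≡f = e≡f
  ... | no  e≢f = contradiction same (proper e f e≢f (a , p , q))

  -- Two vertices call for simplicity of the graph, a vertex and a colour for properness; two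
  -- colours never lie on one edge.
  linear : ∀ {e f x y} → x ≢ y → e contains x → e contains y → f contains x → f contains y → e ≡ f
  linear {x = inj₁ a} {inj₁ b} x≢y p q r s =
    ends-determined (λ a≡b → x≢y (cong inj₁ a≡b)) (contains-vertex p) (contains-vertex q) (contains-vertex r) (contains-vertex s)
  linear {x = inj₁ a} {inj₂ c} _ p q r s =
    colour-determined (contains-vertex p) (contains-vertex r) (trans (contains-colour q) (sym (contains-colour s)))
  linear {x = inj₂ c} {inj₁ a} _ p q r s =
    colour-determined (contains-vertex q) (contains-vertex s) (trans (contains-colour p) (sym (contains-colour r)))
  linear {x = inj₂ c} {inj₂ d} x≢y p q _ _ =
    contradiction (cong inj₂ (trans (sym (contains-colour p)) (contains-colour q))) x≢y

  points : List Point
  points = map inj₁ (allFin n) ++ map inj₂ (allFin k)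

  complete : ∀ x → x ∈ points
  complete (inj₁ a) = ∈-++⁺ˡ (∈-map⁺ inj₁ (∈-allFin a))
  complete (inj₂ c) = ∈-++⁺ʳ (map inj₁ (allFin n)) (∈-map⁺ inj₂ (∈-allFin c))

  unique : Unique points
  unique = Unique.++⁺ (Unique.map⁺ inj₁-injective (Unique.allFin⁺ n)) (Unique.map⁺ inj₂-injective (Unique.allFin⁺ k)) apart
    where
    apart : ∀ {x} → ¬ (x ∈ map inj₁ (allFin n) × x ∈ map inj₂ (allFin k))
    apart (i , j) with ∈-map⁻ inj₁ i | ∈-map⁻ inj₂ j
    ... | _ , _ , refl | _ , _ , ()

  triples : LinearTripleSystem
  triples = record
    { X = Point ; _≟_ = ≡-dec Fin._≟_ Fin._≟_ ; points = points ; complete = complete ; unique = unique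
    ; E = Fin m ; v₀ = λ e → inj₁ (u e) ; v₁ = λ e → inj₁ (v e) ; v₂ = λ e → inj₂ (colour e)
    ; v₀≢v₁ = λ e p → ℕ.<⇒≢ (ordered e) (cong toℕ (inj₁-injective p))
    ; v₀≢v₂ = λ _ ()
    ; v₁≢v₂ = λ _ ()
    ; linear = linear
    }

  open LinearTripleSystem triples using (Disjoint)
  open Incidence triples ℕ-orderedSemiring
  open Sum ℕ-orderedSemiring

  inc≤1 : ∀ e x → inc e x ℕ.≤ 1
  inc≤1 e x with inc-cases e x
  ... | inj₁ (_ , p) = ℕ.≤-reflexive p
  ... | inj₂ (_ , p) = ℕ.≤-trans (ℕ.≤-reflexive p) z≤n

  -- Each edge at `a` is charged to its colour, and `a` has codegree at most one with every colour.
  deg-vertex : ∀ a → deg (allFin m) (inj₁ a) ℕ.≤ k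
  deg-vertex a = begin
    deg (allFin m) (inj₁ a)                                              ≤⟨ ∑-mono (allFin m) (λ {e} _ → spread e) ⟩
    ∑ (allFin m) (λ e → ∑ (allFin k) (λ c → inc e (inj₁ a) ℕ.* inc e (inj₂ c))) ≡⟨ ∑-swap (allFin m) (allFin k) (λ e c → inc e (inj₁ a) ℕ.* inc e (inj₂ c)) ⟩
    ∑ (allFin k) (λ c → codeg (allFin m) (inj₁ a) (inj₂ c))              ≤⟨ ∑-≤-const (allFin k) 1 (λ {c} _ → codeg≤1 {allFin m} {inj₁ a} {inj₂ c} (Unique.allFin⁺ m) λ ()) ⟩
    length (allFin k) ℕ.* 1                                              ≡⟨ trans (ℕ.*-identityʳ _) (length-tabulate {n = k} (λ i → i)) ⟩
    k                                                                    ∎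
    where
    open ℕ.≤-Reasoning
    spread : ∀ e → inc e (inj₁ a) ℕ.≤ ∑ (allFin k) (λ c → inc e (inj₁ a) ℕ.* inc e (inj₂ c))
    spread e = ℕ.≤-trans
      (ℕ.≤-reflexive (sym (trans (cong (inc e (inj₁ a) ℕ.*_) (inc-∈ (inj₂ (inj₂ refl)))) (ℕ.*-identityʳ _))))
      (∑-member {f = λ c → inc e (inj₁ a) ℕ.* inc e (inj₂ c)} (∈-allFin (colour e)) (λ _ → z≤n))

  deg-colour : ∀ c → deg (allFin m) (inj₂ c) ℕ.≤ colourCount c
  deg-colour c = begin
    ∑ (allFin m) (λ e → inc e (inj₂ c))           ≡⟨ ∑-filter (λ e → colour e Fin.≟ c) (allFin m) (λ e n → inc-∉ λ p → n (contains-colour p)) ⟩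
    ∑ (filter (λ e → colour e Fin.≟ c) (allFin m)) (λ e → inc e (inj₂ c)) ≤⟨ ∑-≤-const (filter (λ e → colour e Fin.≟ c) (allFin m)) 1 (λ {e} _ → inc≤1 e (inj₂ c)) ⟩
    colourCount c ℕ.* 1                           ≡⟨ ℕ.*-identityʳ _ ⟩
    colourCount c                                 ∎
    where open ℕ.≤-Reasoning

  rainbow-lookup : ∀ {M : List (Fin m)} → AllPairs Disjoint M → ∀ i j → i ≢ j → Disjoint (lookup M i) (lookup M j)
  rainbow-lookup (p ∷ ps) Fin.zero Fin.zero i≢j = contradiction refl i≢j
  rainbow-lookup (p ∷ ps) Fin.zero (Fin.suc j) _ = All.lookup p (∈-lookup j)
  rainbow-lookup (p ∷ ps) (Fin.suc i) Fin.zero _ = λ x x∈ y∈ → All.lookup p (∈-lookup i) x y∈ x∈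
  rainbow-lookup (p ∷ ps) (Fin.suc i) (Fin.suc j) i≢j = rainbow-lookup ps i j (λ q → i≢j (cong Fin.suc q))

  toRainbow : ∀ {r} (M : List (Fin m)) → AllPairs Disjoint M → length M ≡ r → RainbowMatching r
  toRainbow M disj refl = record
    { edge = lookup M
    ; disjoint = λ i j i≢j a p q → rainbow-lookup disj i j i≢j (inj₁ a) (vertex-contained p) (vertex-contained q)
    ; rainbow = λ {i} {j} same → injective i j same
    }
    where
    injective : ∀ i j → colour (lookup M i) ≡ colour (lookup M j) → i ≡ j
    injective i j same with i Fin.≟ j
    ... | yes p = p
    ... | no  p = contradiction (inj₂ (inj₂ (cong inj₂ (sym same)))) (λ h → rainbow-lookup disj i j p (inj₂ (colour (lookup M i))) (inj₂ (inj₂ refl)) h)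

-- Clearing denominators and rounding

module Scaling (p b-1 : ℕ) where
  b : ℕ
  b = suc b-1

  toℚᵘ-ℕ : ∀ n → toℚᵘ (ℕ→ℚ n) ℚᵘ.≃ mkℚᵘ (ℤ.+ n) 0
  toℚᵘ-ℕ n = ℚ.toℚᵘ-fromℚᵘ (mkℚᵘ (ℤ.+ n) 0)

  module _ (ε : ℚ) (ε≡ : toℚᵘ ε ≡ mkℚᵘ (ℤ.+ p) b-1) where

    factor : ∀ n → toℚᵘ ((ℕ→ℚ 2 + ε) * ℕ→ℚ n) ℚᵘ.≃ (mkℚᵘ (ℤ.+ 2) 0 ℚᵘ.+ mkℚᵘ (ℤ.+ p) b-1) ℚᵘ.* mkℚᵘ (ℤ.+ n) 0
    factor n = ℚᵘ.≃-trans (ℚ.toℚᵘ-homo-* (ℕ→ℚ 2 + ε) (ℕ→ℚ n))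
      (ℚᵘ.*-cong (ℚᵘ.≃-trans (ℚ.toℚᵘ-homo-+ (ℕ→ℚ 2) ε) (ℚᵘ.+-cong (toℚᵘ-ℕ 2) (ℚᵘ.≃-reflexive ε≡))) (toℚᵘ-ℕ n))

    private
      numerator : ∀ n → (ℤ.+ 2 ℤ.* ℤ.+ b ℤ.+ ℤ.+ p ℤ.* ℤ.+ 1) ℤ.* ℤ.+ n ≡ ℤ.+ ((2 ℕ.* b ℕ.+ p) ℕ.* n)
      numerator n = trans (cong (ℤ._* ℤ.+ n) (trans (cong₂ ℤ._+_ (sym (ℤ.pos-* 2 b)) (ℤ.*-identityʳ (ℤ.+ p))) (sym (ℤ.pos-+ (2 ℕ.* b) p))))
        (sym (ℤ.pos-* (2 ℕ.* b ℕ.+ p) n))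

      denominator : ∀ n → ℤ.+ n ℤ.* ℤ.+ (1 ℕ.* b ℕ.* 1) ≡ ℤ.+ (n ℕ.* b)
      denominator n = trans (cong (λ t → ℤ.+ n ℤ.* ℤ.+ t) (trans (ℕ.*-identityʳ (1 ℕ.* b)) (ℕ.*-identityˡ b))) (sym (ℤ.pos-* n b))

    clear-upper : ∀ k q → ℕ→ℚ k ≤ℚ (ℕ→ℚ 2 + ε) * ℕ→ℚ q → k ℕ.* b ℕ.≤ (2 ℕ.* b ℕ.+ p) ℕ.* q
    clear-upper k q h = ℤ.drop‿+≤+ (ℤ.≤-trans (ℤ.≤-reflexive (sym (denominator k)))
      (ℤ.≤-trans (ℚᵘ.drop-*≤* (ℚᵘ.≤-respˡ-≃ (toℚᵘ-ℕ k) (ℚᵘ.≤-respʳ-≃ (factor q) (ℚ.toℚᵘ-mono-≤ h))))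
        (ℤ.≤-reflexive (trans (ℤ.*-identityʳ _) (numerator q)))))

    clear-lower : ∀ m q r → (ℕ→ℚ 2 + ε) * ℕ→ℚ q * ℕ→ℚ r ≤ℚ ℕ→ℚ m → (2 ℕ.* b ℕ.+ p) ℕ.* q ℕ.* r ℕ.≤ m ℕ.* b
    clear-lower m q r h = ℤ.drop‿+≤+ (ℤ.≤-trans
      (ℤ.≤-reflexive (sym (trans (ℤ.*-identityʳ _) (trans (cong (ℤ._* ℤ.+ r) (numerator q)) (sym (ℤ.pos-* ((2 ℕ.* b ℕ.+ p) ℕ.* q) r))))))
      (ℤ.≤-trans (ℚᵘ.drop-*≤* (ℚᵘ.≤-respˡ-≃ product (ℚᵘ.≤-respʳ-≃ (toℚᵘ-ℕ m) (ℚ.toℚᵘ-mono-≤ h))))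
        (ℤ.≤-reflexive (trans (cong (λ t → ℤ.+ m ℤ.* ℤ.+ t) (ℕ.*-identityʳ (1 ℕ.* b ℕ.* 1))) (denominator m)))))
      where
      product : toℚᵘ ((ℕ→ℚ 2 + ε) * ℕ→ℚ q * ℕ→ℚ r) ℚᵘ.≃ (mkℚᵘ (ℤ.+ 2) 0 ℚᵘ.+ mkℚᵘ (ℤ.+ p) b-1) ℚᵘ.* mkℚᵘ (ℤ.+ q) 0 ℚᵘ.* mkℚᵘ (ℤ.+ r) 0
      product = ℚᵘ.≃-trans (ℚ.toℚᵘ-homo-* ((ℕ→ℚ 2 + ε) * ℕ→ℚ q) (ℕ→ℚ r)) (ℚᵘ.*-cong (factor q) (toℚᵘ-ℕ r))

module Parameters (p′ b-1 : ℕ) (q : ℕ) (2b≤q : 2 ℕ.* suc b-1 ℕ.≤ q) where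
  open +-*-Solver
  open ℕ.≤-Reasoning

  -- `g` is built from `1 / b`, a lower bound of `ε = p / b`, so that `g ≤ q` holds for large `ε`
  -- too. `h` is `ε q` rounded down, and `2 q + g + Δ` is the integer part of `(2 + ε) q`.
  b p 2b g h Δ : ℕ
  b = suc b-1
  p = suc p′
  2b = 2 ℕ.* b
  g = q ℕ./ 2b
  h = (p ℕ.* q) ℕ./ b
  Δ = h ℕ.∸ g

  1≤g : 1 ℕ.≤ g
  1≤g = ℕ.≤-trans (ℕ.≤-reflexive (sym (ℕ.n/n≡1 2b))) (ℕ./-monoˡ-≤ 2b 2b≤q)

  g≤q : g ℕ.≤ q
  g≤q = ℕ.m/n≤m q 2b

  -- Rounding down loses less than `2 b`, which is at most `2 b g` since `g ≥ 1`; this doubles the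
  -- constant.
  q≤4bg : q ℕ.≤ 4 ℕ.* b ℕ.* g
  q≤4bg = begin
    q                        ≡⟨ ℕ.m≡m%n+[m/n]*n q 2b ⟩
    q ℕ.% 2b ℕ.+ g ℕ.* 2b    ≤⟨ ℕ.+-monoˡ-≤ (g ℕ.* 2b) (ℕ.≤-trans (ℕ.<⇒≤ (ℕ.m%n<n q 2b)) (ℕ.≤-trans (ℕ.≤-reflexive (sym (ℕ.*-identityʳ 2b))) (ℕ.*-monoʳ-≤ 2b 1≤g))) ⟩
    2b ℕ.* g ℕ.+ g ℕ.* 2b    ≡⟨ solve 2 (λ b g → con 2 :* b :* g :+ g :* (con 2 :* b) := con 4 :* b :* g) refl b g ⟩
    4 ℕ.* b ℕ.* g            ∎

  2g≤h : g ℕ.+ g ℕ.≤ h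
  2g≤h = begin
    g ℕ.+ g                       ≡⟨ sym (ℕ.m*n/n≡m (g ℕ.+ g) b) ⟩
    (g ℕ.+ g) ℕ.* b ℕ./ b         ≤⟨ ℕ./-monoˡ-≤ b (begin
      (g ℕ.+ g) ℕ.* b               ≡⟨ solve 2 (λ g b → (g :+ g) :* b := g :* (con 2 :* b)) refl g b ⟩
      g ℕ.* 2b                      ≤⟨ ℕ.m/n*n≤m q 2b ⟩
      q                             ≤⟨ ℕ.m≤n*m q p ⟩
      p ℕ.* q                       ∎) ⟩
    h                             ∎

  g≤Δ : g ℕ.≤ Δ
  g≤Δ = ℕ.≤-trans (ℕ.≤-reflexive (sym (ℕ.m+n∸n≡m g g))) (ℕ.∸-monoˡ-≤ g 2g≤h)

  D≡ : 2 ℕ.* q ℕ.+ g ℕ.+ Δ ≡ 2 ℕ.* q ℕ.+ h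
  D≡ = trans (ℕ.+-assoc (2 ℕ.* q) g Δ) (cong (2 ℕ.* q ℕ.+_) (ℕ.m+[n∸m]≡n (ℕ.≤-trans (ℕ.m≤m+n g g) 2g≤h)))

  below : ∀ {k} → k ℕ.* b ℕ.≤ (2b ℕ.+ p) ℕ.* q → k ℕ.≤ 2 ℕ.* q ℕ.+ g ℕ.+ Δ
  below {k} le = ℕ.≤-trans (ℕ.s≤s⁻¹ (ℕ.*-cancelʳ-< b k (suc (2 ℕ.* q ℕ.+ h)) (begin-strict
    k ℕ.* b                                            ≤⟨ le ⟩
    (2b ℕ.+ p) ℕ.* q                                   ≡⟨ solve 3 (λ b p q → (con 2 :* b :+ p) :* q := con 2 :* q :* b :+ p :* q) refl b p q ⟩
    2 ℕ.* q ℕ.* b ℕ.+ p ℕ.* q                          ≡⟨ cong (2 ℕ.* q ℕ.* b ℕ.+_) (ℕ.m≡m%n+[m/n]*n (p ℕ.* q) b) ⟩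
    2 ℕ.* q ℕ.* b ℕ.+ ((p ℕ.* q) ℕ.% b ℕ.+ h ℕ.* b)    <⟨ ℕ.+-monoʳ-< (2 ℕ.* q ℕ.* b) (ℕ.+-monoˡ-< (h ℕ.* b) (ℕ.m%n<n (p ℕ.* q) b)) ⟩
    2 ℕ.* q ℕ.* b ℕ.+ (b ℕ.+ h ℕ.* b)                  ≡⟨ solve 3 (λ q b h → con 2 :* q :* b :+ (b :+ h :* b) := (con 1 :+ (con 2 :* q :+ h)) :* b) refl q b h ⟩
    suc (2 ℕ.* q ℕ.+ h) ℕ.* b                          ∎))) (ℕ.≤-reflexive (sym D≡))

  above : ∀ {m r} → (2b ℕ.+ p) ℕ.* q ℕ.* r ℕ.≤ m ℕ.* b → (2 ℕ.* q ℕ.+ g ℕ.+ Δ) ℕ.* r ℕ.≤ m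
  above {m} {r} le = ℕ.*-cancelʳ-≤ ((2 ℕ.* q ℕ.+ g ℕ.+ Δ) ℕ.* r) m b (begin
    (2 ℕ.* q ℕ.+ g ℕ.+ Δ) ℕ.* r ℕ.* b         ≡⟨ cong (λ t → t ℕ.* r ℕ.* b) D≡ ⟩
    (2 ℕ.* q ℕ.+ h) ℕ.* r ℕ.* b               ≡⟨ solve 4 (λ q h r b → (con 2 :* q :+ h) :* r :* b := (con 2 :* q :* b :+ h :* b) :* r) refl q h r b ⟩
    (2 ℕ.* q ℕ.* b ℕ.+ h ℕ.* b) ℕ.* r         ≤⟨ ℕ.*-monoˡ-≤ r (ℕ.+-monoʳ-≤ (2 ℕ.* q ℕ.* b) (ℕ.m/n*n≤m (p ℕ.* q) b)) ⟩
    (2 ℕ.* q ℕ.* b ℕ.+ p ℕ.* q) ℕ.* r         ≡⟨ solve 4 (λ q p r b → (con 2 :* q :* b :+ p :* q) :* r := (con 2 :* b :+ p) :* q :* r) refl q p r b ⟩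
    (2b ℕ.+ p) ℕ.* q ℕ.* r                    ≤⟨ le ⟩
    m ℕ.* b                                   ∎)

theorem2p16 : (ε : ℚ) → Positive ε →
    Σ ℕ (λ q₀ → ∀ (q : ℕ) → q₀ ≤ q →
    ∀ (n m k r : ℕ) (G : ColouredGraph n m k) →
    ColouredGraph.Proper G →
    ℕ→ℚ k ≤ℚ (ℕ→ℚ 2 + ε) * ℕ→ℚ q →
    (ℕ→ℚ 2 + ε) * ℕ→ℚ q * ℕ→ℚ r ≤ℚ ℕ→ℚ m →
    r ≤ q →
    (∀ (c : Fin k) → ColouredGraph.colourCount G c ≤ q) →
    ColouredGraph.RainbowMatching G r)
theorem2p16 (mkℚ (ℤ.+ zero) _ _) record { pos = () }
theorem2p16 (mkℚ ℤ.-[1+ _ ] _ _) record { pos = () }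
-- The summand `2 b` makes `g` positive, and `threshold` makes `d ≥ q` large enough for the nibble
-- at `c = 4 b`, the constant of `q≤4bg`.
theorem2p16 ε@(mkℚ (ℤ.+ suc p′) b-1 _) _ = 2 ℕ.* suc b-1 ℕ.+ threshold , main
  where
  open Matchings (4 ℕ.* suc b-1)
  open Scaling (suc p′) b-1

  main : ∀ q → 2 ℕ.* suc b-1 ℕ.+ threshold ℕ.≤ q → ∀ n m k r (G : ColouredGraph n m k) → ColouredGraph.Proper G →
    ℕ→ℚ k ≤ℚ (ℕ→ℚ 2 + ε) * ℕ→ℚ q → (ℕ→ℚ 2 + ε) * ℕ→ℚ q * ℕ→ℚ r ≤ℚ ℕ→ℚ m → r ℕ.≤ q →
    (∀ c → ColouredGraph.colourCount G c ℕ.≤ q) → ColouredGraph.RainbowMatching G r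
  main q q₀≤q n m k r G proper few many r≤q rare = rainbow
      (matching triples q g Δ 1≤g g≤q q≤4bg g≤Δ
        (ℕ.≤-trans (ℕ.≤-trans (ℕ.m≤n+m threshold 2b) q₀≤q) (ℕ.≤-trans (ℕ.m≤n*m q 2) (ℕ.m≤m+n (2 ℕ.* q) g)))
        r (allFin m) r≤q (Unique.allFin⁺ m) degree (λ e → ℕ.≤-trans (deg-colour _) (rare _))
        (ℕ.≤-trans (above (clear-lower ε refl m q r many)) (ℕ.≤-reflexive (sym (length-tabulate {n = m} (λ i → i))))))
    where
    open ColouredTriples G proper
    open Parameters p′ b-1 q (ℕ.≤-trans (ℕ.m≤m+n _ threshold) q₀≤q) using (g; Δ; 2b; 1≤g; g≤q; q≤4bg; g≤Δ; below; above)
    open LinearTripleSystem triples using (Disjoint)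
    open Incidence triples ℕ-orderedSemiring using (deg)

    degree : ∀ x → deg (allFin m) x ℕ.≤ 2 ℕ.* q ℕ.+ g ℕ.+ Δ
    degree (inj₁ a) = ℕ.≤-trans (deg-vertex a) (below (clear-upper ε refl k q few))
    degree (inj₂ c) = ℕ.≤-trans (deg-colour c) (ℕ.≤-trans (rare c)
      (ℕ.≤-trans (ℕ.m≤n*m q 2) (ℕ.≤-trans (ℕ.m≤m+n (2 ℕ.* q) g) (ℕ.m≤m+n _ Δ))))

    rainbow : (∃ λ M → (∀ {f} → f ∈ M → f ∈ allFin m) × AllPairs Disjoint M × length M ≡ r) → ColouredGraph.RainbowMatching G r
    rainbow (M , _ , disj , len) = toRainbow M disj len
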